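{- Let $(K,\mathcal{L})$ be a $C$-minimal valued field with characteristic exponent $p$, let $W$ be a definable set and let $f\colon X\subseteq W\times K\rightarrow K^\times$ be a definable family of functions defined at a neighborhood of infinity. Let $h\colon Y\subseteq W\times \Gamma_K\to \Gamma_K$ be a definable $\Gamma$-factorization of $f$ at infinity, namely, for every $w\in W$, $f_w$ factorizes at infinity over $\Gamma$ through $h_w$. If $h$ is eventually $\mathbb{Q}$-linear, then there are a finite definable partition of $W$ into sets $W_1\cup\dots\cup W_\ell$, integers $n_1,\ldots,n_\ell,m_1,\ldots,m_\ell \in \mathbb{Z}$ and a definable function $c\colon W\to \mathrm{RV}^*$, such that for every $i$ and all $w\in W_i$, for all $x$ in a neighborhood of infinity, \[ \mathrm{rv}(f_w(x)) = \mathrm{rv}(x)^{n_i/p^{m_i}}\, c(w). \] If in addition $(K,\mathcal{L})$ is definably complete and all definable unary $\Gamma$-functions are eventually linear, then for every $i$ and all $w\in W_i$ the limit \[ a(w):=\lim_{x\to \infty} \frac{f_w(x)}{x^{n_i/p^{m_i}}} \] exists in $K$ and $c(w)=\mathrm{rv}(a(w))$.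
   Context: Valued fields $(K,v)$ are non-trivially valued; $\Gamma_K$ is the value group, $\mathcal{M}_K$ the maximal ideal of the valuation ring. Closed balls are $B(a,\gamma)=\{x\in K: v(x-a)\geq\gamma\}$ for $a \in K$, $\gamma\in\Gamma_K\cup\{+\infty\}$; open balls are $B^\circ(a,\gamma)=\{x\in K: v(x-a)>\gamma\}$ for $a\in K$, $\gamma\in\Gamma_K\cup\{ -\infty\}$ (so points are closed balls and $K$ is an open ball). A ball is a closed or an open ball. $\mathcal{L}_{div}=(+,-,\cdot,0,1,\mathrm{div})$ is the language of valued fields, with $\mathrm{div}(x,y)$ interpreted as $v(x)\leq v(y)$. Let $K$ be an algebraically closed valued field and $(K,\mathcal{L})$ an expansion of $(K,\mathcal{L}_{div})$ ($\mathcal{L}\supseteq\mathcal{L}_{div}$). $(K,\mathcal{L})$ is $C$-minimal (a "$C$-minimal valued field") if for every structure $(K',\mathcal{L})$ elementarily equivalent to it, every $\mathcal{L}$-definable subset of $K'$ is a boolean combination of balls. "Definable" means $\mathcal{L}$-definable with parameters; for sets involving $\Gamma_K$ or $\mathrm{RV}$ it means interpretable. The characteristic exponent $p$ of $K$ is $1$ if $\mathrm{char}(K)=0$ and $\mathrm{char}(K)$ otherwise. $\mathrm{RV}^*=K^\times/(1+\mathcal{M}_K)$, $\mathrm{RV}=\mathrm{RV}^*\cup\{0\}$, and $\mathrm{rv}\colon K\to\mathrm{RV}$ is the quotient map with $\mathrm{rv}(0)=0$. When $p>1$, the $p$-th power map is bijective on $K^\times$ and on $\mathrm{RV}^*$,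 so $x^{n/p^m}$ is well defined in both; when $p=1$, $x^{n/p^m}=x^n$. A definable family $X\subseteq W\times K$ is a definable set whose projection to $W$ is all of $W$; $X_w=\{x: (w,x)\in X\}$. A definable family of functions is a definable function $f\colon X\subseteq W\times K\to K$, with fibers $f_w\colon X_w\to K$, $f_w(x)=f(w,x)$; similarly with $\Gamma_K$ in place of $K$. A neighborhood of infinity is a set $K\setminus B(0,\gamma)$ with $\gamma\in\Gamma_K$. The family $f$ is defined at a neighborhood of infinity if for every $w\in W$ the set $X_w$ contains a neighborhood of infinity. A function $g\colon Z\subseteq K\to K$ defined at a neighborhood of infinity factorizes at infinity over $\Gamma$ through a (possibly partial) function $h\colon\Gamma_K\to\Gamma_K$ if there is $\gamma_0\in\Gamma_K$ such that $v(g(x))=h(v(x))$ for all $x\in Z\setminus B(0,\gamma_0)$. A unary $\Gamma$-function is a function $g\colon\Gamma_K\to\Gamma_K$. It is eventually linear if there are $\delta,\alpha\in\Gamma_K$ and an endomorphism $\lambda$ of $(\Gamma_K,+)$ such that $g(\gamma)=\lambda(\gamma)+\alpha$ for all $\gamma\in\Gamma_K$ with $\gamma>\delta$; it is eventually $\mathbb{Q}$-linear if moreover $\lambda$ can be taken of the form $\lambda(\gamma)=r\gamma$ with $r\in\mathbb{Q}$ (the slope). A definable family $h$ of functions from $\Gamma_K$ to $\Gamma_K$ parametrized by $W$ is eventually $\mathbb{Q}$-linear if there is a finite set $Z_h\subseteq\mathbb{Q}$ such that for every $w\in W$ the function $h_w$ is eventually $\mathbb{Q}$-linear with slope $r\in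 Z_h$. $\lim_{x\to\infty}g(x)=b$ with $b\in K$ means: for every $\gamma\in\Gamma_K$ there is $\delta\in\Gamma_K$ such that $v(g(x)-b)>\gamma$ for all $x$ with $v(x)<\delta$. $(K,\mathcal{L})$ is definably complete if every definable family of nested balls whose set of radii tends to $+\infty$ has non-empty intersection.
   Formalization: "h is eventually ℚ-linear" is required for all sufficiently small γ (γ < δ), where h is related to f at infinity, instead of for γ > δ, where the possibly partial h need not be defined. -}

module Defs where

open import Algebra.Bundles using (AbelianGroup; RawGroup)
open import Algebra.Morphism.Structures using (module GroupMorphisms)
open import Algebra.Structures using (IsCommutativeRing)
import Algebra.Definitions.RawMonoid as RawMonoidDefs
open import Data.Empty.Polymorphic using (⊥)
open import Data.Fin.Base using (Fin)
open import Data.Integer.Base as ℤ using (ℤ; +_; -[1+_])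
open import Data.List.Base using (List)
open import Data.List.Membership.Propositional using () renaming (_∈_ to _∈ˡ_)
open import Data.Nat.Base as ℕ using (ℕ; zero; suc)
open import Data.Nat.Divisibility using (_∣_)
open import Data.Product.Base using (Σ; ∃; _×_; _,_; proj₁; proj₂)
open import Data.Rational.Base using (ℚ; ↥_; ↧_)
open import Data.Sum.Base using (_⊎_; inj₁; inj₂)
open import Data.Unit.Polymorphic using (⊤)
open import Data.Vec.Base using (Vec; []; _∷_; _++_; head; tail; lookup)
open import Data.Vec.Relation.Binary.Pointwise.Inductive using (Pointwise)
open import Function.Bundles using (_⇔_)
open import Function.Definitions using (Congruent)
open import Level using (Level; _⊔_) renaming (suc to lsuc)
open import Relation.Binary.Core using (Rel)
open import Relation.Binary.PropositionalEquality.Core using (_≡_; _≢_)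
open import Relation.Binary.Structures using (IsEquivalence; IsTotalOrder)
open import Relation.Nullary.Construct.Add.Supremum using (_⁺; ⊤⁺; [_])
open import Relation.Nullary.Construct.Add.Infimum using (_₋; ⊥₋)
open import Relation.Nullary.Construct.Add.Extrema using (_±)
open import Relation.Nullary.Negation.Core using (¬_)
open import Relation.Unary using (Pred; _≐_; _∪_; _∩_; ∁)
import Relation.Binary.Construct.Add.Supremum.Equality as SupEquality
import Relation.Binary.Construct.Add.Supremum.NonStrict as SupNonStrict
import Relation.Binary.Construct.Add.Supremum.Strict as SupStrict
import Relation.Binary.Construct.Add.Extrema.Strict as ExtremaStrict
import Relation.Binary.Construct.NonStrictToStrict as ToStrict

private
  variable
    a b ℓ : Level
    k n : ℕ

------------------------------------------------------------------------
-- First-order logic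

record Language a : Set (lsuc a) where
  field
    Function : ℕ → Set a
    Relation : ℕ → Set a

open Language

data Term (L : Language a) (n : ℕ) : Set a where
  var : Fin n → Term L n
  app : Function L k → Vec (Term L n) k → Term L n

infix  7 _≋_
infixr 6 _∧_
infixr 5 _∨_
infixr 4 _⇒_

-- `Formula L n` has n free variables; a quantifier binds variable 0.
data Formula (L : Language a) : ℕ → Set a where
  _≋_         : Term L n → Term L n → Formula L n
  rel         : Relation L k → Vec (Term L n) k → Formula L n
  false       : Formula L n
  _∧_ _∨_ _⇒_ : Formula L n → Formula L n → Formula L n
  all ex      : Formula L (suc n) → Formula L n

-- Carriers are setoids, so that structures which are quotients (such as
-- ultrapowers) are included.
record Structure (ℓ : Level) (L : Language a) : Set (a ⊔ lsuc ℓ) where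
  infix 4 _≈_
  field
    Carrier       : Set ℓ
    _≈_           : Rel Carrier ℓ
    isEquivalence : IsEquivalence _≈_
    function      : Function L k → Vec Carrier k → Carrier
    function-cong : ∀ (g : Function L k) {xs ys} →
                    Pointwise _≈_ xs ys → function g xs ≈ function g ys
    relation      : Relation L k → Vec Carrier k → Set ℓ
    relation-cong : ∀ (R : Relation L k) {xs ys} →
                    Pointwise _≈_ xs ys → relation R xs → relation R ys

module _ {L : Language a} (M : Structure ℓ L) where
  open Structure M

  mutual
    ⟦_⟧ : Term L n → Vec Carrier n → Carrier
    ⟦ var i ⟧    ρ = lookup ρ i
    ⟦ app g ts ⟧ ρ = function g (⟦ ts ⟧* ρ)

    ⟦_⟧* : Vec (Term L n) k → Vec Carrier n → Vec Carrier k
    ⟦ [] ⟧*     ρ = []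
    ⟦ t ∷ ts ⟧* ρ = ⟦ t ⟧ ρ ∷ ⟦ ts ⟧* ρ

  Holds : Formula L n → Pred (Vec Carrier n) ℓ
  Holds (s ≋ t)    ρ = ⟦ s ⟧ ρ ≈ ⟦ t ⟧ ρ
  Holds (rel R ts) ρ = relation R (⟦ ts ⟧* ρ)
  Holds false      ρ = ⊥
  Holds (φ ∧ ψ)    ρ = Holds φ ρ × Holds ψ ρ
  Holds (φ ∨ ψ)    ρ = Holds φ ρ ⊎ Holds ψ ρ
  Holds (φ ⇒ ψ)    ρ = Holds φ ρ → Holds ψ ρ
  Holds (all φ)    ρ = ∀ x → Holds φ (x ∷ ρ)
  Holds (ex φ)     ρ = ∃ λ x → Holds φ (x ∷ ρ)

  -- Definability with parameters.
  Definable : Pred (Vec Carrier n) ℓ → Set (a ⊔ ℓ)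
  Definable {n} P = ∃ λ k → Σ (Formula L (n ℕ.+ k)) λ φ → Σ (Vec Carrier k) λ ps →
    ∀ xs → P xs ⇔ Holds φ (xs ++ ps)

ElementarilyEquivalent : {L : Language a} → Structure ℓ L → Structure ℓ L → Set (a ⊔ ℓ)
ElementarilyEquivalent {L = L} M N = (φ : Formula L 0) → Holds M φ [] ⇔ Holds N φ []

------------------------------------------------------------------------
-- Expansions of the language of valued fields

data DivFunction : ℕ → Set where
  plus times : DivFunction 2
  minus      : DivFunction 1
  zer one    : DivFunction 0

data DivRelation : ℕ → Set where
  div : DivRelation 2

-- A language containing L_div is L_div together with the symbols of a
-- further language E.
Ldiv+_ : Language a → Language a
Ldiv+ E = record
  { Function = λ k → DivFunction k ⊎ Function E k
  ; Relation = λ k → DivRelation k ⊎ Relation E k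
  }

------------------------------------------------------------------------
-- Ordered abelian groups and valued fields

module _ (G : RawGroup a b) where
  open RawGroup G
  open RawMonoidDefs rawMonoid using () renaming (_×_ to _×ᴳ_)

  pow : ℤ → Carrier → Carrier
  pow (+ n)    x = n ×ᴳ x
  pow -[1+ n ] x = (suc n ×ᴳ x) ⁻¹

record OrderedAbelianGroup ℓ : Set (lsuc ℓ) where
  infix 4 _≤_
  field
    abelianGroup : AbelianGroup ℓ ℓ

  open AbelianGroup abelianGroup public
    renaming (_∙_ to _+_; ε to 0#; _⁻¹ to -_)

  field
    _≤_          : Rel Carrier ℓ
    isTotalOrder : IsTotalOrder _≈_ _≤_
    +-monoˡ-≤    : ∀ γ {α β} → α ≤ β → (γ + α) ≤ (γ + β)

  open ToStrict _≈_ _≤_ public using (_<_)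
  open SupEquality _≈_ public using (_≈⁺_)
  open SupNonStrict _≤_ public using (_≤⁺_)
  open SupStrict _<_ public using (_<⁺_)
  open ExtremaStrict _<_ public using (_<±_)

  infixl 6 _+⁺_
  _+⁺_ : Carrier ⁺ → Carrier ⁺ → Carrier ⁺
  [ α ] +⁺ [ β ] = [ α + β ]
  [ α ] +⁺ ⊤⁺    = ⊤⁺
  ⊤⁺    +⁺ _     = ⊤⁺

-- `ValuedField M` says that the L_div-reduct of M is a non-trivially
-- valued field.  The value group is determined by M only up to
-- isomorphism, and is part of the data.
record ValuedField {E : Language a} (M : Structure ℓ (Ldiv+ E)) : Set (a ⊔ lsuc ℓ) where
  open Structure M public renaming (Carrier to K)

  infixl 6 _+_
  infixl 7 _*_
  infix  8 -_

  _+_ : K → K → K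
  x + y = function (inj₁ plus) (x ∷ y ∷ [])

  _*_ : K → K → K
  x * y = function (inj₁ times) (x ∷ y ∷ [])

  -_ : K → K
  - x = function (inj₁ minus) (x ∷ [])

  0# : K
  0# = function (inj₁ zer) []

  1# : K
  1# = function (inj₁ one) []

  Div : Rel K ℓ
  Div x y = relation (inj₁ div) (x ∷ y ∷ [])

  field
    isCommutativeRing : IsCommutativeRing _≈_ _+_ _*_ -_ 0# 1#
    0≉1               : ¬ 0# ≈ 1#
    inverse           : ∀ x → ¬ x ≈ 0# → ∃ λ y → x * y ≈ 1#
    orderedGroup      : OrderedAbelianGroup ℓ

  module Γ = OrderedAbelianGroup orderedGroup
  open Γ public using (_≤_; _<_; _≈⁺_; _≤⁺_; _<⁺_; _<±_; _+⁺_)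

  field
    v            : K → Γ.Carrier ⁺
    v-cong       : ∀ {x y} → x ≈ y → v x ≈⁺ v y
    v-∞          : ∀ x → v x ≈⁺ ⊤⁺ ⇔ x ≈ 0#
    v-*          : ∀ x y → v (x * y) ≈⁺ v x +⁺ v y
    v-+          : ∀ x y {γ} → γ ≤⁺ v x → γ ≤⁺ v y → γ ≤⁺ v (x + y)
    v-surjective : ∀ γ → ∃ λ x → v x ≈⁺ [ γ ]
    v-nontrivial : ∃ λ γ → ¬ γ Γ.≈ Γ.0#
    div-v        : ∀ x y → Div x y ⇔ v x ≤⁺ v y

module _ {E : Language a} {M : Structure ℓ (Ldiv+ E)} (V : ValuedField M) where
  open ValuedField V

  ----------------------------------------------------------------------
  -- Algebraic closedness and characteristic exponent

  -- a₀ + a₁ x + ⋯ + aₙ₋₁ xⁿ⁻¹ + c xⁿ, by Horner's rule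
  evalPoly : Vec K n → K → K → K
  evalPoly []       c x = c
  evalPoly (a ∷ as) c x = a + x * evalPoly as c x

  AlgebraicallyClosed : Set ℓ
  AlgebraicallyClosed = ∀ {d} (as : Vec K (suc d)) (c : K) → ¬ c ≈ 0# →
    ∃ λ x → evalPoly as c x ≈ 0#

  fromℕ : ℕ → K
  fromℕ zero    = 0#
  fromℕ (suc n) = 1# + fromℕ n

  Characteristic : ℕ → Set ℓ
  Characteristic q = ∀ n → fromℕ n ≈ 0# ⇔ q ∣ n

  CharacteristicExponent : ℕ → Set ℓ
  CharacteristicExponent p =
    (Characteristic 0 × p ≡ 1) ⊎ (Characteristic p × p ≢ 0)

  ----------------------------------------------------------------------
  -- Balls and C-minimality

  data Ball : Set ℓ where
    closed : K → Γ.Carrier ⁺ → Ball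
    open′  : K → Γ.Carrier ₋ → Ball

  members : Ball → Pred K ℓ
  members (closed a γ)    x = γ ≤⁺ v (x + - a)
  members (open′ a [ γ ]) x = [ γ ] <⁺ v (x + - a)
  members (open′ a ⊥₋)    x = ⊤

  radius : Ball → Γ.Carrier ±
  radius (closed a [ γ ]) = [ [ γ ] ]
  radius (closed a ⊤⁺)    = ⊤⁺
  radius (open′ a γ)      = [ γ ]

  data BooleanCombinationOfBalls : Pred K ℓ → Set (lsuc ℓ) where
    ball  : ∀ B → BooleanCombinationOfBalls (members B)
    compl : ∀ {P} → BooleanCombinationOfBalls P → BooleanCombinationOfBalls (∁ P)
    union : ∀ {P Q} → BooleanCombinationOfBalls P → BooleanCombinationOfBalls Q →
            BooleanCombinationOfBalls (P ∪ Q)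
    inter : ∀ {P Q} → BooleanCombinationOfBalls P → BooleanCombinationOfBalls Q →
            BooleanCombinationOfBalls (P ∩ Q)
    resp  : ∀ {P Q} → P ≐ Q → BooleanCombinationOfBalls P → BooleanCombinationOfBalls Q

-- An L-structure elementarily equivalent to a valued field is again a
-- valued field; V′ below ranges over the presentations of its (unique)
-- valuation inducing div.  By Löwenheim–Skolem, restricting M′ to the
-- universe level of the language and of M is harmless.
CMinimal : {E : Language a} (M : Structure ℓ (Ldiv+ E)) → Set (a ⊔ lsuc ℓ)
CMinimal {ℓ = ℓ} M = ∀ M′ → ElementarilyEquivalent M′ M → (V′ : ValuedField M′) →
  (P : Pred (Structure.Carrier M′) ℓ) → Definable M′ (λ (xs : Vec _ 1) → P (head xs)) →
  BooleanCombinationOfBalls V′ P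

module _ {E : Language a} {M : Structure ℓ (Ldiv+ E)} (V : ValuedField M) where
  open ValuedField V
  private module R = IsCommutativeRing isCommutativeRing

  ----------------------------------------------------------------------
  -- The groups K^× and RV^*

  K* : Set ℓ
  K* = Σ K λ x → ¬ x ≈ 0#

  *-nonzero : ∀ {x y} → ¬ x ≈ 0# → ¬ y ≈ 0# → ¬ x * y ≈ 0#
  *-nonzero {x} {y} x≉0 y≉0 xy≈0 with inverse x x≉0
  ... | x′ , xx′≈1 = y≉0 (R.trans (R.sym (R.*-identityˡ y))
    (R.trans (R.*-congʳ (R.trans (R.sym xx′≈1) (R.*-comm x x′)))
    (R.trans (R.*-assoc x′ x y) (R.trans (R.*-congˡ xy≈0) (R.zeroʳ x′)))))

  inverse-nonzero : ∀ {x y} → x * y ≈ 1# → ¬ y ≈ 0#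
  inverse-nonzero {x} xy≈1 y≈0 =
    0≉1 (R.trans (R.sym (R.zeroʳ x)) (R.trans (R.*-congˡ (R.sym y≈0)) xy≈1))

  Kˣ : RawGroup ℓ ℓ
  Kˣ = record
    { Carrier = K*
    ; _≈_     = λ x y → proj₁ x ≈ proj₁ y
    ; _∙_     = λ x y → proj₁ x * proj₁ y , *-nonzero (proj₂ x) (proj₂ y)
    ; ε       = 1# , λ 1≈0 → 0≉1 (R.sym 1≈0)
    ; _⁻¹     = λ x → proj₁ (inverse (proj₁ x) (proj₂ x)) ,
                      inverse-nonzero (proj₂ (inverse (proj₁ x) (proj₂ x)))
    }

  infix 4 _∈𝓜
  _∈𝓜 : Pred K ℓ
  m ∈𝓜 = [ Γ.0# ] <⁺ v m

  -- RV^* = K^× / (1 + 𝓜) keeps the carrier of K^× and coarsens its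
  -- equality, so that rv is the identity on K^×.
  RV* : RawGroup ℓ ℓ
  RV* = record
    { RawGroup Kˣ
    ; _≈_ = λ x y → ∃ λ m → m ∈𝓜 × proj₁ x ≈ proj₁ y * (1# + m)
    }

  rv : K* → RawGroup.Carrier RV*
  rv x = x

  -- y = x^(n / p^m).  For p the characteristic exponent there is exactly
  -- one such y, both in K^× and in RV^*.
  IsPower : (G : RawGroup ℓ ℓ) (x : RawGroup.Carrier G) (n : ℤ) (p : ℕ) (m : ℤ) →
            RawGroup.Carrier G → Set ℓ
  IsPower G x n p (+ m)    y = RawGroup._≈_ G (pow G (+ (p ℕ.^ m)) y) (pow G n x)
  IsPower G x n p -[1+ m ] y = RawGroup._≈_ G y (pow G (n ℤ.* + (p ℕ.^ suc m)) x)

  ----------------------------------------------------------------------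
  -- Definable maps
  --
  -- Partial maps are given by total Agda functions together with a
  -- domain: values off the domain play no role.  Objects over Γ_K or
  -- RV^* are definable (that is, interpretable) when their preimages in
  -- powers of K are.  Since formulas respect _≈_, definability of the
  -- graph already makes maps compatible with _≈_ on K.

  -- a definable family of functions f : X ⊆ W × K → K^×
  record KFamily (W : Pred (Vec K n) ℓ) : Set (a ⊔ lsuc ℓ) where
    field
      X         : Vec K n → Pred K ℓ
      f         : Vec K n → K → K*
      domain    : ∀ {w} → (∃ λ x → X w x) ⇔ W w
      definable : Definable M {n = suc (suc n)} λ where
        (x ∷ y ∷ w) → X w x × y ≈ proj₁ (f w x)

  -- a definable family of functions h : Y ⊆ W × Γ_K → Γ_K
  record ΓFamily (W : Pred (Vec K n) ℓ) : Set (a ⊔ lsuc ℓ) where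
    field
      Y         : Vec K n → Pred Γ.Carrier ℓ
      h         : Vec K n → Γ.Carrier → Γ.Carrier
      domain    : ∀ {w} → (∃ λ γ → Y w γ) ⇔ W w
      Y-resp    : ∀ {w γ δ} → γ Γ.≈ δ → Y w γ → Y w δ
      h-cong    : ∀ {w γ δ} → γ Γ.≈ δ → Y w γ → h w γ Γ.≈ h w δ
      definable : Definable M {n = suc (suc n)} λ where
        (x ∷ y ∷ w) → ∃ λ γ → v x ≈⁺ [ γ ] × Y w γ × v y ≈⁺ [ h w γ ]

  DefinableΓ→Γ : (Γ.Carrier → Γ.Carrier) → Set (a ⊔ ℓ)
  DefinableΓ→Γ g = Congruent Γ._≈_ Γ._≈_ g × Definable M {n = 2} λ where
    (x ∷ y ∷ []) → ∃ λ γ → v x ≈⁺ [ γ ] × v y ≈⁺ [ g γ ]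

  -- a definable function c : W → RV^*
  DefinableRV : Pred (Vec K n) ℓ → (Vec K n → RawGroup.Carrier RV*) → Set (a ⊔ ℓ)
  DefinableRV {n} W c = Definable M {n = suc n} λ where
    (y ∷ w) → W w × ∃ λ y≉0 → RawGroup._≈_ RV* (rv (y , y≉0)) (c w)

  ----------------------------------------------------------------------
  -- Behaviour at infinity

  -- P holds on K ∖ B(0,γ) for some γ ∈ Γ_K, that is, where v x < γ
  -- (so that in particular x ≠ 0).
  NearInfinity : Pred K* ℓ → Set ℓ
  NearInfinity P = ∃ λ γ → ∀ x → v (proj₁ x) <⁺ [ γ ] → P x

  DefinedNearInfinity : {W : Pred (Vec K n) ℓ} → KFamily W → Set ℓ
  DefinedNearInfinity {W = W} F = ∀ w → W w → NearInfinity λ x → X w (proj₁ x)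
    where open KFamily F

  FactorizesAtInfinity : {W : Pred (Vec K n) ℓ} → KFamily W → ΓFamily W → Set ℓ
  FactorizesAtInfinity {W = W} F H = ∀ w → W w → NearInfinity λ x → X w (proj₁ x) →
    ∃ λ γ → v (proj₁ x) ≈⁺ [ γ ] × Y w γ × v (proj₁ (f w (proj₁ x))) ≈⁺ [ h w γ ]
    where
    open KFamily F
    open ΓFamily H

  -- lim_{x → ∞} g(x) = b, for g given by its graph
  Limit : (K* → Pred K ℓ) → K → Set ℓ
  Limit g b = ∀ γ → NearInfinity λ x → ∃ λ y → g x y × [ γ ] <⁺ v (y + - b)

  ----------------------------------------------------------------------
  -- Eventual linearity

  IsEndomorphism : (Γ.Carrier → Γ.Carrier) → Set ℓ
  IsEndomorphism = GroupMorphisms.IsGroupHomomorphism Γ.rawGroup Γ.rawGroup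

  EventuallyLinear : (Γ.Carrier → Γ.Carrier) → Set ℓ
  EventuallyLinear g = ∃ λ δ → ∃ λ α → ∃ λ Λ → IsEndomorphism Λ ×
    (∀ γ → δ < γ → g γ Γ.≈ (Λ γ Γ.+ α))

  -- Λ γ = r γ; the group Γ_K of an algebraically closed K is divisible and
  -- torsion-free, so this determines Λ.
  IsMultiplication : ℚ → (Γ.Carrier → Γ.Carrier) → Set ℓ
  IsMultiplication r Λ =
    ∀ γ → pow Γ.rawGroup (↧ r) (Λ γ) Γ.≈ pow Γ.rawGroup (↥ r) γ

  -- A factorization h_w at infinity is evaluated at v x for x → ∞, that is,
  -- as v x → -∞: for h_w, "eventually" refers to all sufficiently small γ,
  -- the end of Γ_K at which h_w is related to f_w.
  EventuallyℚLinearAtInfinity : {W : Pred (Vec K n) ℓ} → ΓFamily W → Set ℓ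
  EventuallyℚLinearAtInfinity {W = W} H = ∃ λ (Z : List ℚ) → ∀ w → W w →
    ∃ λ r → r ∈ˡ Z × ∃ λ δ → ∃ λ α → ∃ λ Λ → IsEndomorphism Λ × IsMultiplication r Λ ×
      (∀ γ → γ < δ → Y w γ × h w γ Γ.≈ (Λ γ Γ.+ α))
    where open ΓFamily H

  AllDefinableΓ→ΓEventuallyLinear : Set (a ⊔ ℓ)
  AllDefinableΓ→ΓEventuallyLinear = ∀ g → DefinableΓ→Γ g → EventuallyLinear g

  ----------------------------------------------------------------------
  -- Definable completeness and partitions

  DefinablyComplete : Set (a ⊔ lsuc ℓ)
  DefinablyComplete = ∀ {n} (W : Pred (Vec K n) ℓ) (X : Vec K n → Pred K ℓ) →
    Definable M W → Definable M (λ xs → X (tail xs) (head xs)) →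
    (∀ {w} → (∃ λ x → X w x) ⇔ W w) →
    (∀ w → W w → ∃ λ B → X w ≐ members V B) →
    (∀ w w′ → W w → W w′ → (∀ x → X w x → X w′ x) ⊎ (∀ x → X w′ x → X w x)) →
    (∀ γ → ∃ λ w → W w × ∃ λ B → X w ≐ members V B × [ [ γ ] ] <± radius V B) →
    ∃ λ x → ∀ w → W w → X w x

  record IsDefinablePartition (W : Pred (Vec K n) ℓ) {k} (P : Fin k → Pred (Vec K n) ℓ) :
                              Set (a ⊔ ℓ) where
    field
      definable : ∀ i → Definable M (P i)
      covers    : ∀ w → W w ⇔ (∃ λ i → P i w)
      disjoint  : ∀ {i j w} → P i w → P j w → i ≡ j

  ----------------------------------------------------------------------
  -- The two conclusions

  -- rv (f_w(x)) = rv(x)^(n / p^m) c for all x in a neighborhood of infinity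
  RVMonomialAtInfinity : {W : Pred (Vec K n) ℓ} → KFamily W → Vec K n →
                         ℤ → ℕ → ℤ → RawGroup.Carrier RV* → Set ℓ
  RVMonomialAtInfinity F w n p m c = NearInfinity λ x → X w (proj₁ x) ×
    ∃ λ z → IsPower RV* (rv x) n p m z × rv (f w (proj₁ x)) ∼ (z ∙ c)
    where
    open KFamily F
    open RawGroup RV* renaming (_≈_ to _∼_)

  -- the graph of x ↦ f_w(x) / x^(n / p^m)
  Quotient : {W : Pred (Vec K n) ℓ} → KFamily W → Vec K n →
             ℤ → ℕ → ℤ → K* → Pred K ℓ
  Quotient F w n p m x y = X w (proj₁ x) ×
    ∃ λ z → IsPower Kˣ x n p m z × y ≈ proj₁ (f w (proj₁ x) ∙ z ⁻¹)
    where
    open KFamily F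
    open RawGroup Kˣ using (_∙_; _⁻¹)

  -- lim_{x → ∞} f_w(x) / x^(n / p^m) exists in K and its class in RV is c
  -- (so it is nonzero, c being in RV^*).
  HasLimitWithRV : {W : Pred (Vec K n) ℓ} → KFamily W → Vec K n →
                   ℤ → ℕ → ℤ → RawGroup.Carrier RV* → Set ℓ
  HasLimitWithRV F w n p m c = ∃ λ a → Limit (Quotient F w n p m) a ×
    ∃ λ a≉0 → RawGroup._≈_ RV* c (rv (a , a≉0))

{-# OPTIONS --safe #-}

-- Let f have slope a/b at infinity.  After the substitution x = tᵇ, the
-- function u(t) = f(tᵇ)/tᵃ has eventually constant valuation, and everything
-- follows from the fact that a bounded definable function u of one variable
-- has a limit at infinity up to any prescribed precision: rv(u(t)) is then
-- eventually constant; for ζᵇ = 1 the germs of u(ζt) = ζ⁻ᵃu(t) and u(t) are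
-- arbitrarily close, so ζ = 1 and b is a power of the characteristic exponent;
-- and definable completeness turns the approximate limits into a limit.
--
-- The fact itself uses C-minimality of the given structure only.  A boolean
-- combination of balls contains or avoids a neighborhood of infinity, it
-- contains or avoids {v(x) = γ} for all but finitely many γ, and similarly for
-- the residue classes of the valuation ring.  Hence a definable equivalence
-- relation near infinity either is eventually trivial or eventually refines
-- v(y) = v(y′), and no definable decreasing family of subsets of the residue
-- field indexed by the value group has empty intersection without being
-- eventually empty.  It follows that for definable g and t ≠ 0 the class
-- rv(g(ty)/g(y)) eventually depends on v(y) only, and therefore that
-- v(g(ty)) − v(g(y)) is eventually constant, because a definable section of
-- rv over infinitely many γ would not be a boolean combination of balls.
-- Consequently v(g(y)) cannot tend to some γ without being eventually equal
-- to it, so that no proper supremum of the attainable precisions exists.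

module Submission where

open import Algebra.Bundles using (CommutativeRing; RawGroup; RawRing)
import Algebra.Definitions.RawMonoid as RawMonoidDefs
open import Algebra.Morphism.Structures using (module GroupMorphisms)
import Algebra.Properties.AbelianGroup as AbelianGroupProps
import Algebra.Properties.CommutativeSemigroup as CSProps
import Algebra.Properties.CommutativeSemiring.Exp as Exp
import Algebra.Properties.Ring as RingProps
import Algebra.Properties.Semiring.Mult.TCOptimised as Mult
import Algebra.Solver.Ring
open import Algebra.Solver.Ring.AlmostCommutativeRing using (fromCommutativeRing; _-Raw-AlmostCommutative⟶_)
open import Axiom.ExcludedMiddle using (ExcludedMiddle)
open import Data.Empty using () renaming (⊥ to ⊥₀)
open import Data.Empty.Polymorphic using (⊥; ⊥-elim)
open import Data.Fin.Base using (Fin; zero; suc; _↑ˡ_; _↑ʳ_; splitAt)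
open import Data.Fin.Patterns using (0F; 1F; 2F; 3F; 4F)
open import Data.Integer.Base as ℤ using (ℤ; +_; -[1+_])
open import Data.List.Base as List using (List; []; _∷_; _++_; map; length)
open import Data.List.Membership.Propositional using (_∈_)
open import Data.List.Relation.Unary.All as All using (All; []; _∷_)
import Data.List.Relation.Unary.All.Properties as All
open import Data.List.Relation.Unary.Any using (here; there)
open import Data.Maybe.Base using (Maybe; just; nothing)
open import Data.Nat.Base as ℕ using (ℕ; zero; suc)
open import Data.Nat.Coprimality as Coprimality using (Coprime; coprime-Bézout)
open import Data.Nat.Divisibility using (_∣_; divides; 0∣⇒≡0)
open import Data.Nat.GCD using (module Bézout)
open import Data.Nat.ListAction using (product)
open import Data.Nat.ListAction.Properties using (∈⇒∣product)
open import Data.Nat.Primality using (Prime; prime⇒irreducible; ¬prime[0]; ¬prime[1])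
open import Data.Nat.Primality.Factorisation using (factorise; PrimeFactorisation)
import Data.Nat.Properties as ℕ
open import Data.Product.Base as Product using (Σ; ∃; _×_; _,_; proj₁; proj₂)
open import Data.Rational.Base using (ℚ; mkℚ; ↥_; ↧ₙ_)
open import Data.Sum.Base as Sum using (_⊎_; inj₁; inj₂)
open import Data.Vec.Base as Vec using (Vec; []; _∷_; lookup; head; take; drop) renaming (_++_ to _++ᵛ_)
import Data.Vec.Properties as Vec
open import Data.Vec.Relation.Binary.Pointwise.Inductive as Pointwise using (Pointwise; []; _∷_)
open import Function.Base using (_∘_; case_of_; id; _|>′_)
open import Function.Bundles using (_⇔_; mk⇔; module Equivalence)
open import Level using () renaming (suc to lsuc)
import Relation.Binary.Construct.Add.Infimum.Strict as InfStrict
import Relation.Binary.Construct.Add.Supremum.Equality as SupEq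
import Relation.Binary.Construct.Add.Supremum.NonStrict as SupNS
import Relation.Binary.Construct.Add.Supremum.Strict as SupStrict
open import Relation.Binary.PropositionalEquality as ≡ using (_≡_)
import Relation.Binary.Reasoning.Setoid as SetoidReasoning
open import Relation.Binary.Structures using (IsEquivalence; IsTotalOrder)
open import Relation.Nullary.Construct.Add.Infimum using (⊥₋)
open import Relation.Nullary.Construct.Add.Supremum using (⊤⁺; [_])
open import Relation.Nullary.Decidable.Core using (yes; no; decidable-stable)
open import Relation.Nullary.Negation.Core using (¬_; contradiction)
open import Relation.Unary using (Pred; _≐_)
open import Defs

-- It yields an eventual residue for a quotient of definable functions with values in the valuation
-- ring, and it turns invariance under each unit separately into invariance under all units at once.
-- The two alternatives for an equivalence relation are decided by comparing `y` with `π * y`, where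
-- `π` has negative valuation: an equivalence between these points refutes the injective
-- alternative. This is why v(g(y)) cannot approach v(l) without reaching it: a nonzero constant
-- difference would keep v(g(πy)) and v(g(y)) apart although both approach v(l), and a zero
-- difference leaves only an eventually constant v(g(y)). The value group need not be Dedekind
-- complete; the suprema used exist because a definable cut is a boolean combination of balls.

-- Integer coefficients for the ring solver

module DifferenceCoefficients {c ℓ} (R : CommutativeRing c ℓ) where
  open CommutativeRing R
  open RingProps ring using (-‿distribˡ-*; -‿distribʳ-*; -‿involutive; -0#≈0#)
  open AbelianGroupProps +-abelianGroup using (⁻¹-∙-comm)
  open CSProps +-commutativeSemigroup using (interchange)
  open Mult semiring using (×-homo-+; ×1-homo-*) renaming (_×_ to _·_)
  open SetoidReasoning setoid

  -- Equality in `R` need not be decidable, so the solver computes with integers. The pair `(a , b)`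
  -- stands for a - b; the homomorphism laws then need no case distinction on signs.
  Differences : RawRing _ _
  Differences = record
    { Carrier = ℕ × ℕ
    ; _≈_     = _≡_
    ; _+_     = λ { (a , b) (c , d) → a ℕ.+ c , b ℕ.+ d }
    ; _*_     = λ { (a , b) (c , d) → a ℕ.* c ℕ.+ b ℕ.* d , a ℕ.* d ℕ.+ b ℕ.* c }
    ; -_      = λ { (a , b) → b , a }
    ; 0#      = 0 , 0
    ; 1#      = 1 , 0
    }

  -- The first clause makes the values of (0 , 0) and (1 , 0) the constants
  -- 0# and 1# themselves.
  value : ℕ × ℕ → Carrier
  value (a , zero)  = a · 1#
  value (a , suc b) = a · 1# + - (suc b · 1#)

  private
    sum-of-differences : ∀ x y z w → (x + z) + - (y + w) ≈ (x + - y) + (z + - w)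
    sum-of-differences x y z w = trans (+-congˡ (sym (⁻¹-∙-comm y w))) (interchange x z (- y) (- w))

    product-of-differences : ∀ x y z w →
      (x * z + y * w) + - (x * w + y * z) ≈ (x + - y) * (z + - w)
    product-of-differences x y z w = sym (begin
      (x + - y) * (z + - w)                          ≈⟨ distribʳ _ _ _ ⟩
      x * (z + - w) + - y * (z + - w)                ≈⟨ +-cong (distribˡ _ _ _) (distribˡ _ _ _) ⟩
      (x * z + x * - w) + (- y * z + - y * - w)      ≈⟨ +-congˡ (+-comm _ _) ⟩
      (x * z + x * - w) + (- y * - w + - y * z)      ≈⟨ interchange _ _ _ _ ⟩
      (x * z + - y * - w) + (x * - w + - y * z)      ≈⟨ +-cong (+-congˡ (trans (sym (-‿distribˡ-* _ _)) (trans (-‿cong (sym (-‿distribʳ-* _ _))) (-‿involutive _)))) (+-cong (sym (-‿distribʳ-* _ _)) (sym (-‿distribˡ-* _ _))) ⟩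
      (x * z + y * w) + (- (x * w) + - (y * z))      ≈⟨ +-congˡ (⁻¹-∙-comm _ _) ⟩
      (x * z + y * w) + - (x * w + y * z)            ∎)

    value≈ : ∀ a b → value (a , b) ≈ a · 1# + - (b · 1#)
    value≈ a zero    = sym (trans (+-congˡ -0#≈0#) (+-identityʳ _))
    value≈ a (suc b) = refl

  morphism : Differences -Raw-AlmostCommutative⟶ fromCommutativeRing R
  morphism = record
    { ⟦_⟧    = value
    ; +-homo = λ { (a , b) (c , d) → begin
        value (a ℕ.+ c , b ℕ.+ d)                         ≈⟨ value≈ (a ℕ.+ c) (b ℕ.+ d) ⟩
        (a ℕ.+ c) · 1# + - ((b ℕ.+ d) · 1#)               ≈⟨ +-cong (×-homo-+ 1# a c) (-‿cong (×-homo-+ 1# b d)) ⟩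
        (a · 1# + c · 1#) + - (b · 1# + d · 1#)           ≈⟨ sum-of-differences _ _ _ _ ⟩
        (a · 1# + - (b · 1#)) + (c · 1# + - (d · 1#))     ≈⟨ +-cong (value≈ a b) (value≈ c d) ⟨
        value (a , b) + value (c , d)                     ∎ }
    ; *-homo = λ { (a , b) (c , d) → begin
        value (a ℕ.* c ℕ.+ b ℕ.* d , a ℕ.* d ℕ.+ b ℕ.* c) ≈⟨ value≈ (a ℕ.* c ℕ.+ b ℕ.* d) (a ℕ.* d ℕ.+ b ℕ.* c) ⟩
        (a ℕ.* c ℕ.+ b ℕ.* d) · 1# + - ((a ℕ.* d ℕ.+ b ℕ.* c) · 1#)
          ≈⟨ +-cong (trans (×-homo-+ 1# (a ℕ.* c) (b ℕ.* d)) (+-cong (×1-homo-* a c) (×1-homo-* b d)))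
                    (-‿cong (trans (×-homo-+ 1# (a ℕ.* d) (b ℕ.* c)) (+-cong (×1-homo-* a d) (×1-homo-* b c)))) ⟩
        _                                                 ≈⟨ product-of-differences _ _ _ _ ⟩
        (a · 1# + - (b · 1#)) * (c · 1# + - (d · 1#))     ≈⟨ *-cong (value≈ a b) (value≈ c d) ⟨
        value (a , b) * value (c , d)                     ∎ }
    ; -‿homo = λ { (a , b) → begin
        value (b , a)                                     ≈⟨ value≈ b a ⟩
        b · 1# + - (a · 1#)                               ≈⟨ +-comm _ _ ⟩
        - (a · 1#) + b · 1#                               ≈⟨ +-congˡ (-‿involutive _) ⟨
        - (a · 1#) + - - (b · 1#)                         ≈⟨ ⁻¹-∙-comm _ _ ⟩
        - (a · 1# + - (b · 1#))                           ≈⟨ -‿cong (value≈ a b) ⟨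
        - value (a , b)                                   ∎ }
    ; 0-homo = refl
    ; 1-homo = refl
    }

  -- Only the integers are compared: `nothing` is a safe answer even where the values agree in `R`,
  -- as may happen in positive characteristic.
  _≟ᵛ_ : ∀ p q → Maybe (value p ≈ value q)
  (a , b) ≟ᵛ (c , d) with a ℕ.+ d ℕ.≟ c ℕ.+ b
  ... | no  _  = nothing
  ... | yes eq = just (begin
    value (a , b)                                 ≈⟨ value≈ a b ⟩
    a · 1# + - (b · 1#)                           ≈⟨ +-identityʳ _ ⟨
    (a · 1# + - (b · 1#)) + 0#                    ≈⟨ +-congˡ (-‿inverseʳ (d · 1#)) ⟨
    (a · 1# + - (b · 1#)) + (d · 1# + - (d · 1#)) ≈⟨ interchange _ _ _ _ ⟩
    (a · 1# + d · 1#) + (- (b · 1#) + - (d · 1#)) ≈⟨ +-cong (sym (×-homo-+ 1# a d)) (+-comm _ _) ⟩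
    (a ℕ.+ d) · 1# + (- (d · 1#) + - (b · 1#))    ≡⟨ ≡.cong (λ n → n · 1# + (- (d · 1#) + - (b · 1#))) eq ⟩
    (c ℕ.+ b) · 1# + (- (d · 1#) + - (b · 1#))    ≈⟨ +-congʳ (×-homo-+ 1# c b) ⟩
    (c · 1# + b · 1#) + (- (d · 1#) + - (b · 1#)) ≈⟨ interchange _ _ _ _ ⟩
    (c · 1# + - (d · 1#)) + (b · 1# + - (b · 1#)) ≈⟨ +-congˡ (-‿inverseʳ (b · 1#)) ⟩
    (c · 1# + - (d · 1#)) + 0#                    ≈⟨ +-identityʳ _ ⟩
    c · 1# + - (d · 1#)                           ≈⟨ value≈ c d ⟨
    value (c , d)                                 ∎)

  open Algebra.Solver.Ring Differences (fromCommutativeRing R) morphism _≟ᵛ_ public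
    using (solve; _:+_; _:*_; :-_; _:=_; con; Polynomial)

  :0 :1 : ∀ {n} → Polynomial n
  :0 = con (0 , 0)
  :1 = con (1 , 0)

-- Closure properties of definable sets and a formula language for them

module Definability {ℓ} {E : Language ℓ} (M : Structure ℓ (Ldiv+ E)) where

  open Structure M renaming (Carrier to K)
  private
    L : Language ℓ
    L = Ldiv+ E
    module ≈ = IsEquivalence isEquivalence
    variable
      m n d k : ℕ

  renameTerm : (Fin n → Fin m) → Term L n → Term L m
  renameTerms : (Fin n → Fin m) → Vec (Term L n) k → Vec (Term L m) k
  renameTerm ρ (var i)    = var (ρ i)
  renameTerm ρ (app g ts) = app g (renameTerms ρ ts)
  renameTerms ρ []       = []
  renameTerms ρ (t ∷ ts) = renameTerm ρ t ∷ renameTerms ρ ts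

  lift : (Fin n → Fin m) → Fin (suc n) → Fin (suc m)
  lift ρ zero    = zero
  lift ρ (suc i) = suc (ρ i)

  renameFormula : (Fin n → Fin m) → Formula L n → Formula L m
  renameFormula ρ (s ≋ t)    = renameTerm ρ s ≋ renameTerm ρ t
  renameFormula ρ (rel R ts) = rel R (renameTerms ρ ts)
  renameFormula ρ false      = false
  renameFormula ρ (φ ∧ ψ)    = renameFormula ρ φ ∧ renameFormula ρ ψ
  renameFormula ρ (φ ∨ ψ)    = renameFormula ρ φ ∨ renameFormula ρ ψ
  renameFormula ρ (φ ⇒ ψ)    = renameFormula ρ φ ⇒ renameFormula ρ ψ
  renameFormula ρ (all φ)    = all (renameFormula (lift ρ) φ)
  renameFormula ρ (ex φ)     = ex (renameFormula (lift ρ) φ)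

  Renames : (Fin n → Fin m) → Vec K n → Vec K m → Set ℓ
  Renames ρ xs ys = ∀ i → lookup ys (ρ i) ≡ lookup xs i

  lift-renames : ∀ {ρ : Fin n → Fin m} {xs ys} → Renames ρ xs ys → ∀ z → Renames (lift ρ) (z ∷ xs) (z ∷ ys)
  lift-renames r z zero    = ≡.refl
  lift-renames r z (suc i) = r i

  rename-⟦⟧ : ∀ {ρ : Fin n → Fin m} {xs ys} → Renames ρ xs ys → ∀ t → ⟦_⟧ M (renameTerm ρ t) ys ≡ ⟦_⟧ M t xs
  rename-⟦⟧* : ∀ {ρ : Fin n → Fin m} {xs ys} → Renames ρ xs ys → ∀ (ts : Vec (Term L n) k) →
               ⟦_⟧* M (renameTerms ρ ts) ys ≡ ⟦_⟧* M ts xs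
  rename-⟦⟧ r (var i)    = r i
  rename-⟦⟧ r (app g ts) = ≡.cong (function g) (rename-⟦⟧* r ts)
  rename-⟦⟧* r []       = ≡.refl
  rename-⟦⟧* r (t ∷ ts) = ≡.cong₂ _∷_ (rename-⟦⟧ r t) (rename-⟦⟧* r ts)

  ≡⇒⇔ : ∀ {A B : Set ℓ} → A ≡ B → A ⇔ B
  ≡⇒⇔ ≡.refl = mk⇔ id id

  rename-Holds : ∀ (φ : Formula L n) {ρ : Fin n → Fin m} {xs ys} → Renames ρ xs ys →
                 Holds M (renameFormula ρ φ) ys ⇔ Holds M φ xs
  rename-Holds (s ≋ t)    r = ≡⇒⇔ (≡.cong₂ _≈_ (rename-⟦⟧ r s) (rename-⟦⟧ r t))
  rename-Holds (rel R ts) r = ≡⇒⇔ (≡.cong (relation R) (rename-⟦⟧* r ts))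
  rename-Holds false      r = mk⇔ id id
  rename-Holds (φ ∧ ψ)    r = mk⇔
    (Product.map (Equivalence.to (rename-Holds φ r)) (Equivalence.to (rename-Holds ψ r)))
    (Product.map (Equivalence.from (rename-Holds φ r)) (Equivalence.from (rename-Holds ψ r)))
  rename-Holds (φ ∨ ψ)    r = mk⇔
    (Sum.map (Equivalence.to (rename-Holds φ r)) (Equivalence.to (rename-Holds ψ r)))
    (Sum.map (Equivalence.from (rename-Holds φ r)) (Equivalence.from (rename-Holds ψ r)))
  rename-Holds (φ ⇒ ψ)    r = mk⇔
    (λ f → Equivalence.to (rename-Holds ψ r) ∘ f ∘ Equivalence.from (rename-Holds φ r))
    (λ f → Equivalence.from (rename-Holds ψ r) ∘ f ∘ Equivalence.to (rename-Holds φ r))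
  rename-Holds (all φ)    r = mk⇔
    (λ f x → Equivalence.to (rename-Holds φ (lift-renames r x)) (f x))
    (λ f x → Equivalence.from (rename-Holds φ (lift-renames r x)) (f x))
  rename-Holds (ex φ)     r = mk⇔
    (λ (x , p) → x , Equivalence.to (rename-Holds φ (lift-renames r x)) p)
    (λ (x , p) → x , Equivalence.from (rename-Holds φ (lift-renames r x)) p)

  ⟦⟧-cong : ∀ {xs ys} → Pointwise _≈_ xs ys → ∀ (t : Term L n) → ⟦_⟧ M t xs ≈ ⟦_⟧ M t ys
  ⟦⟧*-cong : ∀ {xs ys} → Pointwise _≈_ xs ys → ∀ (ts : Vec (Term L n) k) →
             Pointwise _≈_ (⟦_⟧* M ts xs) (⟦_⟧* M ts ys)
  ⟦⟧-cong p (var i)    = Pointwise.lookup p i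
  ⟦⟧-cong p (app g ts) = function-cong g (⟦⟧*-cong p ts)
  ⟦⟧*-cong p []       = []
  ⟦⟧*-cong p (t ∷ ts) = ⟦⟧-cong p t ∷ ⟦⟧*-cong p ts

  Holds-cong : ∀ (φ : Formula L n) {xs ys} → Pointwise _≈_ xs ys → Holds M φ xs → Holds M φ ys
  Holds-cong (s ≋ t)    p h = ≈.trans (≈.sym (⟦⟧-cong p s)) (≈.trans h (⟦⟧-cong p t))
  Holds-cong (rel R ts) p h = relation-cong R (⟦⟧*-cong p ts) h
  Holds-cong (φ ∧ ψ)    p h = Product.map (Holds-cong φ p) (Holds-cong ψ p) h
  Holds-cong (φ ∨ ψ)    p h = Sum.map (Holds-cong φ p) (Holds-cong ψ p) h
  Holds-cong (φ ⇒ ψ)    p h = Holds-cong ψ p ∘ h ∘ Holds-cong φ (Pointwise.sym ≈.sym p)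
  Holds-cong (all φ)    p h = λ x → Holds-cong φ (≈.refl ∷ p) (h x)
  Holds-cong (ex φ)     p h = Product.map₂ (λ {x} → Holds-cong φ (≈.refl ∷ p)) h

  Definable-cong : ∀ {P : Pred (Vec K n) ℓ} → Definable M P → ∀ {xs ys} → Pointwise _≈_ xs ys → P xs → P ys
  Definable-cong (k , φ , ps , iff) p h = Equivalence.from (iff _)
    (Holds-cong φ (Pointwise.++⁺ p (Pointwise.refl ≈.refl)) (Equivalence.to (iff _) h))

  def-resp : ∀ {P Q : Pred (Vec K n) ℓ} → (∀ xs → P xs ⇔ Q xs) → Definable M P → Definable M Q
  def-resp P⇔Q (k , φ , ps , iff) = k , φ , ps , λ xs → mk⇔
    (Equivalence.to (iff xs) ∘ Equivalence.from (P⇔Q xs))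
    (Equivalence.to (P⇔Q xs) ∘ Equivalence.from (iff xs))

  def-formula : (φ : Formula L n) → Definable M (Holds M φ)
  def-formula φ = 0 , renameFormula (_↑ˡ 0) φ , [] , λ xs →
    let iff = rename-Holds φ (Vec.lookup-++ˡ xs [])
    in mk⇔ (Equivalence.from iff) (Equivalence.to iff)

  private
    join : (Fin n → Fin m) → (Fin k → Fin m) → Fin (n ℕ.+ k) → Fin m
    join {n} ρ σ i = Sum.[ ρ , σ ]′ (splitAt n i)

    join-renames : ∀ (ρ : Fin n → Fin m) (σ : Fin k → Fin m) xs ps ys →
      Renames ρ xs ys → Renames σ ps ys → Renames (join ρ σ) (xs ++ᵛ ps) ys
    join-renames {n} ρ σ xs ps ys r s i = ≡.trans (eq (splitAt n i)) (≡.sym (Vec.lookup-splitAt n xs ps i))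
      where
      eq : ∀ j → lookup ys (Sum.[ ρ , σ ]′ j) ≡ Sum.[ lookup xs , lookup ps ]′ j
      eq (inj₁ j) = r j
      eq (inj₂ j) = s j

  def-rename : ∀ {P : Pred (Vec K n) ℓ} (ρ : Fin n → Fin m) (f : Vec K m → Vec K n) →
    (∀ ys → Renames ρ (f ys) ys) → Definable M P → Definable M (P ∘ f)
  def-rename {n} {m} ρ f r (k , φ , ps , iff) =
    k , renameFormula (join (λ i → ρ i ↑ˡ k) (m ↑ʳ_)) φ , ps , λ ys →
      let iff′ = rename-Holds φ (join-renames (λ i → ρ i ↑ˡ k) (m ↑ʳ_) (f ys) ps (ys ++ᵛ ps) (λ i → ≡.trans (Vec.lookup-++ˡ ys ps (ρ i)) (r ys i)) (Vec.lookup-++ʳ ys ps))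
      in mk⇔ (Equivalence.from iff′ ∘ Equivalence.to (iff (f ys))) (Equivalence.from (iff (f ys)) ∘ Equivalence.to iff′)

  private
    widenˡ : ∀ k₁ k₂ → Formula L (n ℕ.+ k₁) → Formula L (n ℕ.+ (k₁ ℕ.+ k₂))
    widenˡ {n} k₁ k₂ = renameFormula (join (_↑ˡ (k₁ ℕ.+ k₂)) (λ i → n ↑ʳ (i ↑ˡ k₂)))

    widenˡ-Holds :  ∀ k₁ k₂ (φ : Formula L (n ℕ.+ k₁)) xs (ps : Vec K k₁) (qs : Vec K k₂) →
      Holds M (widenˡ {n} k₁ k₂ φ) (xs ++ᵛ (ps ++ᵛ qs)) ⇔ Holds M φ (xs ++ᵛ ps)
    widenˡ-Holds {n} k₁ k₂ φ xs ps qs = rename-Holds φ (join-renames (_↑ˡ (k₁ ℕ.+ k₂)) (λ i → n ↑ʳ (i ↑ˡ k₂)) xs ps (xs ++ᵛ (ps ++ᵛ qs)) (Vec.lookup-++ˡ xs (ps ++ᵛ qs))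
      (λ i → ≡.trans (Vec.lookup-++ʳ xs (ps ++ᵛ qs) (i ↑ˡ k₂)) (Vec.lookup-++ˡ ps qs i)))

    widenʳ : ∀ k₁ k₂ → Formula L (n ℕ.+ k₂) → Formula L (n ℕ.+ (k₁ ℕ.+ k₂))
    widenʳ {n} k₁ k₂ = renameFormula (join (_↑ˡ (k₁ ℕ.+ k₂)) (λ i → n ↑ʳ (k₁ ↑ʳ i)))

    widenʳ-Holds : ∀ k₁ k₂ (φ : Formula L (n ℕ.+ k₂)) xs (ps : Vec K k₁) (qs : Vec K k₂) →
      Holds M (widenʳ {n} k₁ k₂ φ) (xs ++ᵛ (ps ++ᵛ qs)) ⇔ Holds M φ (xs ++ᵛ qs)
    widenʳ-Holds {n} k₁ k₂ φ xs ps qs = rename-Holds φ (join-renames (_↑ˡ (k₁ ℕ.+ k₂)) (λ i → n ↑ʳ (k₁ ↑ʳ i)) xs qs (xs ++ᵛ (ps ++ᵛ qs)) (Vec.lookup-++ˡ xs (ps ++ᵛ qs))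
      (λ i → ≡.trans (Vec.lookup-++ʳ xs (ps ++ᵛ qs) (k₁ ↑ʳ i)) (Vec.lookup-++ʳ ps qs i)))

    -- Both formulas are read over the concatenated parameter tuples, so that a connective can
    -- combine them.
    merge : ∀ {P Q : Pred (Vec K n) ℓ} → Definable M P → Definable M Q →
      ∃ λ k → Σ (Formula L (n ℕ.+ k)) λ φ → Σ (Formula L (n ℕ.+ k)) λ ψ → Σ (Vec K k) λ ps →
        (∀ xs → P xs ⇔ Holds M φ (xs ++ᵛ ps)) × (∀ xs → Q xs ⇔ Holds M ψ (xs ++ᵛ ps))
    merge {n} (k₁ , φ , ps , iff) (k₂ , ψ , qs , iff′) =
      k₁ ℕ.+ k₂ , widenˡ {n} k₁ k₂ φ , widenʳ {n} k₁ k₂ ψ , ps ++ᵛ qs ,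
      (λ xs → let w = widenˡ-Holds k₁ k₂ φ xs ps qs in
        mk⇔ (Equivalence.from w ∘ Equivalence.to (iff xs)) (Equivalence.from (iff xs) ∘ Equivalence.to w)) ,
      (λ xs → let w = widenʳ-Holds k₁ k₂ ψ xs ps qs in
        mk⇔ (Equivalence.from w ∘ Equivalence.to (iff′ xs)) (Equivalence.from (iff′ xs) ∘ Equivalence.to w))

  module _ {P Q : Pred (Vec K n) ℓ} (DP : Definable M P) (DQ : Definable M Q) where

    def-∧ : Definable M (λ xs → P xs × Q xs)
    def-∧ = let k , φ , ψ , ps , p , q = merge DP DQ in k , φ ∧ ψ , ps , λ xs → mk⇔
      (Product.map (Equivalence.to (p xs)) (Equivalence.to (q xs)))
      (Product.map (Equivalence.from (p xs)) (Equivalence.from (q xs)))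

    def-∨ : Definable M (λ xs → P xs ⊎ Q xs)
    def-∨ = let k , φ , ψ , ps , p , q = merge DP DQ in k , φ ∨ ψ , ps , λ xs → mk⇔
      (Sum.map (Equivalence.to (p xs)) (Equivalence.to (q xs)))
      (Sum.map (Equivalence.from (p xs)) (Equivalence.from (q xs)))

    def-⇒ : Definable M (λ xs → P xs → Q xs)
    def-⇒ = let k , φ , ψ , ps , p , q = merge DP DQ in k , (φ ⇒ ψ) , ps , λ xs → mk⇔
      (λ f → Equivalence.to (q xs) ∘ f ∘ Equivalence.from (p xs))
      (λ f → Equivalence.from (q xs) ∘ f ∘ Equivalence.to (p xs))

  def-all : {P : Pred (Vec K (suc n)) ℓ} → Definable M P → Definable M (λ xs → ∀ x → P (x ∷ xs))
  def-all (k , φ , ps , iff) = k , all φ , ps , λ xs → mk⇔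
    (λ f x → Equivalence.to (iff (x ∷ xs)) (f x))
    (λ f x → Equivalence.from (iff (x ∷ xs)) (f x))

  def-ex : {P : Pred (Vec K (suc n)) ℓ} → Definable M P → Definable M (λ xs → ∃ λ x → P (x ∷ xs))
  def-ex (k , φ , ps , iff) = k , ex φ , ps , λ xs → mk⇔
    (λ (x , p) → x , Equivalence.to (iff (x ∷ xs)) p)
    (λ (x , p) → x , Equivalence.from (iff (x ∷ xs)) p)

  def-fix : ∀ n {P : Pred (Vec K (n ℕ.+ d)) ℓ} → Definable M P → ∀ w → Definable M (λ xs → P (xs ++ᵛ w))
  def-fix {d} n {P} (k , φ , ps , iff) w = d ℕ.+ k , renameFormula τ φ , w ++ᵛ ps , λ xs →
    mk⇔ (Equivalence.from (iff′ xs) ∘ Equivalence.to (iff _)) (Equivalence.from (iff _) ∘ Equivalence.to (iff′ xs))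
    where
    ρ : Fin (n ℕ.+ d) → Fin (n ℕ.+ (d ℕ.+ k))
    ρ = join {n = n} {k = d} (_↑ˡ (d ℕ.+ k)) (λ i → n ↑ʳ (i ↑ˡ k))
    τ : Fin (n ℕ.+ d ℕ.+ k) → Fin (n ℕ.+ (d ℕ.+ k))
    τ = join {n = n ℕ.+ d} {k = k} ρ (λ i → n ↑ʳ (d ↑ʳ i))
    iff′ : ∀ xs → Holds M (renameFormula τ φ) (xs ++ᵛ (w ++ᵛ ps)) ⇔ Holds M φ ((xs ++ᵛ w) ++ᵛ ps)
    iff′ xs = rename-Holds φ (join-renames {n = n ℕ.+ d} {k = k} ρ (λ i → n ↑ʳ (d ↑ʳ i)) (xs ++ᵛ w) ps (xs ++ᵛ (w ++ᵛ ps))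
      (join-renames {n = n} {k = d} (_↑ˡ (d ℕ.+ k)) (λ i → n ↑ʳ (i ↑ˡ k)) xs w (xs ++ᵛ (w ++ᵛ ps)) (Vec.lookup-++ˡ xs (w ++ᵛ ps))
        (λ i → ≡.trans (Vec.lookup-++ʳ xs (w ++ᵛ ps) (i ↑ˡ k)) (Vec.lookup-++ˡ w ps i)))
      (λ i → ≡.trans (Vec.lookup-++ʳ xs (w ++ᵛ ps) (d ↑ʳ i)) (Vec.lookup-++ʳ w ps i)))

  Graph : (K → K) → Set ℓ
  Graph g = Definable M {n = 2} λ xs → lookup xs (suc zero) ≈ g (lookup xs zero)

  infixl 9 _⊗_
  infixl 8 _⊕_

  -- `fn` admits any function with a definable graph as if it were a function symbol; translation
  -- into the language costs an existential quantifier over its value.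
  data Expr (n : ℕ) : Set ℓ where
    ` : Fin n → Expr n
    # : K → Expr n
    _⊕_ _⊗_ : Expr n → Expr n → Expr n
    ⊝ : Expr n → Expr n
    fn : (g : K → K) → Graph g → Expr n → Expr n

  eval : Expr n → Vec K n → K
  eval (` i)       ρ = lookup ρ i
  eval (# c)       ρ = c
  eval (s ⊕ t)     ρ = function (inj₁ plus) (eval s ρ ∷ eval t ρ ∷ [])
  eval (s ⊗ t)     ρ = function (inj₁ times) (eval s ρ ∷ eval t ρ ∷ [])
  eval (⊝ t)       ρ = function (inj₁ minus) (eval t ρ ∷ [])
  eval (fn g _ t)  ρ = g (eval t ρ)

  infix  6 _≼ᶠ_ _≈ᶠ_ _≺ᶠ_
  infixr 5 _∧ᶠ_
  infixr 4 _∨ᶠ_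
  infixr 3 _⇒ᶠ_

  -- Besides its n quantifiable variables, a formula has d trailing
  -- variables, which enter only through definable relations.
  data Fm (d n : ℕ) : Set (lsuc ℓ) where
    _≼ᶠ_ _≈ᶠ_     : Expr n → Expr n → Fm d n
    atom          : (R : Pred (Vec K (m ℕ.+ d)) ℓ) → Definable M R → Vec (Fin n) m → Fm d n
    falseᶠ        : Fm d n
    _∧ᶠ_ _∨ᶠ_ _⇒ᶠ_ : Fm d n → Fm d n → Fm d n
    allᶠ exᶠ      : Fm d (suc n) → Fm d n

  -- Written as an implication so that its satisfaction unfolds to exactly the relation `_≺_` used
  -- on K.
  _≺ᶠ_ : Expr n → Expr n → Fm d n
  s ≺ᶠ t = t ≼ᶠ s ⇒ᶠ falseᶠ

  Sat : Fm d n → Vec K n → Vec K d → Set ℓ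
  Sat (s ≼ᶠ t)      ρ w = relation (inj₁ div) (eval s ρ ∷ eval t ρ ∷ [])
  Sat (s ≈ᶠ t)      ρ w = eval s ρ ≈ eval t ρ
  Sat (atom R _ is) ρ w = R (Vec.map (lookup ρ) is ++ᵛ w)
  Sat falseᶠ        ρ w = ⊥
  Sat (φ ∧ᶠ ψ)      ρ w = Sat φ ρ w × Sat ψ ρ w
  Sat (φ ∨ᶠ ψ)      ρ w = Sat φ ρ w ⊎ Sat ψ ρ w
  Sat (φ ⇒ᶠ ψ)      ρ w = Sat φ ρ w → Sat ψ ρ w
  Sat (allᶠ φ)      ρ w = ∀ x → Sat φ (x ∷ ρ) w
  Sat (exᶠ φ)       ρ w = ∃ λ x → Sat φ (x ∷ ρ) w

  private
    lookup-take : ∀ n {d} (xs : Vec K (n ℕ.+ d)) i → lookup xs (i ↑ˡ d) ≡ lookup (take n xs) i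
    lookup-take (suc n) (x ∷ xs) zero    = ≡.refl
    lookup-take (suc n) (x ∷ xs) (suc i) = lookup-take n xs i

    lookup-drop : ∀ n {d} (xs : Vec K (n ℕ.+ d)) i → lookup xs (n ↑ʳ i) ≡ lookup (drop n xs) i
    lookup-drop zero    xs       i = ≡.refl
    lookup-drop (suc n) (x ∷ xs) i = lookup-drop n xs i

  graph-cong : ∀ g → Graph g → ∀ {x y} → x ≈ y → g x ≈ g y
  graph-cong g D x≈y = Definable-cong D (x≈y ∷ ≈.refl ∷ []) ≈.refl

  private
    drop₁ : Fin (suc n) → Fin (suc (suc n))
    drop₁ zero    = zero
    drop₁ (suc i) = suc (suc i)

    def-apply₂ : ∀ (g : DivFunction 2) (s t : Expr n) →
      Definable M {n = suc n ℕ.+ d} (λ xs → lookup xs zero ≈ eval s (take n (Vec.tail xs))) →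
      Definable M {n = suc n ℕ.+ d} (λ xs → lookup xs zero ≈ eval t (take n (Vec.tail xs))) →
      Definable M {n = suc n ℕ.+ d} λ xs → lookup xs zero ≈
        function (inj₁ g) (eval s (take n (Vec.tail xs)) ∷ eval t (take n (Vec.tail xs)) ∷ [])
    def-apply₂ {n} {d} g s t Ds Dt = def-resp
      (λ { (z ∷ xs) → mk⇔ (λ (a , b , (p , q) , r) → ≈.trans r (function-cong _ (p ∷ q ∷ [])))
                          (λ r → _ , _ , (≈.refl , ≈.refl) , r) })
      (def-ex (def-ex (def-∧ (def-∧
        (def-rename (λ { zero → suc zero ; (suc i) → suc (suc (suc i)) }) (λ { (b ∷ a ∷ z ∷ xs) → a ∷ xs })
          (λ { (b ∷ a ∷ z ∷ xs) zero → ≡.refl ; (b ∷ a ∷ z ∷ xs) (suc i) → ≡.refl }) Ds)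
        (def-rename (λ { zero → zero ; (suc i) → suc (suc (suc i)) }) (λ { (b ∷ a ∷ z ∷ xs) → b ∷ xs })
          (λ { (b ∷ a ∷ z ∷ xs) zero → ≡.refl ; (b ∷ a ∷ z ∷ xs) (suc i) → ≡.refl }) Dt))
        (def-rename {n = 3} (_↑ˡ (n ℕ.+ d)) (λ { (b ∷ a ∷ z ∷ xs) → b ∷ a ∷ z ∷ [] })
          (λ { (b ∷ a ∷ z ∷ xs) zero → ≡.refl ; (b ∷ a ∷ z ∷ xs) (suc zero) → ≡.refl ; (b ∷ a ∷ z ∷ xs) (suc (suc zero)) → ≡.refl })
          (def-formula (var (suc (suc zero)) ≋ app (inj₁ g) (var (suc zero) ∷ var zero ∷ [])))))))

  def-value : ∀ (t : Expr n) → Definable M {n = suc n ℕ.+ d} λ xs → lookup xs zero ≈ eval t (take n (Vec.tail xs))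
  def-value {n} {d} (` i) = def-resp (λ { (z ∷ xs) → ≡⇒⇔ (≡.cong (z ≈_) (lookup-take n xs i)) })
    (def-formula (var zero ≋ var (suc (i ↑ˡ d))))
  def-value (# c) = def-rename {n = 1} {P = λ xs → lookup xs zero ≈ c} (λ _ → zero) (λ xs → lookup xs zero ∷ []) (λ { xs zero → ≡.refl })
    (1 , var zero ≋ var (suc zero) , c ∷ [] , λ { (x ∷ []) → mk⇔ id id })
  def-value {n} {d} (s ⊕ t) = def-apply₂ plus s t (def-value s) (def-value t)
  def-value {n} {d} (s ⊗ t) = def-apply₂ times s t (def-value s) (def-value t)
  def-value {n} {d} (⊝ t)   = def-resp
    (λ { (z ∷ xs) → mk⇔ (λ (a , p , r) → ≈.trans r (function-cong _ (p ∷ []))) (λ r → _ , ≈.refl , r) })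
    (def-ex (def-∧
      (def-rename drop₁ (λ { (a ∷ z ∷ xs) → a ∷ xs }) (λ { (a ∷ z ∷ xs) zero → ≡.refl ; (a ∷ z ∷ xs) (suc i) → ≡.refl }) (def-value t))
      (def-rename {n = 2} (_↑ˡ (n ℕ.+ d)) (λ { (a ∷ z ∷ xs) → a ∷ z ∷ [] }) (λ { (a ∷ z ∷ xs) zero → ≡.refl ; (a ∷ z ∷ xs) (suc zero) → ≡.refl })
        (def-formula (var (suc zero) ≋ app (inj₁ minus) (var zero ∷ []))))))
  def-value {n} {d} (fn g D t) = def-resp
    (λ { (z ∷ xs) → mk⇔ (λ (a , p , r) → ≈.trans r (graph-cong g D p)) (λ r → _ , ≈.refl , r) })
    (def-ex (def-∧
      (def-rename drop₁ (λ { (a ∷ z ∷ xs) → a ∷ xs }) (λ { (a ∷ z ∷ xs) zero → ≡.refl ; (a ∷ z ∷ xs) (suc i) → ≡.refl }) (def-value t))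
      (def-rename {n = 2} (_↑ˡ (n ℕ.+ d)) (λ { (a ∷ z ∷ xs) → a ∷ z ∷ [] }) (λ { (a ∷ z ∷ xs) zero → ≡.refl ; (a ∷ z ∷ xs) (suc zero) → ≡.refl }) D)))

  private
    def-compare : ∀ (s t : Expr n) {R : Pred (Vec K 2) ℓ} → Definable M R →
      Definable M {n = n ℕ.+ d} λ xs → R (eval s (take n xs) ∷ eval t (take n xs) ∷ [])
    def-compare {n} {d} s t DR = def-resp
      (λ xs → mk⇔ (λ (a , b , (p , q) , r) → Definable-cong DR (p ∷ q ∷ []) r) (λ r → _ , _ , (≈.refl , ≈.refl) , r))
      (def-ex (def-ex (def-∧ (def-∧
        (def-rename (λ { zero → suc zero ; (suc i) → suc (suc i) }) (λ { (b ∷ a ∷ xs) → a ∷ xs })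
          (λ { (b ∷ a ∷ xs) zero → ≡.refl ; (b ∷ a ∷ xs) (suc i) → ≡.refl }) (def-value {d = d} s))
        (def-rename (λ { zero → zero ; (suc i) → suc (suc i) }) (λ { (b ∷ a ∷ xs) → b ∷ xs })
          (λ { (b ∷ a ∷ xs) zero → ≡.refl ; (b ∷ a ∷ xs) (suc i) → ≡.refl }) (def-value {d = d} t)))
        (def-rename {n = 2} (λ { zero → suc zero ; (suc _) → zero }) (λ { (b ∷ a ∷ xs) → a ∷ b ∷ [] })
          (λ { (b ∷ a ∷ xs) zero → ≡.refl ; (b ∷ a ∷ xs) (suc zero) → ≡.refl }) DR))))

  abstract
    def-sat : ∀ (φ : Fm d n) → Definable M {n = n ℕ.+ d} λ xs → Sat φ (take n xs) (drop n xs)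
    def-sat (s ≼ᶠ t) = def-compare s t {λ xs → relation (inj₁ div) xs}
      (def-resp (λ { (a ∷ b ∷ []) → mk⇔ id id }) (def-formula (rel (inj₁ div) (var zero ∷ var (suc zero) ∷ []))))
    def-sat (s ≈ᶠ t) = def-compare s t {λ xs → lookup xs zero ≈ lookup xs (suc zero)}
      (def-resp (λ { (a ∷ b ∷ []) → mk⇔ id id }) (def-formula (var zero ≋ var (suc zero))))
    def-sat {d} {n} (atom {m = m} R DR is) =
      def-rename (join (λ i → lookup is i ↑ˡ d) (n ↑ʳ_)) (λ xs → Vec.map (lookup (take n xs)) is ++ᵛ drop n xs)
        (λ xs → join-renames (λ i → lookup is i ↑ˡ d) (n ↑ʳ_) (Vec.map (lookup (take n xs)) is) (drop n xs) xs
                             (λ i → ≡.trans (lookup-take n xs (lookup is i)) (≡.sym (Vec.lookup-map i (lookup (take n xs)) is)))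
                             (lookup-drop n xs))
        DR
    def-sat falseᶠ   = def-formula false
    def-sat (φ ∧ᶠ ψ) = def-∧ (def-sat φ) (def-sat ψ)
    def-sat (φ ∨ᶠ ψ) = def-∨ (def-sat φ) (def-sat ψ)
    def-sat (φ ⇒ᶠ ψ) = def-⇒ (def-sat φ) (def-sat ψ)
    def-sat (allᶠ φ) = def-all (def-sat φ)
    def-sat (exᶠ φ)  = def-ex (def-sat φ)

  Definable₂ : (K → K → Set ℓ) → Set ℓ
  Definable₂ R = Definable M {n = 2} λ xs → R (lookup xs zero) (lookup xs (suc zero))

  abstract
    definable₂ : ∀ (φ : Fm 0 2) → Definable₂ (λ x y → Sat φ (x ∷ y ∷ []) [])
    definable₂ φ = def-resp (λ { (x ∷ y ∷ []) → mk⇔ id id }) (def-sat φ)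

  abstract
    graph : ∀ (t : Expr 1) → Graph (λ x → eval t (x ∷ []))
    graph t = def-rename {n = 2} (λ { zero → suc zero ; (suc _) → zero }) (λ { (x ∷ y ∷ []) → y ∷ x ∷ [] })
      (λ { (x ∷ y ∷ []) zero → ≡.refl ; (x ∷ y ∷ []) (suc zero) → ≡.refl }) (def-value {d = 0} t)
      |>′ def-resp (λ { (x ∷ y ∷ []) → mk⇔ id id })

-- Valued fields through the divisibility relation

module Valuation {ℓ} {E : Language ℓ} (em : ∀ {a} → ExcludedMiddle a)
  (M : Structure ℓ (Ldiv+ E)) (V : ValuedField M) where

  open ValuedField V hiding (isEquivalence; _≤_; _<_; _≈⁺_; _≤⁺_; _<⁺_; _<±_; _+⁺_) public

  commutativeRing : CommutativeRing ℓ ℓ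
  commutativeRing = record { isCommutativeRing = isCommutativeRing }

  module R = CommutativeRing commutativeRing
  open DifferenceCoefficients commutativeRing public
    using (solve; _:+_; _:*_; :-_; _:=_; :0; :1)
  open Exp R.commutativeSemiring public
    using (_^_; ^-assocʳ; ^-distrib-*; ^-congˡ; ^-congʳ)

  infix 4 _≼_ _≺_ _≍_ _∼_ _≉_

  -- x ≼ y means v(x) ≤ v(y): elements near infinity are ≺-small, and 0 is
  -- the ≼-largest element.  x ∼ y means rv(x) = rv(y) for nonzero y, and
  -- 1# ≺ x + - y means that x and y agree modulo the maximal ideal.
  _≼_ _≺_ _≍_ _∼_ _≉_ : K → K → Set ℓ
  x ≼ y = Div x y
  x ≺ y = Div y x → ⊥ {ℓ}
  x ≍ y = x ≼ y × y ≼ x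
  x ∼ y = y ≺ x + - y
  x ≉ y = ¬ x ≈ y

  module ≤ = IsTotalOrder Γ.isTotalOrder

  ≼⇒v : ∀ {x y} → x ≼ y → v x Γ.≤⁺ v y
  ≼⇒v {x} {y} = Equivalence.to (div-v x y)

  v⇒≼ : ∀ {x y} → v x Γ.≤⁺ v y → x ≼ y
  v⇒≼ {x} {y} = Equivalence.from (div-v x y)

  ≤⁺-trans : ∀ {p q r} → p Γ.≤⁺ q → q Γ.≤⁺ r → p Γ.≤⁺ r
  ≤⁺-trans = SupNS.≤⁺-trans _ ≤.trans

  ≤⁺-reflexive : ∀ {p q} → p Γ.≈⁺ q → p Γ.≤⁺ q
  ≤⁺-reflexive = SupNS.≤⁺-reflexive _ ≤.reflexive

  ≈⁺-sym : ∀ {p q} → p Γ.≈⁺ q → q Γ.≈⁺ p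
  ≈⁺-sym = SupEq.≈⁺-sym _ Γ.sym

  ≈⁺-trans : ∀ {p q r} → p Γ.≈⁺ q → q Γ.≈⁺ r → p Γ.≈⁺ r
  ≈⁺-trans = SupEq.≈⁺-trans _ Γ.trans

  +⁺-mono : ∀ r {p q} → p Γ.≤⁺ q → (r Γ.+⁺ p) Γ.≤⁺ (r Γ.+⁺ q)
  +⁺-mono ⊤⁺    p≤q             = ⊤⁺ SupNS.≤⊤⁺
  +⁺-mono [ γ ] SupNS.[ p≤q ]   = SupNS.[ Γ.+-monoˡ-≤ γ p≤q ]
  +⁺-mono [ γ ] (p SupNS.≤⊤⁺)   = _ SupNS.≤⊤⁺

  ≼-reflexive : ∀ {x y} → x ≈ y → x ≼ y
  ≼-reflexive x≈y = v⇒≼ (≤⁺-reflexive (v-cong x≈y))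

  ≼-refl : ∀ {x} → x ≼ x
  ≼-refl = ≼-reflexive R.refl

  ≼-trans : ∀ {x y z} → x ≼ y → y ≼ z → x ≼ z
  ≼-trans x≼y y≼z = v⇒≼ (≤⁺-trans (≼⇒v x≼y) (≼⇒v y≼z))

  ≼-total : ∀ x y → x ≼ y ⊎ y ≼ x
  ≼-total x y = Sum.map v⇒≼ v⇒≼ (SupNS.≤⁺-total _ ≤.total (v x) (v y))

  ≼-+ : ∀ {x y z} → z ≼ x → z ≼ y → z ≼ x + y
  ≼-+ {x} {y} z≼x z≼y = v⇒≼ (v-+ x y (≼⇒v z≼x) (≼⇒v z≼y))

  ≼-0 : ∀ {x} → x ≼ 0#
  ≼-0 {x} = v⇒≼ (≤⁺-trans (v x SupNS.≤⊤⁺) (≤⁺-reflexive (≈⁺-sym (Equivalence.from (v-∞ 0#) R.refl))))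

  0≼⇒≈0 : ∀ {x} → 0# ≼ x → x ≈ 0#
  0≼⇒≈0 {x} 0≼x = Equivalence.to (v-∞ x) (SupNS.≤⁺-antisym _ ≤.antisym (v x SupNS.≤⊤⁺)
    (≤⁺-trans (≤⁺-reflexive (≈⁺-sym (Equivalence.from (v-∞ 0#) R.refl))) (≼⇒v 0≼x)))

  *-monoʳ-≼ : ∀ {x y} z → x ≼ y → z * x ≼ z * y
  *-monoʳ-≼ {x} {y} z x≼y = v⇒≼ (≤⁺-trans (≤⁺-reflexive (v-* z x))
    (≤⁺-trans (+⁺-mono (v z) (≼⇒v x≼y)) (≤⁺-reflexive (≈⁺-sym (v-* z y)))))

  ≍-refl : ∀ {x} → x ≍ x
  ≍-refl = ≼-refl , ≼-refl

  ≍-reflexive : ∀ {x y} → x ≈ y → x ≍ y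
  ≍-reflexive x≈y = ≼-reflexive x≈y , ≼-reflexive (R.sym x≈y)

  ≍-sym : ∀ {x y} → x ≍ y → y ≍ x
  ≍-sym (p , q) = q , p

  ≍-trans : ∀ {x y z} → x ≍ y → y ≍ z → x ≍ z
  ≍-trans (p , q) (r , s) = ≼-trans p r , ≼-trans s q

  *-monoˡ-≼ : ∀ {x y} z → x ≼ y → x * z ≼ y * z
  *-monoˡ-≼ z x≼y = ≼-trans (≼-reflexive (R.*-comm _ z))
    (≼-trans (*-monoʳ-≼ z x≼y) (≼-reflexive (R.*-comm z _)))

  *-mono-≼ : ∀ {x y z w} → x ≼ y → z ≼ w → x * z ≼ y * w
  *-mono-≼ x≼y z≼w = ≼-trans (*-monoˡ-≼ _ x≼y) (*-monoʳ-≼ _ z≼w)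

  *-cong-≍ : ∀ {x y z w} → x ≍ y → z ≍ w → x * z ≍ y * w
  *-cong-≍ (p , q) (r , s) = *-mono-≼ p r , *-mono-≼ q s

  *-cancelʳ-≼ : ∀ {x y z} → z ≉ 0# → x * z ≼ y * z → x ≼ y
  *-cancelʳ-≼ {x} {y} {z} z≉0 xz≼yz with inverse z z≉0
  ... | z⁻¹ , zz⁻¹≈1 = ≼-trans (≼-reflexive (eq x)) (≼-trans (*-monoˡ-≼ z⁻¹ xz≼yz) (≼-reflexive (R.sym (eq y))))
    where
    eq : ∀ x → x ≈ x * z * z⁻¹
    eq x = R.trans (R.sym (R.*-identityʳ x)) (R.trans (R.*-congˡ (R.sym zz⁻¹≈1)) (R.sym (R.*-assoc x z z⁻¹)))

  *-cancelʳ-≍ : ∀ {x y z} → z ≉ 0# → x * z ≍ y * z → x ≍ y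
  *-cancelʳ-≍ z≉0 (p , q) = *-cancelʳ-≼ z≉0 p , *-cancelʳ-≼ z≉0 q

  private
    1≈-1*-1 : 1# ≈ - 1# * - 1#
    1≈-1*-1 = solve 1 (λ e → e := :- e :* :- :1) R.refl 1#

    -- As the square of `- 1#` is `1#`, either inequality between the two, multiplied by `- 1#`,
    -- gives the other.
    -1≍1 : - 1# ≍ 1#
    -1≍1 with ≼-total (- 1#) 1#
    ... | inj₁ p = p , ≼-trans (≼-reflexive 1≈-1*-1) (≼-trans (*-monoˡ-≼ (- 1#) p) (≼-reflexive (R.*-identityˡ _)))
    ... | inj₂ p = ≼-trans (≼-reflexive (R.sym (R.*-identityˡ _))) (≼-trans (*-monoˡ-≼ (- 1#) p) (≼-reflexive (R.sym 1≈-1*-1))) , p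

  ≍-neg : ∀ {x} → - x ≍ x
  ≍-neg {x} = ≍-trans (≍-reflexive (solve 1 (λ x → :- x := :- :1 :* x) R.refl x))
    (≍-trans (*-cong-≍ -1≍1 ≍-refl) (≍-reflexive (R.*-identityˡ x)))

  ≼-or-≻ : ∀ x y → x ≼ y ⊎ y ≺ x
  ≼-or-≻ x y with em {P = x ≼ y}
  ... | yes x≼y = inj₁ x≼y
  ... | no  x⋠y = inj₂ (λ x≼y → contradiction x≼y x⋠y)

  ≺-≼-absurd : ∀ {x y} {a} {A : Set a} → x ≺ y → y ≼ x → A
  ≺-≼-absurd x≺y y≼x = ⊥-elim (x≺y y≼x)

  ≺⇒≼ : ∀ {x y} → x ≺ y → x ≼ y
  ≺⇒≼ {x} {y} x≺y with ≼-total x y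
  ... | inj₁ x≼y = x≼y
  ... | inj₂ y≼x = ≺-≼-absurd x≺y y≼x

  ≺-≼-trans : ∀ {x y z} → x ≺ y → y ≼ z → x ≺ z
  ≺-≼-trans x≺y y≼z z≼x = x≺y (≼-trans y≼z z≼x)

  ≼-≺-trans : ∀ {x y z} → x ≼ y → y ≺ z → x ≺ z
  ≼-≺-trans x≼y y≺z z≼x = y≺z (≼-trans z≼x x≼y)

  ≺-trans : ∀ {x y z} → x ≺ y → y ≺ z → x ≺ z
  ≺-trans x≺y y≺z = ≺-≼-trans x≺y (≺⇒≼ y≺z)

  ≺-resp : ∀ {x y x′ y′} → x ≈ x′ → y ≈ y′ → x ≺ y → x′ ≺ y′
  ≺-resp x≈x′ y≈y′ x≺y = ≼-≺-trans (≼-reflexive (R.sym x≈x′)) (≺-≼-trans x≺y (≼-reflexive y≈y′))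

  ≼-resp : ∀ {x y x′ y′} → x ≈ x′ → y ≈ y′ → x ≼ y → x′ ≼ y′
  ≼-resp x≈x′ y≈y′ x≼y = ≼-trans (≼-reflexive (R.sym x≈x′)) (≼-trans x≼y (≼-reflexive y≈y′))

  ≺⇒≉0 : ∀ {x y} → x ≺ y → x ≉ 0#
  ≺⇒≉0 x≺y x≈0 = ≺-≼-absurd x≺y (≼-trans ≼-0 (≼-reflexive (R.sym x≈0)))

  ≉0⇒≺0 : ∀ {x} → x ≉ 0# → x ≺ 0#
  ≉0⇒≺0 x≉0 0≼x = contradiction (0≼⇒≈0 0≼x) x≉0

  ≉0-resp-≼ : ∀ {x y} → y ≉ 0# → x ≼ y → x ≉ 0#
  ≉0-resp-≼ y≉0 x≼y = ≺⇒≉0 (≼-≺-trans x≼y (≉0⇒≺0 y≉0))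

  1≉0 : 1# ≉ 0#
  1≉0 1≈0 = 0≉1 (R.sym 1≈0)

  *-≉0 : ∀ {x y} → x ≉ 0# → y ≉ 0# → x * y ≉ 0#
  *-≉0 = *-nonzero V

  *-monoˡ-≺ : ∀ {x y} z → z ≉ 0# → x ≺ y → x * z ≺ y * z
  *-monoˡ-≺ z z≉0 x≺y yz≼xz = x≺y (*-cancelʳ-≼ z≉0 yz≼xz)

  *-monoʳ-≺ : ∀ {x y} z → z ≉ 0# → x ≺ y → z * x ≺ z * y
  *-monoʳ-≺ z z≉0 x≺y = ≺-resp (R.*-comm _ _) (R.*-comm _ _) (*-monoˡ-≺ z z≉0 x≺y)

  *-cancelʳ-≺ : ∀ {x y} z → x * z ≺ y * z → x ≺ y
  *-cancelʳ-≺ z xz≺yz y≼x = xz≺yz (*-monoˡ-≼ z y≼x)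

  ≺-+ : ∀ {x y z} → z ≺ x → z ≺ y → z ≺ x + y
  ≺-+ {x} {y} z≺x z≺y with ≼-total x y
  ... | inj₁ x≼y = ≺-≼-trans z≺x (≼-+ ≼-refl x≼y)
  ... | inj₂ y≼x = ≺-≼-trans z≺y (≼-+ y≼x ≼-refl)

  ≺-neg : ∀ {x z} → z ≺ x → z ≺ - x
  ≺-neg z≺x = ≺-≼-trans z≺x (proj₂ ≍-neg)

  ≼-neg : ∀ {x z} → z ≼ x → z ≼ - x
  ≼-neg z≼x = ≼-trans z≼x (proj₂ ≍-neg)

  minus-swap : ∀ x y → - (x + - y) ≈ y + - x
  minus-swap = solve 2 (λ x y → :- (x :+ :- y) := y :+ :- x) R.refl

  minus-trans : ∀ x y z → (x + - y) + (y + - z) ≈ x + - z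
  minus-trans = solve 3 (λ x y z → (x :+ :- y) :+ (y :+ :- z) := x :+ :- z) R.refl

  minus-plus : ∀ x y → (x + - y) + y ≈ x
  minus-plus = solve 2 (λ x y → (x :+ :- y) :+ y := x) R.refl

  minus-sym-≼ : ∀ {x y z} → z ≼ x + - y → z ≼ y + - x
  minus-sym-≼ z≼ = ≼-resp R.refl (minus-swap _ _) (≼-neg z≼)

  minus-sym-≺ : ∀ {x y z} → z ≺ x + - y → z ≺ y + - x
  minus-sym-≺ z≺ = ≺-resp R.refl (minus-swap _ _) (≺-neg z≺)

  minus-trans-≼ : ∀ {x y w z} → z ≼ x + - y → z ≼ y + - w → z ≼ x + - w
  minus-trans-≼ p q = ≼-resp R.refl (minus-trans _ _ _) (≼-+ p q)

  minus-trans-≺ : ∀ {x y w z} → z ≺ x + - y → z ≺ y + - w → z ≺ x + - w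
  minus-trans-≺ p q = ≺-resp R.refl (minus-trans _ _ _) (≺-+ p q)

  minus-≼ : ∀ {x y z} → z ≼ x → z ≼ y → z ≼ x + - y
  minus-≼ p q = ≼-+ p (≼-neg q)

  minus-0 : ∀ x → x + - 0# ≈ x
  minus-0 = solve 1 (λ x → x :+ :- :0 := x) R.refl

  minus-self : ∀ {x z} → z ≼ x + - x
  minus-self {x} = ≼-trans ≼-0 (≼-reflexive (R.sym (R.-‿inverseʳ x)))

  minus-*ʳ : ∀ x y z → (x + - y) * z ≈ x * z + - (y * z)
  minus-*ʳ = solve 3 (λ x y z → (x :+ :- y) :* z := x :* z :+ :- (y :* z)) R.refl

  minus-*ˡ : ∀ z x y → z * (x + - y) ≈ z * x + - (z * y)
  minus-*ˡ = solve 3 (λ z x y → z :* (x :+ :- y) := z :* x :+ :- (z :* y)) R.refl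

  ∼⇒≍ : ∀ {x y} → x ∼ y → x ≍ y
  ∼⇒≍ {x} {y} x∼y = x≼y , y≼x
    where
    y≼x : y ≼ x
    y≼x = ≼-resp R.refl (minus-plus x y) (≼-+ (≺⇒≼ x∼y) ≼-refl)
    x≼y : x ≼ y
    x≼y with ≼-or-≻ x y
    ... | inj₁ p   = p
    -- Both terms of y = x - (x - y) would lie strictly above `y`.
    ... | inj₂ y≺x = ≺-≼-absurd (≺-resp R.refl
      (solve 2 (λ x y → x :+ :- (x :+ :- y) := y) R.refl x y) (≺-+ y≺x (≺-neg x∼y))) ≼-refl

  ∼⇒≉0ʳ : ∀ {x y} → x ∼ y → y ≉ 0#
  ∼⇒≉0ʳ = ≺⇒≉0

  ∼-refl : ∀ {x} → x ≉ 0# → x ∼ x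
  ∼-refl x≉0 = ≺-≼-trans (≉0⇒≺0 x≉0) minus-self

  ∼-reflexive : ∀ {x y} → y ≉ 0# → x ≈ y → x ∼ y
  ∼-reflexive {x} {y} y≉0 x≈y = ≺-resp R.refl (R.+-congʳ (R.sym x≈y)) (∼-refl y≉0)

  ∼-sym : ∀ {x y} → x ∼ y → y ∼ x
  ∼-sym x∼y = ≼-≺-trans (proj₁ (∼⇒≍ x∼y)) (minus-sym-≺ x∼y)

  ∼-trans : ∀ {x y z} → x ∼ y → y ∼ z → x ∼ z
  ∼-trans x∼y y∼z = minus-trans-≺ (≼-≺-trans (proj₂ (∼⇒≍ y∼z)) x∼y) y∼z

  ∼-resp : ∀ {x y x′ y′} → x ≈ x′ → y ≈ y′ → x ∼ y → x′ ∼ y′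
  ∼-resp x≈x′ y≈y′ = ≺-resp y≈y′ (R.+-cong x≈x′ (R.-‿cong y≈y′))

  *-monoˡ-∼ : ∀ {x y} z → z ≉ 0# → x ∼ y → x * z ∼ y * z
  *-monoˡ-∼ z z≉0 x∼y = ≺-resp R.refl (minus-*ʳ _ _ z) (*-monoˡ-≺ z z≉0 x∼y)

  *-monoʳ-∼ : ∀ {x y} z → z ≉ 0# → x ∼ y → z * x ∼ z * y
  *-monoʳ-∼ z z≉0 x∼y = ∼-resp (R.*-comm _ _) (R.*-comm _ _) (*-monoˡ-∼ z z≉0 x∼y)

  *-cancelʳ-∼ : ∀ {x y} z → x * z ∼ y * z → x ∼ y
  *-cancelʳ-∼ z p = *-cancelʳ-≺ z (≺-resp R.refl (R.sym (minus-*ʳ _ _ z)) p)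

  *-≉0ʳ : ∀ {x y z} → z ≉ 0# → x * y ≈ z → y ≉ 0#
  *-≉0ʳ {x} z≉0 xy≈z y≈0 = z≉0 (R.trans (R.sym xy≈z) (R.trans (R.*-congˡ y≈0) (R.zeroʳ x)))

  divide : ∀ x {y} → y ≉ 0# → ∃ λ z → z * y ≈ x
  divide x {y} y≉0 with inverse y y≉0
  ... | y⁻¹ , yy⁻¹≈1 = x * y⁻¹ ,
    R.trans (R.*-assoc x y⁻¹ y) (R.trans (R.*-congˡ (R.trans (R.*-comm y⁻¹ y) yy⁻¹≈1)) (R.*-identityʳ x))

  inverse-≺ : ∀ {x y} → x * y ≈ 1# → 1# ≺ x → y ≺ 1#
  inverse-≺ {x} {y} xy≈1 1≺x = ≺-resp (R.*-identityˡ y) xy≈1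
    (*-monoˡ-≺ y (*-≉0ʳ 1≉0 xy≈1) 1≺x)

  *-cancelˡ : ∀ {x y z} → x ≉ 0# → x * y ≈ x * z → y ≈ z
  *-cancelˡ {x} {y} {z} x≉0 xy≈xz with inverse x x≉0
  ... | x⁻¹ , xx⁻¹≈1 = R.trans (eq y) (R.trans (R.*-congˡ xy≈xz) (R.sym (eq z)))
    where
    eq : ∀ y → y ≈ x⁻¹ * (x * y)
    eq y = R.trans (R.sym (R.*-identityˡ y)) (R.trans (R.*-congʳ (R.trans (R.sym xx⁻¹≈1) (R.*-comm x x⁻¹))) (R.*-assoc x⁻¹ x y))

  private
    v1≈0 : ∃ λ ε → v 1# Γ.≈⁺ [ ε ] × ε Γ.≈ Γ.0#
    v1≈0 with v 1# | v-∞ 1# | v-* 1# 1# | v-cong (R.*-identityʳ 1#)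
    ... | ⊤⁺    | eqv | _ | _ = contradiction (Equivalence.to eqv SupEq.⊤⁺≈⊤⁺) 1≉0
    ... | [ ε ] | _   | p | q with ≈⁺-trans (≈⁺-sym p) q
    ...   | SupEq.[ ε+ε≈ε ] = ε , SupEq.[ Γ.refl ] , identity
      where
      identity : ε Γ.≈ Γ.0#
      identity = Γ.trans (Γ.sym (Γ.identityˡ ε)) (Γ.trans (Γ.∙-congʳ (Γ.sym (Γ.inverseˡ ε)))
        (Γ.trans (Γ.assoc _ _ _) (Γ.trans (Γ.∙-congˡ ε+ε≈ε) (Γ.inverseˡ ε))))

  -- A nonzero value is realized by some `c`, and either `c` or its inverse has negative valuation.
  -- Multiplication by such an element moves towards infinity.
  infinite : ∃ λ π → π ≺ 1#
  infinite with v-nontrivial | v1≈0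
  ... | γ , γ≉0 | ε , v1≈ε , ε≈0 with v-surjective γ
  ...   | c , vc≈γ with ≼-or-≻ 1# c | ≼-or-≻ c 1#
  ...     | inj₂ c≺1 | _ = c , c≺1
  ...     | inj₁ 1≼c | inj₁ c≼1 = contradiction
    (Γ.trans (SupEq.[≈]-injective _ (≈⁺-trans (≈⁺-sym vc≈γ) (≈⁺-trans
      (SupNS.≤⁺-antisym _ ≤.antisym (≼⇒v c≼1) (≼⇒v 1≼c)) v1≈ε))) ε≈0) γ≉0
  ...     | inj₁ 1≼c | inj₂ 1≺c with em {P = c ≈ 0#}
  ...       | no  c≉0 = _ , inverse-≺ (proj₂ (inverse c c≉0)) 1≺c
  ...       | yes c≈0 with ≈⁺-trans (≈⁺-sym vc≈γ) (Equivalence.from (v-∞ c) c≈0)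
  ...         | ()

  π : K
  π = proj₁ infinite

  π≺1 : π ≺ 1#
  π≺1 = proj₂ infinite

  π≉0 : π ≉ 0#
  π≉0 = ≺⇒≉0 π≺1

  πx≺x : ∀ {x} → x ≉ 0# → π * x ≺ x
  πx≺x {x} x≉0 = ≺-resp R.refl (R.*-identityˡ x) (*-monoˡ-≺ x x≉0 π≺1)

  infixl 6 _⊓_
  _⊓_ : K → K → K
  x ⊓ y with ≼-total x y
  ... | inj₁ _ = x
  ... | inj₂ _ = y

  ⊓-≼ˡ : ∀ x y → x ⊓ y ≼ x
  ⊓-≼ˡ x y with ≼-total x y
  ... | inj₁ _   = ≼-refl
  ... | inj₂ y≼x = y≼x

  ⊓-≼ʳ : ∀ x y → x ⊓ y ≼ y
  ⊓-≼ʳ x y with ≼-total x y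
  ... | inj₁ x≼y = x≼y
  ... | inj₂ _   = ≼-refl

  ⊓-≉0 : ∀ {x y} → x ≉ 0# → y ≉ 0# → x ⊓ y ≉ 0#
  ⊓-≉0 {x} {y} x≉0 y≉0 with ≼-total x y
  ... | inj₁ _ = x≉0
  ... | inj₂ _ = y≉0

  ≤⁺⇔≼ : ∀ {q l} x → v l Γ.≈⁺ q → (q Γ.≤⁺ v x) ⇔ (l ≼ x)
  ≤⁺⇔≼ x vl≈q = mk⇔
    (λ q≤vx → v⇒≼ (≤⁺-trans (≤⁺-reflexive vl≈q) q≤vx))
    (λ l≼x → ≤⁺-trans (≤⁺-reflexive (≈⁺-sym vl≈q)) (≼⇒v l≼x))

  private
    <⁺⇒≰⁺ : ∀ {p q} → p Γ.<⁺ q → ¬ q Γ.≤⁺ p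
    <⁺⇒≰⁺ SupStrict.[ α≤β , α≉β ] SupNS.[ β≤α ] = α≉β (≤.antisym α≤β β≤α)
    <⁺⇒≰⁺ SupStrict.[ _ ]<⊤⁺      ()

    ≰⁺⇒<⁺ : ∀ {p q} → ¬ q Γ.≤⁺ p → p Γ.<⁺ q
    ≰⁺⇒<⁺ {⊤⁺}    {q}     q≰p = contradiction (q SupNS.≤⊤⁺) q≰p
    ≰⁺⇒<⁺ {[ α ]} {⊤⁺}    q≰p = SupStrict.[ α ]<⊤⁺
    ≰⁺⇒<⁺ {[ α ]} {[ β ]} q≰p with ≤.total α β
    ... | inj₁ α≤β = SupStrict.[ α≤β , (λ α≈β → q≰p SupNS.[ ≤.reflexive (Γ.sym α≈β) ]) ]
    ... | inj₂ β≤α = contradiction SupNS.[ β≤α ] q≰p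

  <⁺⇔≺ : ∀ {q l} x → v l Γ.≈⁺ q → (q Γ.<⁺ v x) ⇔ (l ≺ x)
  <⁺⇔≺ x vl≈q = mk⇔
    (λ q<vx x≼l → contradiction (≤⁺-trans (≼⇒v x≼l) (≤⁺-reflexive vl≈q)) (<⁺⇒≰⁺ q<vx))
    (λ l≺x → ≰⁺⇒<⁺ (λ vx≤q → ≺-≼-absurd l≺x (v⇒≼ (≤⁺-trans vx≤q (≤⁺-reflexive (≈⁺-sym vl≈q))))))

  >⁺⇔≻ : ∀ {q l} x → v l Γ.≈⁺ q → (v x Γ.<⁺ q) ⇔ (x ≺ l)
  >⁺⇔≻ {l = l} x vl≈q = mk⇔
    (λ vx<q l≼x → contradiction (≤⁺-trans (≤⁺-reflexive (≈⁺-sym vl≈q)) (≼⇒v l≼x)) (<⁺⇒≰⁺ vx<q))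
    (λ x≺l → ≰⁺⇒<⁺ (λ q≤vx → ≺-≼-absurd x≺l (v⇒≼ (≤⁺-trans (≤⁺-reflexive vl≈q) q≤vx))))

  v-realize : ∀ q → ∃ λ l → v l Γ.≈⁺ q
  v-realize ⊤⁺    = 0# , Equivalence.from (v-∞ 0#) R.refl
  v-realize [ γ ] = v-surjective γ

  v-finite : ∀ {x} → x ≉ 0# → ∃ λ γ → v x Γ.≈⁺ [ γ ]
  v-finite {x} x≉0 with v x | v-∞ x
  ... | ⊤⁺    | eqv = contradiction (Equivalence.to eqv SupEq.⊤⁺≈⊤⁺) x≉0
  ... | [ γ ] | _   = γ , SupEq.[ Γ.refl ]

  v-finite⁻¹ : ∀ {x γ} → v x Γ.≈⁺ [ γ ] → x ≉ 0#
  v-finite⁻¹ {x} vx≈γ x≈0 with ≈⁺-trans (≈⁺-sym (Equivalence.from (v-∞ x) x≈0)) vx≈γ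
  ... | ()

  -- Radii are replaced by elements `l` that realize them, which turns balls into conditions on
  -- `_≼_` and `_≺_`; the radius `⊤⁺` of a point is realized by `0#`.
  ball-form : ∀ B → (∃ λ a → ∃ λ l → ∀ x → members V B x ⇔ (l ≼ x + - a))
                  ⊎ (∃ λ a → ∃ λ l → ∀ x → members V B x ⇔ (l ≺ x + - a))
                  ⊎ (∀ x → members V B x)
  ball-form (closed a γ) with v-realize γ
  ... | l , vl≈γ = inj₁ (a , l , λ x → ≤⁺⇔≼ _ vl≈γ)
  ball-form (open′ a [ γ ]) with v-realize [ γ ]
  ... | l , vl≈γ = inj₂ (inj₁ (a , l , λ x → <⁺⇔≺ _ vl≈γ))
  ball-form (open′ a ⊥₋) = inj₂ (inj₂ _)

  v-1 : v 1# Γ.≈⁺ [ Γ.0# ]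
  v-1 = ≈⁺-trans (proj₁ (proj₂ v1≈0)) SupEq.[ proj₂ (proj₂ v1≈0) ]

  v-≍ : ∀ {q x y} → v x Γ.≈⁺ q → v y Γ.≈⁺ q → x ≍ y
  v-≍ vx≈q vy≈q = v⇒≼ (≤⁺-reflexive (≈⁺-trans vx≈q (≈⁺-sym vy≈q))) , v⇒≼ (≤⁺-reflexive (≈⁺-trans vy≈q (≈⁺-sym vx≈q)))

  v-< : ∀ {γ δ x y} → v x Γ.≈⁺ [ γ ] → v y Γ.≈⁺ [ δ ] → x ≺ y → γ Γ.< δ
  v-< vx≈γ vy≈δ x≺y =
    SupNS.[≤]-injective _ (≤⁺-trans (≤⁺-reflexive (≈⁺-sym vx≈γ)) (≤⁺-trans (≼⇒v (≺⇒≼ x≺y)) (≤⁺-reflexive vy≈δ))) ,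
    λ γ≈δ → ≺-≼-absurd x≺y (proj₁ (v-≍ vy≈δ (≈⁺-trans vx≈γ SupEq.[ γ≈δ ])))

  v-product : ∀ {γ δ x y} → v x Γ.≈⁺ [ γ ] → v y Γ.≈⁺ [ δ ] → v (x * y) Γ.≈⁺ [ γ Γ.+ δ ]
  v-product {x = x} {y} vx≈γ vy≈δ with v x | v y | v-* x y
  v-product SupEq.[ x≈γ ] SupEq.[ y≈δ ] | _ | _ | eq = ≈⁺-trans eq SupEq.[ Γ.∙-cong x≈γ y≈δ ]

-- Residue classes and boolean combinations of balls over an algebraically closed field

module Closed {ℓ} {E : Language ℓ} (em : ∀ {a} → ExcludedMiddle a)
  (M : Structure ℓ (Ldiv+ E)) (V : ValuedField M) (ac : AlgebraicallyClosed V) where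

  open Valuation em M V public

  -x+y≈0⇒y≈x : ∀ {x y} → - x + y ≈ 0# → y ≈ x
  -x+y≈0⇒y≈x {x} {y} p = R.trans (solve 2 (λ x y → y := x :+ (:- x :+ y)) R.refl x y)
    (R.trans (R.+-congˡ p) (R.+-identityʳ x))

  evalPoly-replicate : ∀ n y → evalPoly V (Vec.replicate n 0#) 1# y ≈ y ^ n
  evalPoly-replicate zero    y = R.refl
  evalPoly-replicate (suc n) y = R.trans (R.+-identityˡ _) (R.*-congˡ (evalPoly-replicate n y))

  root : ∀ n x → ∃ λ y → y ^ suc n ≈ x
  root n x with ac (- x ∷ Vec.replicate n 0#) 1# 1≉0
  ... | y , p = y , -x+y≈0⇒y≈x (R.trans (R.+-congˡ (R.*-congˡ (R.sym (evalPoly-replicate n y)))) p)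

  square-root : ∀ x → ∃ λ y → y * y ≈ x
  square-root x = let y , p = root 1 x in y , R.trans (R.*-congˡ (R.sym (R.*-identityʳ y))) p

  -- A square root of `x * y` has the midpoint of the two values.
  between : ∀ {x y} → x ≺ y → y ≉ 0# → ∃ λ z → x ≺ z × z ≺ y
  between {x} {y} x≺y y≉0 = let z , zz≈xy = square-root (x * y) in z ,
    (λ z≼x → *-monoʳ-≺ x (≺⇒≉0 x≺y) x≺y (≼-trans (≼-reflexive (R.sym zz≈xy)) (*-mono-≼ z≼x z≼x))) ,
    (λ y≼z → *-monoˡ-≺ y y≉0 x≺y (≼-trans (*-mono-≼ y≼z y≼z) (≼-reflexive zz≈xy)))

  rootProduct : List K → K → K
  rootProduct []       x = 1#
  rootProduct (a ∷ as) x = (x + - a) * rootProduct as x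

  private
    -- Carrying the constant `e` lets the recursion pass from one Horner coefficient to the next.
    timesLinear : ∀ e a {n} (as : Vec K n) c → Σ (Vec K (suc n)) λ bs →
      ∀ x → evalPoly V bs c x ≈ e + (x + - a) * evalPoly V as c x
    timesLinear e a []       c = (e + - (a * c)) ∷ [] , λ x →
      solve 4 (λ e a c x → (e :+ :- (a :* c)) :+ x :* c := e :+ (x :+ :- a) :* c) R.refl e a c x
    timesLinear e a (d ∷ as) c with timesLinear d a as c
    ... | bs , p = (e + - (a * d)) ∷ bs , λ x → R.trans (R.+-congˡ (R.*-congˡ (p x)))
      (solve 5 (λ e a d x q → (e :+ :- (a :* d)) :+ x :* (d :+ (x :+ :- a) :* q)
                            := e :+ (x :+ :- a) :* (d :+ x :* q)) R.refl e a d x _)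

    rootProduct-poly : ∀ zs → ∃ λ n → Σ (Vec K n) λ as → ∀ x → evalPoly V as 1# x ≈ rootProduct zs x
    rootProduct-poly []       = 0 , [] , λ _ → R.refl
    rootProduct-poly (a ∷ zs) with rootProduct-poly zs
    ... | n , as , p with timesLinear 0# a as 1#
    ...   | bs , q = suc n , bs , λ x → R.trans (q x) (R.trans (R.+-identityˡ _) (R.*-congˡ (p x)))

  -- For `z` in the valuation ring: the residue of `z` differs from that of every integral member of
  -- `zs`. Members outside the valuation ring impose no condition.
  Fresh : List K → K → Set ℓ
  Fresh zs z = All (λ a → z + - a ≼ 1#) zs

  private
    product-≼1 : ∀ {zs z} → z ≺ 1# → All (1# ≼_) zs → rootProduct zs z ≼ 1#
    product-≼1 z≺1 []           = ≼-refl
    product-≼1 {a ∷ zs} {z} z≺1 (1≼a ∷ 1≼zs) = ≼-trans (*-mono-≼ z-a≼1 (product-≼1 z≺1 1≼zs)) (≼-reflexive (R.*-identityˡ 1#))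
      where
      z-a≼1 : z + - a ≼ 1#
      z-a≼1 = ≼-trans (proj₁ (∼⇒≍ (≺-resp R.refl (solve 2 (λ z a → :- a := (z :+ :- a) :+ :- z) R.refl z a)
        (≺-neg (≺-≼-trans z≺1 1≼a))))) (≺⇒≼ z≺1)

    product-1≼ : ∀ {zs z} → 1# ≼ z → All (1# ≼_) zs → 1# ≼ rootProduct zs z
    product-1≼ 1≼z []           = ≼-refl
    product-1≼ 1≼z (1≼a ∷ 1≼zs) = ≼-trans (≼-reflexive (R.sym (R.*-identityˡ 1#)))
      (*-mono-≼ (minus-≼ 1≼z 1≼a) (product-1≼ 1≼z 1≼zs))

    -- All factors have valuation at least 0, so a product of valuation at most 0 leaves no room for
    -- a positive one.
    product-fresh : ∀ {zs z} → 1# ≼ z → All (1# ≼_) zs → rootProduct zs z ≼ 1# → Fresh zs z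
    product-fresh 1≼z []           p = []
    product-fresh {a ∷ zs} {z} 1≼z (1≼a ∷ 1≼zs) p =
      ≼-trans (≼-trans (≼-reflexive (R.sym (R.*-identityʳ _))) (*-monoʳ-≼ _ (product-1≼ 1≼z 1≼zs))) p
      ∷ product-fresh 1≼z 1≼zs (≼-trans (≼-trans (≼-reflexive (R.sym (R.*-identityˡ _))) (*-monoˡ-≼ _ (minus-≼ 1≼z 1≼a))) p)

    fresh-integral : ∀ zs → All (1# ≼_) zs → ∃ λ z → z ≍ 1# × Fresh zs z
    fresh-integral zs 1≼zs with rootProduct-poly zs
    ... | n , as , p with ac (- 1# ∷ as) 1# 1≉0
    ...   | z , q = z , (z≼1 , 1≼z) , product-fresh 1≼z 1≼zs (≼-trans
        (≼-trans (≼-reflexive (R.sym (R.*-identityˡ _))) (*-monoˡ-≼ _ 1≼z)) (≼-reflexive zp≈1))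
      where
      zp≈1 : z * rootProduct zs z ≈ 1#
      zp≈1 = R.trans (R.*-congˡ (R.sym (p z))) (-x+y≈0⇒y≈x q)
      1≼z : 1# ≼ z
      1≼z with ≼-or-≻ 1# z
      ... | inj₁ 1≼z = 1≼z
      ... | inj₂ z≺1 = ≺-≼-absurd z≺1 (≼-trans (≼-reflexive (R.sym zp≈1))
        (≼-trans (*-monoʳ-≼ z (product-≼1 z≺1 1≼zs)) (≼-reflexive (R.*-identityʳ z))))
      z≼1 : z ≼ 1#
      z≼1 = ≼-trans (≼-trans (≼-reflexive (R.sym (R.*-identityʳ z))) (*-monoʳ-≼ z (product-1≼ 1≼z 1≼zs))) (≼-reflexive zp≈1)

    integral-part : ∀ zs → ∃ λ zs′ → All (1# ≼_) zs′ × (∀ {z} → 1# ≼ z → Fresh zs′ z → Fresh zs z)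
    integral-part [] = [] , [] , λ _ _ → []
    integral-part (a ∷ zs) with integral-part zs | ≼-or-≻ 1# a
    ... | zs′ , 1≼zs′ , f | inj₁ 1≼a = a ∷ zs′ , 1≼a ∷ 1≼zs′ , λ { 1≼z (p ∷ ps) → p ∷ f 1≼z ps }
    ... | zs′ , 1≼zs′ , f | inj₂ a≺1 = zs′ , 1≼zs′ , λ {z} 1≼z ps →
      ≼-trans (proj₁ (∼⇒≍ {z + - a} { - a} (≼-≺-trans (proj₁ ≍-neg) (≺-resp R.refl
        (solve 2 (λ z a → z := (z :+ :- a) :+ :- :- a) R.refl z a) (≺-≼-trans a≺1 1≼z))))) (≼-trans (proj₁ ≍-neg) (≺⇒≼ a≺1))
      ∷ f 1≼z ps

  -- A root of X ∏ (X − aᵢ) = 1 is a unit, as are all the factors.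
  abstract
    fresh-unit : ∀ zs → ∃ λ z → z ≍ 1# × Fresh zs z
    fresh-unit zs =
      let zs′ , 1≼zs′ , f = integral-part zs
          z , z≍1 , fresh = fresh-integral zs′ 1≼zs′
      in z , z≍1 , f (proj₂ z≍1) fresh

  fresh-resp : ∀ {zs z z′} → 1# ≺ z + - z′ → Fresh zs z → Fresh zs z′
  fresh-resp 1≺ = All.map λ {a} z-a≼1 → case ≼-or-≻ _ 1# of λ where
    (inj₁ p) → p
    (inj₂ p) → ≺-≼-absurd (minus-trans-≺ 1≺ p) z-a≼1

  abstract
    -- Since z u - a = (z - a u⁻¹) u, it suffices that `z` avoids `zs` and its multiples by `u⁻¹`.
    -- Every unit thereby becomes a quotient of two fresh units.
    fresh-scaled : ∀ {u} → u ≍ 1# → ∀ zs → ∃ λ z → z ≍ 1# × Fresh zs z × Fresh zs (z * u)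
    fresh-scaled {u} u≍1 zs =
      let z , z≍1 , fresh = fresh-unit (zs ++ map (_* u⁻¹) zs)
      in z , z≍1 , All.++⁻ˡ zs fresh , All.map (scale z) (All.map⁻ (All.++⁻ʳ zs fresh))
      where
      u⁻¹ : K
      u⁻¹ = proj₁ (inverse u (≉0-resp-≼ 1≉0 (proj₁ u≍1)))
      uu⁻¹≈1 : u * u⁻¹ ≈ 1#
      uu⁻¹≈1 = proj₂ (inverse u (≉0-resp-≼ 1≉0 (proj₁ u≍1)))
      scale : ∀ z {a} → z + - (a * u⁻¹) ≼ 1# → z * u + - a ≼ 1#
      scale z {a} p = ≼-trans (≼-reflexive (R.trans
          (R.+-congˡ (R.-‿cong (R.trans (R.sym (R.*-identityʳ a)) (R.*-congˡ (R.sym uu⁻¹≈1)))))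
          (solve 4 (λ z u a w → z :* u :+ :- (a :* (u :* w)) := (z :+ :- (a :* w)) :* u) R.refl z u a u⁻¹)))
        (≼-trans (*-mono-≼ p (proj₁ u≍1)) (≼-reflexive (R.*-identityˡ 1#)))

  private
    inv : K → K
    inv a with em {P = a ≈ 0#}
    ... | yes _   = 0#
    ... | no  a≉0 = proj₁ (inverse a a≉0)

    inv-inverse : ∀ {a} → a ≉ 0# → a * inv a ≈ 1#
    inv-inverse {a} a≉0 with em {P = a ≈ 0#}
    ... | yes a≈0  = contradiction a≈0 a≉0
    ... | no  a≉0′ = proj₂ (inverse a a≉0′)

  ∼-minus : ∀ {x y} → x ≺ y → x + - y ∼ x
  ∼-minus {x} {y} x≺y = ≺-resp R.refl (solve 2 (λ x y → :- y := (x :+ :- y) :+ :- x) R.refl x y) (≺-neg x≺y)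

  ≍-minus : ∀ {x y} → y ≺ x → x + - y ≍ y
  ≍-minus {x} {y} y≺x = ≍-trans (∼⇒≍ (≼-≺-trans (proj₁ ≍-neg) (≺-resp R.refl
    (solve 2 (λ x y → x := (x :+ :- y) :+ :- :- y) R.refl x y) y≺x))) ≍-neg

  unit-inverse : ∀ {z w} → z * w ≈ 1# → z ≍ 1# → w ≍ 1#
  unit-inverse {z} {w} zw≈1 z≍1 = ≍-trans (≍-reflexive (R.sym (R.*-identityˡ w)))
    (≍-trans (*-cong-≍ (≍-sym z≍1) ≍-refl) (≍-reflexive zw≈1))

  private
    module _ {z w} (zw≈1 : z * w ≈ 1#) (z≍1 : z ≍ 1#) where

      fresh-invert : ∀ {a} → z + - inv a ≼ 1# → w + - a ≼ 1#
      fresh-invert {a} p with ≼-or-≻ a 1#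
      ... | inj₂ 1≺a = ≼-trans (proj₁ (∼⇒≍ (∼-minus (≼-≺-trans (proj₁ (unit-inverse zw≈1 z≍1)) 1≺a)))) (proj₁ (unit-inverse zw≈1 z≍1))
      ... | inj₁ a≼1 = ≼-trans (≼-reflexive (R.trans
          (R.+-cong (R.trans (R.sym (R.*-identityʳ _)) (R.*-congˡ (R.sym (inv-inverse (≉0-resp-≼ 1≉0 a≼1)))))
                    (R.-‿cong (R.trans (R.sym (R.*-identityʳ _)) (R.*-congˡ (R.sym zw≈1)))))
          (solve 4 (λ z w a b → w :* (a :* b) :+ :- (a :* (z :* w)) := (b :+ :- z) :* (w :* a)) R.refl z w a (inv a))))
        (≼-trans (*-mono-≼ (≼-trans (≼-reflexive (R.sym (minus-swap z (inv a)))) (≼-trans (proj₁ ≍-neg) p))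
                           (≼-trans (*-mono-≼ (proj₁ (unit-inverse zw≈1 z≍1)) a≼1) (≼-reflexive (R.*-identityˡ 1#))))
                 (≼-reflexive (R.*-identityˡ 1#)))

  -- For `a ≼ 1#` use w - a = (a⁻¹ - z)(w a); for `1# ≺ a` the unit `w` is away from `a` anyway.
  -- This allows one genericity statement to compare a unit with its inverse.
  fresh-inverse : ∀ zs → ∃ λ z → ∃ λ w → z * w ≈ 1# × z ≍ 1# × Fresh zs z × Fresh zs w
  fresh-inverse zs =
    let z , z≍1 , fresh = fresh-unit (zs ++ map inv zs)
        w , zw≈1 = inverse z (≉0-resp-≼ 1≉0 (proj₁ z≍1))
    in z , w , zw≈1 , z≍1 , All.++⁻ˡ zs fresh , All.map (fresh-invert zw≈1 z≍1) (All.map⁻ (All.++⁻ʳ zs fresh))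

  BCB : Pred K ℓ → Set _
  BCB = BooleanCombinationOfBalls V

  SameCut : List K → K → K → Set ℓ
  SameCut L x y = All (λ l → (x ≺ l × y ≺ l) ⊎ (l ≺ x × l ≺ y)) L

  private
    sameCut-sym : ∀ {L x y} → SameCut L x y → SameCut L y x
    sameCut-sym = All.map (Sum.map (λ (p , q) → q , p) (λ (p , q) → q , p))

    sameCut-≼ : ∀ {l a x y} → SameCut (l ∷ a ∷ []) x y → l ≼ x + - a → l ≼ y + - a
    sameCut-≼ (p ∷ inj₂ (a≺x , a≺y) ∷ []) q =
      ≼-trans (≼-trans q (proj₁ (≍-minus a≺x))) (proj₂ (≍-minus a≺y))
    sameCut-≼ (inj₁ (x≺l , y≺l) ∷ inj₁ (x≺a , y≺a) ∷ []) q =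
      ≺-≼-absurd x≺l (≼-trans q (proj₁ (∼⇒≍ (∼-minus x≺a))))
    sameCut-≼ (inj₂ (l≺x , l≺y) ∷ inj₁ (x≺a , y≺a) ∷ []) q =
      ≼-trans (≺⇒≼ l≺y) (proj₂ (∼⇒≍ (∼-minus y≺a)))

    sameCut-≺ : ∀ {l a x y} → SameCut (l ∷ a ∷ []) x y → l ≺ x + - a → l ≺ y + - a
    sameCut-≺ (p ∷ inj₂ (a≺x , a≺y) ∷ []) q =
      ≺-≼-trans (≺-≼-trans q (proj₁ (≍-minus a≺x))) (proj₂ (≍-minus a≺y))
    sameCut-≺ (inj₁ (x≺l , y≺l) ∷ inj₁ (x≺a , y≺a) ∷ []) q =
      ≺-≼-absurd x≺l (≺⇒≼ (≺-≼-trans q (proj₁ (∼⇒≍ (∼-minus x≺a)))))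
    sameCut-≺ (inj₂ (l≺x , l≺y) ∷ inj₁ (x≺a , y≺a) ∷ []) q =
      ≺-≼-trans l≺y (proj₂ (∼⇒≍ (∼-minus y≺a)))

  abstract
    -- Membership of `x` in a ball with centre `a` and size `l` is decided by the position of v(x)
    -- relative to v(l) and v(a), as long as v(x) equals neither.
    critical : ∀ {P} → BCB P → ∃ λ L → ∀ {x y} → SameCut L x y → P x → P y
    critical (ball B) with ball-form B
    ... | inj₁ (a , l , form)        = l ∷ a ∷ [] , λ {x} {y} same p → Equivalence.from (form y) (sameCut-≼ same (Equivalence.to (form x) p))
    ... | inj₂ (inj₁ (a , l , form)) = l ∷ a ∷ [] , λ {x} {y} same p → Equivalence.from (form y) (sameCut-≺ same (Equivalence.to (form x) p))
    ... | inj₂ (inj₂ whole)           = [] , λ {x} {y} _ _ → whole y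
    critical (compl b) with critical b
    ... | L , f = L , λ same ¬p p → ¬p (f (sameCut-sym same) p)
    critical (union b c) with critical b | critical c
    ... | L , f | L′ , g = L ++ L′ , λ same → Sum.map (f (All.++⁻ˡ L same)) (g (All.++⁻ʳ L same))
    critical (inter b c) with critical b | critical c
    ... | L , f | L′ , g = L ++ L′ , λ same (p , q) → f (All.++⁻ˡ L same) p , g (All.++⁻ʳ L same) q
    critical (resp (P⊆Q , Q⊆P) b) with critical b
    ... | L , f = L , λ same q → P⊆Q (f same (Q⊆P q))

  private
    fresh-≍ : ∀ {a z z′} → 1# ≼ z → 1# ≼ z′ → z + - a ≼ 1# → z′ + - a ≼ 1# → z + - a ≍ z′ + - a
    fresh-≍ {a} 1≼z 1≼z′ p p′ with ≼-or-≻ 1# a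
    ... | inj₁ 1≼a = ≼-trans p (minus-≼ 1≼z′ 1≼a) , ≼-trans p′ (minus-≼ 1≼z 1≼a)
    ... | inj₂ a≺1 = ≍-trans (≍-minus (≺-≼-trans a≺1 1≼z)) (≍-sym (≍-minus (≺-≼-trans a≺1 1≼z′)))

  abstract
    -- For a fresh integral `z`, v(z - a) is the minimum of 0 and v(a) whatever `z` is, so no ball
    -- with centre `a` separates two such elements.
    generic : ∀ {P} → BCB P → ∃ λ zs → ∀ {z z′} → 1# ≼ z → 1# ≼ z′ → Fresh zs z → Fresh zs z′ → P z → P z′
    generic (ball B) with ball-form B
    ... | inj₁ (a , l , form)        = a ∷ [] , λ where
      1≼z 1≼z′ (p ∷ []) (p′ ∷ []) q → Equivalence.from (form _) (≼-trans (Equivalence.to (form _) q) (proj₁ (fresh-≍ 1≼z 1≼z′ p p′)))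
    ... | inj₂ (inj₁ (a , l , form)) = a ∷ [] , λ where
      1≼z 1≼z′ (p ∷ []) (p′ ∷ []) q → Equivalence.from (form _) (≺-≼-trans (Equivalence.to (form _) q) (proj₁ (fresh-≍ 1≼z 1≼z′ p p′)))
    ... | inj₂ (inj₂ whole)           = [] , λ {z} {z′} _ _ _ _ _ → whole z′
    generic (compl b) with generic b
    ... | zs , f = zs , λ 1≼z 1≼z′ fr fr′ ¬p p → ¬p (f 1≼z′ 1≼z fr′ fr p)
    generic (union b c) with generic b | generic c
    ... | zs , f | zs′ , g = zs ++ zs′ , λ 1≼z 1≼z′ fr fr′ →
      Sum.map (f 1≼z 1≼z′ (All.++⁻ˡ zs fr) (All.++⁻ˡ zs fr′)) (g 1≼z 1≼z′ (All.++⁻ʳ zs fr) (All.++⁻ʳ zs fr′))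
    generic (inter b c) with generic b | generic c
    ... | zs , f | zs′ , g = zs ++ zs′ , λ 1≼z 1≼z′ fr fr′ (p , q) →
      f 1≼z 1≼z′ (All.++⁻ˡ zs fr) (All.++⁻ˡ zs fr′) p , g 1≼z 1≼z′ (All.++⁻ʳ zs fr) (All.++⁻ʳ zs fr′) q
    generic (resp (P⊆Q , Q⊆P) b) with generic b
    ... | zs , f = zs , λ 1≼z 1≼z′ fr fr′ q → P⊆Q (f 1≼z 1≼z′ fr fr′ (Q⊆P q))

-- Definable sets near infinity and definable cuts

module CMinimalFields {ℓ} {E : Language ℓ} (em : ∀ {a} → ExcludedMiddle a)
  (M : Structure ℓ (Ldiv+ E)) (V : ValuedField M) (ac : AlgebraicallyClosed V)
  (cminimal : CMinimal M) where

  open Closed em M V ac public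
  open Definability M public

  private
    variable
      P Q : Pred K ℓ

  by-contradiction : ∀ {a} {A : Set a} → (¬ A → ⊥₀) → A
  by-contradiction = decidable-stable em

  abstract
    definable⇒BCB : ∀ (φ : Fm 0 1) → BCB (λ x → Sat φ (x ∷ []) [])
    definable⇒BCB φ = cminimal M (λ _ → mk⇔ id id) V _ (def-resp (λ { (x ∷ []) → mk⇔ id id }) (def-sat φ))

  relᶠ : ∀ {n} (R : K → K → Set ℓ) → Definable₂ R → Fin n → Fin n → Fm 0 n
  relᶠ R D i j = atom _ D (i ∷ j ∷ [])

  Ev : Pred K ℓ → Set ℓ
  Ev P = ∃ λ s → s ≉ 0# × (∀ y → y ≺ s → P y)

  Ev₂ : (K → K → Set ℓ) → Set ℓ
  Ev₂ R = ∃ λ s → s ≉ 0# × (∀ y y′ → y ≺ s → y′ ≺ s → R y y′)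

  ev-map : (∀ {y} → P y → Q y) → Ev P → Ev Q
  ev-map f (s , s≉0 , p) = s , s≉0 , λ y y≺s → f (p y y≺s)

  ev-∧ : Ev P → Ev Q → Ev (λ y → P y × Q y)
  ev-∧ (s , s≉0 , p) (t , t≉0 , q) = s ⊓ t , ⊓-≉0 s≉0 t≉0 , λ y y≺ →
    p y (≺-≼-trans y≺ (⊓-≼ˡ s t)) , q y (≺-≼-trans y≺ (⊓-≼ʳ s t))

  ev-witness : Ev P → ∃ λ y → y ≉ 0# × P y
  ev-witness (s , s≉0 , p) = π * s , *-≉0 π≉0 s≉0 , p _ (πx≺x s≉0)

  ev-absurd : ∀ {a} {A : Set a} → Ev P → Ev (λ y → ¬ P y) → A
  ev-absurd p ¬p = let _ , _ , q , ¬q = ev-witness (ev-∧ p ¬p) in contradiction q ¬q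

  ev-below : ∀ {s} → s ≉ 0# → Ev (_≺ s)
  ev-below s≉0 = _ , s≉0 , λ _ → id

  below : ∀ L → ∃ λ s → s ≉ 0# × All (s ≼_) L
  below []      = 1# , 1≉0 , []
  below (l ∷ L) = let s , s≉0 , s≼L = below L in case em {P = l ≈ 0#} of λ where
    -- `0#` is the `≼`-largest element and imposes no condition.
    (yes l≈0) → s , s≉0 , ≼-trans ≼-0 (≼-reflexive (R.sym l≈0)) ∷ s≼L
    (no  l≉0) → s ⊓ l , ⊓-≉0 s≉0 l≉0 , ⊓-≼ʳ s l ∷ All.map (≼-trans (⊓-≼ˡ s l)) s≼L

  abstract
    -- Points beyond all critical values lie on the same side of each of them, so a single one in
    -- `P` brings all the others.
    eventually : BCB P → Ev P ⊎ Ev (λ y → ¬ P y)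
    eventually {P} b =
      let L , f = critical b
          s , s≉0 , s≼L = below L
      in case em {P = ∃ λ x → x ≺ s × P x} of λ where
        (yes (x , x≺s , p)) → inj₁ (s , s≉0 , λ y y≺s → f (All.map (λ s≼l → inj₁ (≺-≼-trans x≺s s≼l , ≺-≼-trans y≺s s≼l)) s≼L) p)
        (no  ¬p)            → inj₂ (s , s≉0 , λ y y≺s p → ¬p (_ , y≺s , p))

  module _ {C : Pred K ℓ} (b : BCB C) {s} (below-s : ∀ {y} → y ≺ s → ¬ C y)
    {y₀} (y₀∈C : C y₀) (no-minimum : ∀ {x} → x ≼ y₀ → C x → ∃ λ x′ → x′ ≺ x × C x′) where

    private
      -- No `k` of the list has a value above v(l) and up to v(m), so that `critical` carries
      -- membership in `C` from `m` to everything strictly between `l` and `m`.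
      Gap : List K → Set ℓ
      Gap L = ∃ λ l → ∃ λ m → m ≼ y₀ × C m × (∀ x → x ≼ l → ¬ C x) × All (λ k → k ≼ l ⊎ m ≺ k) L

      gap : s ≉ 0# → ∀ L → Gap L
      gap s≉0 []      = π * s , y₀ , ≼-refl , y₀∈C , (λ _ x≼ → below-s (≼-≺-trans x≼ (πx≺x s≉0))) , []
      gap s≉0 (k ∷ L) =
        let l , m , m≼y₀ , m∈C , ≼l∉C , sep = gap s≉0 L
        in case em {P = ∃ λ x → x ≺ k × C x} of λ where
          (yes (x , x≺k , x∈C)) → case ≼-or-≻ k m of λ where
            (inj₂ m≺k) → l , m , m≼y₀ , m∈C , ≼l∉C , inj₂ m≺k ∷ sep
            (inj₁ k≼m) → l , x , ≼-trans (≺⇒≼ x≺k) (≼-trans k≼m m≼y₀) , x∈C , ≼l∉C ,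
              inj₂ x≺k ∷ All.map (Sum.map₂ (≺-trans (≺-≼-trans x≺k k≼m))) sep
          -- Now `C` lies above `k`, and strictly so because it has no minimum; hence `l` may be
          -- raised to `k`.
          (no  none) →
            let k≼C : ∀ {x} → C x → k ≼ x
                k≼C {x} x∈C = case ≼-or-≻ k x of λ where
                  (inj₁ k≼x) → k≼x
                  (inj₂ x≺k) → contradiction (x , x≺k , x∈C) none
                ≼k∉C : ∀ x → x ≼ k → ¬ C x
                ≼k∉C _ x≼k x∈C =
                  let x′ , x′≺x , x′∈C = no-minimum (≼-trans x≼k (≼-trans (k≼C m∈C) m≼y₀)) x∈C
                  in none (x′ , ≺-≼-trans x′≺x x≼k , x′∈C)
            in case ≼-total k l of λ where
              (inj₁ k≼l) → l , m , m≼y₀ , m∈C , ≼l∉C , inj₁ k≼l ∷ sep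
              (inj₂ l≼k) → k , m , m≼y₀ , m∈C , ≼k∉C , inj₁ ≼-refl ∷ All.map (Sum.map₁ (λ k′≼l → ≼-trans k′≼l l≼k)) sep

    -- The infimum of a definable set without minimum: the critical values
    -- are moved out of a half-open interval one after the other.
    left-endpoint : s ≉ 0# → ∃ λ l → ∃ λ m → l ≺ m × m ≼ y₀ ×
      (∀ x → x ≼ l → ¬ C x) × (∀ x → l ≺ x → x ≺ m → C x)
    left-endpoint s≉0 =
      let L , f = critical b
          l , m , m≼y₀ , m∈C , ≼l∉C , sep = gap s≉0 L
          l≺m : l ≺ m
          l≺m = λ m≼l → contradiction m∈C (≼l∉C _ m≼l)
      in l , m , l≺m , m≼y₀ , ≼l∉C , λ _ l≺x x≺m → f (All.map (λ where
        (inj₁ k≼l) → inj₂ (≼-≺-trans k≼l l≺m , ≼-≺-trans k≼l l≺x)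
        (inj₂ m≺k) → inj₁ (m≺k , ≺-trans x≺m m≺k)) sep) m∈C

  ≺-⊓ : ∀ {x y z} → z ≺ x → z ≺ y → z ≺ x ⊓ y
  ≺-⊓ {x} {y} z≺x z≺y with ≼-total x y
  ... | inj₁ _ = z≺x
  ... | inj₂ _ = z≺y

  -- The cut is realized by a minimum of the complement if there is one, and otherwise by the
  -- infimum that `left-endpoint` provides. Whether `l` itself belongs to `Λ` is left open.
  threshold : ∀ {Λ : Pred K ℓ} → BCB Λ → (∀ {x y} → x ≼ y → Λ y → Λ x) →
    ∀ {a b} → Λ a → b ≉ 0# → ¬ Λ b →
    ∃ λ l → l ≉ 0# × (∀ x → x ≺ l → Λ x) × (∀ x → l ≺ x → ¬ Λ x)
  threshold {Λ} bcb down {a} {b} a∈Λ b≉0 b∉Λ =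
    case em {P = ∃ λ x → x ≼ b × ¬ Λ x × (∀ x′ → x′ ≺ x → Λ x′)} of λ where
      (yes (l , l≼b , l∉Λ , ≺l)) → l , ≉0-resp-≼ b≉0 l≼b , ≺l , λ _ l≺x x∈Λ → l∉Λ (down (≺⇒≼ l≺x) x∈Λ)
      (no  none) →
        let l , m , l≺m , m≼b , ≼l , above = left-endpoint (compl bcb) {a}
              (λ y≺a y∉Λ → y∉Λ (down (≺⇒≼ y≺a) a∈Λ)) b∉Λ
              (λ {x} x≼b x∉Λ → by-contradiction λ ¬∃ → none (x , x≼b , x∉Λ , λ x′ x′≺x →
                by-contradiction λ x′∉Λ → ¬∃ (x′ , x′≺x , x′∉Λ)))
              (≉0-resp-≼ b≉0 (≺⇒≼ {a} {b} λ b≼a → contradiction (down b≼a a∈Λ) b∉Λ))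
        in l , ≺⇒≉0 l≺m , (λ _ x≺l → by-contradiction (≼l _ (≺⇒≼ x≺l))) , λ x l≺x x∈Λ →
          let m≉0 = ≉0-resp-≼ b≉0 m≼b
              z , l≺z , z≺ = between {l} {m ⊓ x} (≺-⊓ l≺m l≺x) (≉0-resp-≼ m≉0 (⊓-≼ˡ m x))
          in above z l≺z (≺-≼-trans z≺ (⊓-≼ˡ m x)) (down (≼-trans (≺⇒≼ z≺) (⊓-≼ʳ m x)) x∈Λ)

  -- Definable equivalence relations near infinity

  -- The laws are demanded beyond `bound` only, because some of the relations compare quotients of
  -- functions that may vanish elsewhere.
  record NearEquivalence (_~_ : K → K → Set ℓ) : Set ℓ where
    field
      definable : Definable₂ _~_
      bound     : K
      bound≉0   : bound ≉ 0#
      reflexive : ∀ {x} → x ≺ bound → x ~ x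
      symmetric : ∀ {x y} → x ≺ bound → y ≺ bound → x ~ y → y ~ x
      transitive : ∀ {x y z} → x ≺ bound → y ≺ bound → z ≺ bound → x ~ y → y ~ z → x ~ z

  module _ {_~_ : K → K → Set ℓ} (equiv : NearEquivalence _~_) where
    open NearEquivalence equiv

    private
      -- `D`: the point is equivalent to one strictly nearer to infinity. `J`: the point is the
      -- infimum of a class that omits it and fills an interval just above it.
      D J : Fm 0 1
      D = exᶠ (` 0F ≺ᶠ ` 1F ∧ᶠ relᶠ _~_ definable 0F 1F)
      J = exᶠ (exᶠ (` 2F ≺ᶠ ` 1F ∧ᶠ ` 1F ≺ᶠ # bound ∧ᶠ ` 0F ≺ᶠ # bound ∧ᶠ
            allᶠ (` 3F ≺ᶠ ` 0F ⇒ᶠ ` 0F ≺ᶠ ` 2F ⇒ᶠ relᶠ _~_ definable 0F 1F) ∧ᶠ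
            allᶠ (` 0F ≼ᶠ ` 3F ⇒ᶠ relᶠ _~_ definable 0F 1F ⇒ᶠ falseᶠ)))

      InJ : K → Set ℓ
      InJ y = Sat J (y ∷ []) []

      classBCB : ∀ y → BCB (_~ y)
      classBCB y = definable⇒BCB (exᶠ (` 0F ≈ᶠ # y ∧ᶠ relᶠ _~_ definable 1F 0F)) |>′ resp
        ((λ {x} (z , z≈y , x~z) → Definable-cong definable (R.refl Pointwise.∷ z≈y Pointwise.∷ Pointwise.[]) x~z) ,
         (λ x~y → y , R.refl , x~y))

      -- Infima of distinct classes without minimum are distinct, and the
      -- class of l is an interval just above l, so the infima cannot fill
      -- an interval.
      ¬evJ : ¬ Ev InJ
      ¬evJ (s , s≉0 , inJ) =
        let l₁ = π * s
            m₁ , y₁ , l₁≺m₁ , m₁≺b , y₁≺b , above₁ , below₁ = inJ l₁ (πx≺x s≉0)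
            l₂ , l₁≺l₂ , l₂≺ = between {l₁} {m₁ ⊓ s} (≺-⊓ l₁≺m₁ (πx≺x s≉0)) (⊓-≉0 (≺⇒≉0 m₁≺b) s≉0)
            l₂≺m₁ = ≺-≼-trans l₂≺ (⊓-≼ˡ m₁ s)
            m₂ , y₂ , l₂≺m₂ , m₂≺b , y₂≺b , above₂ , below₂ = inJ l₂ (≺-≼-trans l₂≺ (⊓-≼ʳ m₁ s))
            x , l₂≺x , x≺ = between {l₂} {m₁ ⊓ m₂} (≺-⊓ l₂≺m₁ l₂≺m₂) (⊓-≉0 (≺⇒≉0 m₁≺b) (≺⇒≉0 m₂≺b))
            x≺m₁ = ≺-≼-trans x≺ (⊓-≼ˡ m₁ m₂)
            x≺m₂ = ≺-≼-trans x≺ (⊓-≼ʳ m₁ m₂)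
            x≺b  = ≺-trans x≺m₁ m₁≺b
            l₂≺b = ≺-trans l₂≺m₁ m₁≺b
        in ⊥-elim (below₂ l₂ ≼-refl (transitive l₂≺b y₁≺b y₂≺b (above₁ l₂ l₁≺l₂ l₂≺m₁)
             (transitive y₁≺b x≺b y₂≺b (symmetric x≺b y₁≺b (above₁ x (≺-trans l₁≺l₂ l₂≺x) x≺m₁)) (above₂ x l₂≺x x≺m₂))))

    -- If `D` eventually fails, equivalent points have equal values. If it eventually holds, classes
    -- have no minimum: either one class contains a neighborhood of infinity, or every class has an
    -- infimum, and these infima put points of `J` arbitrarily far out, against `¬evJ`.
    constant-or-injective : (Ev₂ λ y y′ → y ~ y′) ⊎ (Ev₂ λ y y′ → y ~ y′ → y ≍ y′)
    constant-or-injective = case eventually (definable⇒BCB D) of λ where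
      (inj₂ (s₁ , s₁≉0 , ¬D)) → inj₂ (bound ⊓ s₁ , ⊓-≉0 bound≉0 s₁≉0 , λ y y′ y≺ y′≺ y~y′ →
        let y≺b = ≺-≼-trans y≺ (⊓-≼ˡ bound s₁) ; y′≺b = ≺-≼-trans y′≺ (⊓-≼ˡ bound s₁)
            y≺s = ≺-≼-trans y≺ (⊓-≼ʳ bound s₁) ; y′≺s = ≺-≼-trans y′≺ (⊓-≼ʳ bound s₁)
        in by-contradiction (λ y≭y′ → case ≼-or-≻ y y′ of λ where
             (inj₂ y′≺y) → ¬D y y≺s (y′ , y′≺y , symmetric y≺b y′≺b y~y′)
             (inj₁ y≼y′) → case ≼-or-≻ y′ y of λ where
               (inj₁ y′≼y) → y≭y′ (y≼y′ , y′≼y)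
               (inj₂ y≺y′) → ¬D y′ y′≺s (y , y≺y′ , y~y′)))
      (inj₁ (s₁ , s₁≉0 , inD)) → case em {P = ∃ λ y → y ≺ bound × Ev (_~ y)} of λ where
        (yes (y₀ , y₀≺b , s , s≉0 , ~y₀)) → inj₁ (bound ⊓ s , ⊓-≉0 bound≉0 s≉0 , λ y y′ y≺ y′≺ →
          let y≺b = ≺-≼-trans y≺ (⊓-≼ˡ bound s) ; y′≺b = ≺-≼-trans y′≺ (⊓-≼ˡ bound s)
          in transitive y≺b y₀≺b y′≺b (~y₀ y (≺-≼-trans y≺ (⊓-≼ʳ bound s)))
               (symmetric y′≺b y₀≺b (~y₀ y′ (≺-≼-trans y′≺ (⊓-≼ʳ bound s)))))
        (no  none) →
          let s₀ = bound ⊓ s₁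
              s₀≉0 = ⊓-≉0 bound≉0 s₁≉0
              infimum : ∀ y → y ≺ s₀ → ∃ λ l → l ≺ y × InJ l
              infimum y y≺s₀ =
                let y≺b = ≺-≼-trans y≺s₀ (⊓-≼ˡ bound s₁)
                    s , s≉0 , ≁y = Sum.[ (λ ev → contradiction (y , y≺b , ev) none) , id ]′ (eventually (classBCB y))
                    l , m , l≺m , m≼y , ≼l , above = left-endpoint (classBCB y) (λ {z} → ≁y z) (reflexive y≺b)
                      (λ {x} x≼y x~y →
                        let x≺s₀ = ≼-≺-trans x≼y y≺s₀
                            x′ , x′≺x , x′~x = inD x (≺-≼-trans x≺s₀ (⊓-≼ʳ bound s₁))
                            x≺b = ≺-≼-trans x≺s₀ (⊓-≼ˡ bound s₁)
                        in x′ , x′≺x , transitive (≺-trans x′≺x x≺b) x≺b y≺b x′~x x~y) s≉0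
                in l , ≺-≼-trans l≺m m≼y , m , y , l≺m , ≼-≺-trans m≼y y≺b , y≺b , above ,
                   λ x x≼l x~y → contradiction x~y (≼l x x≼l)
          in case eventually (definable⇒BCB J) of λ where
            (inj₁ evJ) → contradiction evJ ¬evJ
            (inj₂ (s , s≉0 , ¬J)) →
              let y = π * (s₀ ⊓ s)
                  y≺ = πx≺x (⊓-≉0 s₀≉0 s≉0)
                  l , l≺y , l∈J = infimum y (≺-≼-trans y≺ (⊓-≼ˡ s₀ s))
              in contradiction l∈J (¬J l (≺-trans l≺y (≺-≼-trans y≺ (⊓-≼ʳ s₀ s))))

  -- The sets N s decrease as s tends to infinity; being invariant modulo the
  -- maximal ideal, they are subsets of the residue field.
  module _ (N : K → K → Set ℓ) (definable : Definable₂ N)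
    (monotone  : ∀ {s s′ c} → s′ ≼ s → N s′ c → N s c)
    (invariant : ∀ {s c c′} → 1# ≼ c → 1# ≼ c′ → 1# ≺ c + - c′ → N s c → N s c′)
    (pointwise : ∀ c → 1# ≼ c → ∃ λ s → s ≉ 0# × ¬ N s c) where

    private
      Empty : K → Set ℓ
      Empty s = ∀ c → 1# ≼ c → ¬ N s c

      classBCB : ∀ s → BCB (N s)
      classBCB s = definable⇒BCB (exᶠ (` 0F ≈ᶠ # s ∧ᶠ relᶠ N definable 0F 1F)) |>′ resp
        ((λ {x} (z , z≈s , n) → Definable-cong definable (z≈s Pointwise.∷ R.refl Pointwise.∷ Pointwise.[]) n) ,
         (λ n → s , R.refl , n))

      _~_ : K → K → Set ℓ
      s ~ s′ = ∀ c → 1# ≼ c → (N s c → N s′ c) × (N s′ c → N s c)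

      equiv : NearEquivalence _~_
      equiv = record
        { definable  = definable₂ (allᶠ (# 1# ≼ᶠ ` 0F ⇒ᶠ
            (relᶠ N definable 1F 0F ⇒ᶠ relᶠ N definable 2F 0F) ∧ᶠ (relᶠ N definable 2F 0F ⇒ᶠ relᶠ N definable 1F 0F)))
        ; bound      = 1#
        ; bound≉0    = 1≉0
        ; reflexive  = λ _ c _ → id , id
        ; symmetric  = λ _ _ p c 1≼c → proj₂ (p c 1≼c) , proj₁ (p c 1≼c)
        ; transitive = λ _ _ _ p q c 1≼c → proj₁ (q c 1≼c) ∘ proj₁ (p c 1≼c) , proj₂ (p c 1≼c) ∘ proj₂ (q c 1≼c)
        }

      -- By `pointwise` each single residue class leaves the family at some stage, and finitely many
      -- such stages have a common successor.
      uncovered : ∀ {s} → s ≉ 0# → ∀ zs → ∃ λ t → t ≉ 0# × t ≼ s ×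
        All (λ a → ∀ c → 1# ≼ c → 1# ≺ c + - a → ¬ N t c) zs
      uncovered {s} s≉0 []       = s , s≉0 , ≼-refl , []
      uncovered {s} s≉0 (a ∷ zs) =
        let t , t≉0 , t≼s , ps = uncovered s≉0 zs
        in case em {P = ∃ λ c → 1# ≼ c × 1# ≺ c + - a} of λ where
          (no  none) → t , t≉0 , t≼s , (λ c 1≼c c~a _ → none (c , 1≼c , c~a)) ∷ ps
          (yes (c , 1≼c , c~a)) →
            let t′ , t′≉0 , ¬N = pointwise c 1≼c
            in t ⊓ t′ , ⊓-≉0 t≉0 t′≉0 , ≼-trans (⊓-≼ˡ t t′) t≼s ,
               (λ c′ 1≼c′ c′~a n → ¬N (monotone (⊓-≼ʳ t t′)
                 (invariant 1≼c′ 1≼c (minus-trans-≺ c′~a (minus-sym-≺ c~a)) n))) ∷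
               All.map (λ p c 1≼c c~a n → p c 1≼c c~a (monotone (⊓-≼ˡ t t′) n)) ps

      -- `generic` makes `N s` all or nothing on fresh residues. Nothing would leave only the
      -- classes of `zs`, which `uncovered` removes at a later stage.
      cofinite : ¬ (∃ λ s → s ≉ 0# × Empty s) → ∀ {s} → s ≉ 0# →
        ∃ λ zs → ∀ c → 1# ≼ c → Fresh zs c → N s c
      cofinite never {s} s≉0 =
        let zs , f = generic (classBCB s)
        in case em {P = ∃ λ c → 1# ≼ c × Fresh zs c × N s c} of λ where
          (yes (c , 1≼c , fresh , n)) → zs , λ c′ 1≼c′ fresh′ → f 1≼c 1≼c′ fresh fresh′ n
          (no  none) →
            let t , t≉0 , t≼s , ps = uncovered s≉0 zs
            in contradiction (t , t≉0 , λ c 1≼c n → none (c , 1≼c , All.map (λ {a} p → case ≼-or-≻ (c + - a) 1# of λ where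
                 (inj₁ fresh) → fresh
                 (inj₂ c~a)   → contradiction n (p c 1≼c c~a)) ps , monotone t≼s n)) never

      -- Between a and b infinitely many strict inclusions would have to
      -- fit, while only the classes of zs are available.
      no-injection : ∀ {s} → (∀ y y′ → y ≺ s → y′ ≺ s → y ~ y′ → y ≍ y′) →
        ∀ zs {a b} → a ≺ b → b ≺ s → ¬ (∀ c → 1# ≼ c → N b c → ¬ N a c → ¬ Fresh zs c)
      no-injection inj [] {a} {b} a≺b b≺s f = ≺-≼-absurd a≺b (proj₂ (inj a b (≺-trans a≺b b≺s) b≺s
        λ c 1≼c → monotone (≺⇒≼ a≺b) , λ n → by-contradiction λ ¬n → f c 1≼c n ¬n []))
      no-injection {s} inj (z ∷ zs) {a} {b} a≺b b≺s f =
        let t , a≺t , t≺b = between a≺b (≺⇒≉0 b≺s)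
        in case em {P = ∃ λ c → 1# ≼ c × 1# ≺ c + - z × N b c × ¬ N t c} of λ where
          (yes (c , 1≼c , c~z , n , ¬n)) → no-injection inj zs a≺t (≺-trans t≺b b≺s) λ c′ 1≼c′ n′ ¬n′ fresh →
            case ≼-or-≻ (c′ + - z) 1# of λ where
              (inj₁ p)    → f c′ 1≼c′ (monotone (≺⇒≼ t≺b) n′) ¬n′ (p ∷ fresh)
              (inj₂ c′~z) → ¬n (invariant 1≼c′ 1≼c (minus-trans-≺ c′~z (minus-sym-≺ c~z)) n′)
          (no  none) → no-injection inj zs t≺b b≺s λ c 1≼c n ¬n fresh →
            case ≼-or-≻ (c + - z) 1# of λ where
              (inj₁ p)   → f c 1≼c n (λ n′ → ¬n (monotone (≺⇒≼ a≺t) n′)) (p ∷ fresh)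
              (inj₂ c~z) → none (c , 1≼c , c~z , n , ¬n)

    -- Apply the dichotomy to equality of the sets `N s`. An eventually constant family equals its
    -- intersection, which is empty; in an eventually injective one, a later set is already
    -- cofinite, which leaves too few classes for the strict inclusions before it.
    uniformly-empty : ∃ λ s → s ≉ 0# × (∀ c → 1# ≼ c → ¬ N s c)
    uniformly-empty = by-contradiction λ never → case constant-or-injective equiv of λ where
      (inj₁ (s , s≉0 , constant)) →
        let t = π * s
            t≉0 = *-≉0 π≉0 s≉0
        in never (t , t≉0 , λ c 1≼c n →
          let s′ , s′≉0 , ¬n = pointwise c 1≼c
          in ¬n (monotone (⊓-≼ˡ s′ t) (proj₁ (constant t (s′ ⊓ t) (πx≺x s≉0) (≼-≺-trans (⊓-≼ʳ s′ t) (πx≺x s≉0)) c 1≼c) n)))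
      (inj₂ (s , s≉0 , injective)) →
        let b = π * s
            b≉0 = *-≉0 π≉0 s≉0
            zs , f = cofinite never (*-≉0 π≉0 b≉0)
        in no-injection injective zs (πx≺x b≉0) (πx≺x s≉0) λ c 1≼c _ ¬n fresh → ¬n (f c 1≼c fresh)

  -- the quantifier "for all sufficiently large y"; the bound is variable 1
  evᶠ : ∀ {d n} → Fm d (suc (suc n)) → Fm d n
  evᶠ φ = exᶠ (` 0F ≺ᶠ # 0# ∧ᶠ allᶠ (` 0F ≺ᶠ ` 1F ⇒ᶠ φ))

  ev⇒sat : {P : Pred K ℓ} → Ev P → ∃ λ s → s ≺ 0# × (∀ y → y ≺ s → P y)
  ev⇒sat (s , s≉0 , p) = s , ≉0⇒≺0 s≉0 , p

  sat⇒ev : {P : Pred K ℓ} → (∃ λ s → s ≺ 0# × (∀ y → y ≺ s → P y)) → Ev P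
  sat⇒ev (s , s≺0 , p) = s , ≺⇒≉0 s≺0 , p

  ev-scale : ∀ {P : Pred K ℓ} {t} → t ≉ 0# → Ev P → Ev (λ y → P (t * y))
  ev-scale {t = t} t≉0 (s , s≉0 , p) =
    let q , qt≈s = divide s t≉0
        tq≈s = R.trans (R.*-comm t q) qt≈s
    in q , *-≉0ʳ s≉0 tq≈s , λ y y≺q → p _ (≺-resp R.refl tq≈s (*-monoʳ-≺ t t≉0 y≺q))

  unit-≉0 : ∀ {z} → z ≍ 1# → z ≉ 0#
  unit-≉0 z≍1 = ≉0-resp-≼ 1≉0 (proj₁ z≍1)

  scale-≍ : ∀ {y z} → z ≍ 1# → y * z ≍ y
  scale-≍ {y} z≍1 = ≍-trans (*-cong-≍ (≍-refl {y}) z≍1) (≍-reflexive (R.*-identityʳ y))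

  ev-unit : ∀ {P : Pred K ℓ} {z} → z ≍ 1# → Ev P → Ev (λ y → P (y * z))
  ev-unit z≍1 (s , s≉0 , p) = s , s≉0 , λ y y≺s → p _ (≼-≺-trans (proj₁ (scale-≍ z≍1)) y≺s)

  cancel : ∀ {z w} → z * w ≈ 1# → ∀ y → y * w * z ≈ y
  cancel {z} {w} zw≈1 y = R.trans (R.*-assoc y w z)
    (R.trans (R.*-congˡ (R.trans (R.*-comm w z) zw≈1)) (R.*-identityʳ y))

  -- Eventual residues and invariance under units

  module _ {g₁ g₂} (G₁ : Graph g₁) (G₂ : Graph g₂) where

    private
      leading : K → Fm 0 2
      leading s = exᶠ (` 0F ≼ᶠ ` 1F ∧ᶠ ` 0F ≺ᶠ # s ∧ᶠ fn g₂ G₂ (` 0F) ≺ᶠ fn g₁ G₁ (` 0F) ⊕ ⊝ (` 2F ⊗ fn g₂ G₂ (` 0F)))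

    -- Consider the residues that g₁/g₂ takes beyond `t`. If none is eventually the only one, each
    -- is eventually avoided, and `uniformly-empty` leaves no residue at all far out.
    residue-constant : Ev (λ y → g₂ y ≉ 0# × g₂ y ≼ g₁ y) →
      ∃ λ c → 1# ≼ c × Ev (λ y → g₂ y ≺ g₁ y + - (c * g₂ y))
    residue-constant (s , s≉0 , g₂≼g₁) = by-contradiction λ none →
      uniformly-empty (λ t c → Sat (leading s) (t ∷ c ∷ []) []) (definable₂ (leading s))
        (λ t≼ (y , y≼ , y≺s , p) → y , ≼-trans y≼ t≼ , y≺s , p)
        (λ {_} {c} {c′} _ _ 1≺ (y , y≼ , y≺s , p) → y , y≼ , y≺s , minus-trans-≺ p
          (≺-resp (R.*-identityˡ _) (minus-*ʳ c c′ (g₂ y)) (*-monoˡ-≺ (g₂ y) (proj₁ (g₂≼g₁ y y≺s)) 1≺)))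
        (λ c 1≼c → case eventually (definable⇒BCB (fn g₂ G₂ (` 0F) ≺ᶠ fn g₁ G₁ (` 0F) ⊕ ⊝ (# c ⊗ fn g₂ G₂ (` 0F)))) of λ where
          (inj₁ ev) → contradiction (c , 1≼c , ev) none
          (inj₂ (t , t≉0 , ¬p)) → π * t , *-≉0 π≉0 t≉0 , λ (y , y≼ , _ , p) → ¬p y (≼-≺-trans y≼ (πx≺x t≉0)) p)
      |>′ λ (t , t≉0 , empty) → ev-witness (ev-∧ (ev-below t≉0) (ev-below s≉0))
      |>′ λ (y , _ , y≺t , y≺s) → divide (g₁ y) (proj₁ (g₂≼g₁ y y≺s))
      -- The quotient at `y` itself is a residue taken at `y`.
      |>′ λ (c , cg₂≈g₁) → empty c
           (*-cancelʳ-≼ (proj₁ (g₂≼g₁ y y≺s)) (≼-resp (R.sym (R.*-identityˡ _)) (R.sym cg₂≈g₁) (proj₂ (g₂≼g₁ y y≺s))))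
           (y , ≺⇒≼ y≺t , y≺s , ≺-≼-trans (≉0⇒≺0 (proj₁ (g₂≼g₁ y y≺s)))
             (≼-trans minus-self (≼-reflexive (R.+-congˡ (R.-‿cong (R.sym cg₂≈g₁))))))

  module _ {g} (G : Graph g) where

    private
      up down same : Fm 0 1
      up   = evᶠ (fn g G (` 0F) ≺ᶠ fn g G (` 0F ⊗ ` 2F))
      down = evᶠ (fn g G (` 0F ⊗ ` 2F) ≺ᶠ fn g G (` 0F))
      same = evᶠ (fn g G (` 0F ⊗ ` 2F) ≼ᶠ fn g G (` 0F) ∧ᶠ fn g G (` 0F) ≼ᶠ fn g G (` 0F ⊗ ` 2F))

      Up Down Same : K → Set ℓ
      Up   z = Sat up (z ∷ []) []
      Down z = Sat down (z ∷ []) []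
      Same z = Sat same (z ∷ []) []

      us ds ss zs : List K
      us = proj₁ (generic (definable⇒BCB up))
      ds = proj₁ (generic (definable⇒BCB down))
      ss = proj₁ (generic (definable⇒BCB same))
      zs = us ++ ds ++ ss

      trichotomy : ∀ z → Up z ⊎ Down z ⊎ Same z
      trichotomy z = case eventually (definable⇒BCB (fn g G (` 0F ⊗ # z) ≼ᶠ fn g G (` 0F))) of λ where
        (inj₂ ev) → inj₁ (ev⇒sat (ev-map (λ ¬p p → contradiction p ¬p) ev))
        (inj₁ ev) → case eventually (definable⇒BCB (fn g G (` 0F) ≼ᶠ fn g G (` 0F ⊗ # z))) of λ where
          (inj₁ ev′) → inj₂ (inj₂ (ev⇒sat (ev-∧ ev ev′)))
          (inj₂ ev′) → inj₂ (inj₁ (ev⇒sat (ev-map (λ ¬p p → contradiction p ¬p) ev′)))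

      back : ∀ {z w} → z * w ≈ 1# → ∀ y → g (y * w * z) ≍ g y
      back zw≈1 y = ≍-reflexive (graph-cong g G (cancel zw≈1 y))

      -- Inversion exchanges Up and Down, so neither contains a generic unit.
      same-fresh : ∀ {x} → x ≍ 1# → Fresh zs x → Same x
      same-fresh x≍1 fresh =
        fresh-inverse zs |>′ λ (z , w , zw≈1 , z≍1 , z-fresh , w-fresh) →
        unit-inverse zw≈1 z≍1 |>′ λ w≍1 → case trichotomy z of λ where
          (inj₁ p) →
            proj₂ (generic (definable⇒BCB up)) (proj₂ z≍1) (proj₂ w≍1) (All.++⁻ˡ us z-fresh) (All.++⁻ˡ us w-fresh) p |>′ λ p′ →
            ev-absurd (ev-∧ (ev-unit w≍1 (sat⇒ev p)) (sat⇒ev p′)) (1# , 1≉0 , λ y _ (q , q′) →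
              ≺-≼-absurd (≺-trans q′ q) (proj₁ (back zw≈1 y)))
          (inj₂ (inj₁ p)) →
            proj₂ (generic (definable⇒BCB down)) (proj₂ z≍1) (proj₂ w≍1)
              (All.++⁻ˡ ds (All.++⁻ʳ us z-fresh)) (All.++⁻ˡ ds (All.++⁻ʳ us w-fresh)) p |>′ λ p′ →
            ev-absurd (ev-∧ (ev-unit w≍1 (sat⇒ev p)) (sat⇒ev p′)) (1# , 1≉0 , λ y _ (q , q′) →
              ≺-≼-absurd (≺-trans q q′) (proj₂ (back zw≈1 y)))
          (inj₂ (inj₂ p)) → proj₂ (generic (definable⇒BCB same)) (proj₂ z≍1) (proj₂ x≍1)
            (All.++⁻ʳ ds (All.++⁻ʳ us z-fresh)) (All.++⁻ʳ ds (All.++⁻ʳ us fresh)) p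

    -- `u` is the quotient of `x * u` by `x`; both are fresh, so neither changes the value of `g`
    -- eventually.
    unit-invariant : ∀ {u} → u ≍ 1# → Ev (λ y → g (y * u) ≍ g y)
    unit-invariant {u} u≍1 =
      fresh-scaled u≍1 zs |>′ λ (x , x≍1 , x-fresh , xu-fresh) →
      inverse x (unit-≉0 x≍1) |>′ λ (w , xw≈1) →
      unit-inverse xw≈1 x≍1 |>′ λ w≍1 →
      ev-map (λ {y} (p , q) → ≍-trans (≍-reflexive (graph-cong g G (R.sym (R.trans (R.sym (R.*-assoc (y * w) x u)) (R.*-congʳ (cancel xw≈1 y))))))
               (≍-trans q (≍-trans (≍-sym p) (back xw≈1 y))))
             (ev-∧ (ev-unit w≍1 (sat⇒ev (same-fresh x≍1 x-fresh)))
                   (ev-unit w≍1 (sat⇒ev (same-fresh (≍-trans (scale-≍ u≍1) x≍1) xu-fresh))))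

  module _ {_~_ : K → K → Set ℓ} (equiv : NearEquivalence _~_) where
    open NearEquivalence equiv

    private
      -- The residue classes of units that contain no `h` with y ~ y h for all `y` beyond `s`.
      -- Quantifying over `h` in the class of `c` provides the invariance modulo the maximal ideal
      -- that `uniformly-empty` asks for.
      φ : Fm 0 2
      φ = ` 1F ≼ᶠ # 1# ∧ᶠ (exᶠ (` 0F ≼ᶠ # 1# ∧ᶠ # 1# ≼ᶠ ` 0F ∧ᶠ # 1# ≺ᶠ ` 0F ⊕ ⊝ (` 2F) ∧ᶠ
            allᶠ (` 0F ≼ᶠ ` 2F ⇒ᶠ ` 0F ≺ᶠ # bound ⇒ᶠ exᶠ (` 0F ≈ᶠ ` 1F ⊗ ` 2F ∧ᶠ relᶠ _~_ definable 1F 0F))) ⇒ᶠ falseᶠ)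

      stabilizer : K → Fm 0 1
      stabilizer s = ` 0F ≼ᶠ # 1# ∧ᶠ # 1# ≼ᶠ ` 0F ∧ᶠ
        allᶠ (` 0F ≼ᶠ # s ⇒ᶠ ` 0F ≺ᶠ # bound ⇒ᶠ exᶠ (` 0F ≈ᶠ ` 1F ⊗ ` 2F ∧ᶠ relᶠ _~_ definable 1F 0F))

      ~-resp : ∀ {x y z} → y ≈ z → x ~ y → x ~ z
      ~-resp y≈z = Definable-cong definable (R.refl Pointwise.∷ y≈z Pointwise.∷ Pointwise.[])

    -- At the stage from `uniformly-empty`, each class of units contains a stabilizing element;
    -- `generic` spreads this to every fresh unit, and quotients of fresh units are all units.
    coarsen : (∀ {z} → z ≍ 1# → Ev (λ y → y ~ (y * z))) → Ev (λ y → ∀ z → z ≍ 1# → y ~ (y * z))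
    coarsen invariant =
      uniformly-empty (λ s c → Sat φ (s ∷ c ∷ []) []) (definable₂ φ)
        (λ s′≼s (c≼1 , none) → c≼1 , λ (h , h≼1 , 1≼h , h~c , stab) →
          none (h , h≼1 , 1≼h , h~c , λ y y≼s′ → stab y (≼-trans y≼s′ s′≼s)))
        (λ {_} {c} {c′} _ _ c~c′ (c≼1 , none) →
          (case ≼-or-≻ c′ 1# of λ where
            (inj₁ p) → p
            (inj₂ 1≺c′) → ≺-≼-absurd (≺-resp R.refl (minus-plus c c′) (≺-+ c~c′ 1≺c′)) c≼1) ,
          λ (h , h≼1 , 1≼h , h~c′ , stab) → none (h , h≼1 , 1≼h , minus-trans-≺ h~c′ (minus-sym-≺ c~c′) , stab))
        (λ c 1≼c → case em {P = c ≼ 1#} of λ where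
          (no  c⋠1) → 1# , 1≉0 , λ (c≼1 , _) → c⋠1 c≼1
          (yes c≼1) → invariant (c≼1 , 1≼c) |>′ λ (s , s≉0 , inv) →
            π * s , *-≉0 π≉0 s≉0 , λ (_ , none) → ⊥-elim (none (c , c≼1 , 1≼c , ≺-≼-trans (≉0⇒≺0 1≉0) minus-self ,
              λ y y≼ _ → y * c , R.refl , inv y (≼-≺-trans y≼ (πx≺x s≉0)))))
      |>′ λ (s , s≉0 , empty) → generic (definable⇒BCB (stabilizer s))
      |>′ λ (zs , f) → s ⊓ bound , ⊓-≉0 s≉0 bound≉0 , λ y y≺ u u≍1 →
        invariant-at s zs (λ z≍1 fresh → fresh⇒stabilizer {s} {zs} f empty z≍1 fresh) u≍1
          (≺⇒≼ (≺-≼-trans y≺ (⊓-≼ˡ s bound))) (≺-≼-trans y≺ (⊓-≼ʳ s bound))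
      where
      Stab : K → K → Set ℓ
      Stab s z = Sat (stabilizer s) (z ∷ []) []

      fresh⇒stabilizer : ∀ {s zs} → (∀ {z z′} → 1# ≼ z → 1# ≼ z′ → Fresh zs z → Fresh zs z′ → Stab s z → Stab s z′) →
        (∀ c → 1# ≼ c → ¬ Sat φ (s ∷ c ∷ []) []) → ∀ {z} → z ≍ 1# → Fresh zs z → Stab s z
      fresh⇒stabilizer f empty {z} (z≼1 , 1≼z) fresh =
        by-contradiction (λ none → empty z 1≼z (z≼1 , λ p → contradiction p none))
        |>′ λ (h , h≼1 , 1≼h , h~z , stab) → f 1≼h 1≼z (fresh-resp (minus-sym-≺ h~z) fresh) fresh (h≼1 , 1≼h , stab)

      -- Every unit is the quotient of two fresh ones.
      invariant-at : ∀ s zs → (∀ {z} → z ≍ 1# → Fresh zs z → Stab s z) →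
        ∀ {u y} → u ≍ 1# → y ≼ s → y ≺ bound → y ~ (y * u)
      invariant-at s zs fresh⇒ {u} {y} u≍1 y≼s y≺b =
        fresh-scaled u≍1 zs |>′ λ (z , z≍1 , z-fresh , zu-fresh) →
        inverse z (unit-≉0 z≍1) |>′ λ (w , zw≈1) →
        scale-≍ {y} (unit-inverse zw≈1 z≍1) |>′ λ yw≍y →
        ≼-trans (proj₁ yw≍y) y≼s |>′ λ yw≼s →
        ≼-≺-trans (proj₁ yw≍y) y≺b |>′ λ yw≺b →
        proj₂ (proj₂ (fresh⇒ z≍1 z-fresh)) (y * w) yw≼s yw≺b |>′ λ (y₁ , y₁≈ , ~y₁) →
        proj₂ (proj₂ (fresh⇒ (≍-trans (scale-≍ u≍1) z≍1) zu-fresh)) (y * w) yw≼s yw≺b |>′ λ (y₂ , y₂≈ , ~y₂) →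
        transitive y≺b yw≺b (≼-≺-trans (proj₁ (scale-≍ u≍1)) y≺b)
          (symmetric yw≺b y≺b (~-resp (R.trans y₁≈ (cancel zw≈1 y)) ~y₁))
          (~-resp (R.trans y₂≈ (R.trans (R.sym (R.*-assoc (y * w) z u)) (R.*-congʳ (cancel zw≈1 y)))) ~y₂)

  infix 4 _∼ᶠ_ _≍ᶠ_
  _∼ᶠ_ _≍ᶠ_ : ∀ {d n} → Expr n → Expr n → Fm d n
  s ∼ᶠ t = t ≺ᶠ s ⊕ ⊝ t
  s ≍ᶠ t = s ≼ᶠ t ∧ᶠ t ≼ᶠ s

  -- The growth of v(g) under scaling

  module _ {g} (G : Graph g) {t} (t≉0 : t ≉ 0#) where

    private
      -- g(ty)/g(y) and g(ty′)/g(y′) have the same class in RV, resp. the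
      -- same valuation
      _~ʳ_ _~ᵛ_ : K → K → Set ℓ
      y ~ʳ y′ = g (t * y) * g y′ ∼ g (t * y′) * g y
      y ~ᵛ y′ = g (t * y) * g y′ ≍ g (t * y′) * g y

      cross : ∀ a b c → (a * b) * c ≈ (a * c) * b
      cross = solve 3 (λ a b c → (a :* b) :* c := (a :* c) :* b) R.refl

      module Nonzero {s} (s≉0 : s ≉ 0#) (g≉0 : ∀ y → y ≺ s → g (t * y) ≉ 0# × g y ≉ 0#) where

        equivʳ : NearEquivalence _~ʳ_
        equivʳ = record
          { definable  = definable₂ (fn g G (# t ⊗ ` 0F) ⊗ fn g G (` 1F) ∼ᶠ fn g G (# t ⊗ ` 1F) ⊗ fn g G (` 0F))
          ; bound      = s
          ; bound≉0    = s≉0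
          ; reflexive  = λ {x} x≺s → ∼-refl (*-≉0 (proj₁ (g≉0 x x≺s)) (proj₂ (g≉0 x x≺s)))
          ; symmetric  = λ _ _ → ∼-sym
          ; transitive = λ {x} {y} {z} x≺s y≺s z≺s p q → *-cancelʳ-∼ (g y)
              (∼-trans (∼-resp (cross _ _ _) (cross _ _ _) (*-monoˡ-∼ (g z) (proj₂ (g≉0 z z≺s)) p))
                       (∼-resp R.refl (cross _ _ _) (*-monoˡ-∼ (g x) (proj₂ (g≉0 x x≺s)) q)))
          }

        equivᵛ : NearEquivalence _~ᵛ_
        equivᵛ = record
          { definable  = definable₂ (fn g G (# t ⊗ ` 0F) ⊗ fn g G (` 1F) ≍ᶠ fn g G (# t ⊗ ` 1F) ⊗ fn g G (` 0F))
          ; bound      = s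
          ; bound≉0    = s≉0
          ; reflexive  = λ _ → ≍-refl
          ; symmetric  = λ _ _ → ≍-sym
          ; transitive = λ {x} {y} {z} x≺s y≺s z≺s p q → *-cancelʳ-≍ (proj₂ (g≉0 y y≺s))
              (≍-trans (≍-reflexive (cross _ _ _)) (≍-trans (*-cong-≍ p (≍-refl {g z}))
                (≍-trans (≍-reflexive (cross _ _ _)) (≍-trans (*-cong-≍ q (≍-refl {g x})) (≍-reflexive (cross _ _ _))))))
          }

        -- g(yz) ∼ θ g(y) for a unit θ depending only on z, and also at ty.
        unit-invariantʳ : ∀ {z} → z ≍ 1# → Ev (λ y → y ~ʳ (y * z))
        unit-invariantʳ {z} z≍1 =
          residue-constant (graph (fn g G (` 0F ⊗ # z))) (graph (fn g G (` 0F)))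
            (ev-map (λ ((_ , g≉0) , (_ , g≼)) → g≉0 , g≼) (ev-∧ (s , s≉0 , g≉0) (unit-invariant G z≍1)))
          |>′ λ (θ , 1≼θ , ev) → ev-∧ ev (unit-invariant G z≍1)
          |>′ λ ev′ → ev-∧ (ev-∧ ev′ (ev-scale t≉0 ev′)) (s , s≉0 , g≉0)
          |>′ ev-map λ {y} (((p , gz≍g) , (q , _)) , (gt≉0 , gy≉0)) →
            let θ≍1 : θ ≍ 1#
                θ≍1 = (case ≼-or-≻ θ 1# of λ where
                  (inj₁ θ≼1) → θ≼1
                  (inj₂ 1≺θ) → ≺-≼-absurd (≺-resp R.refl (minus-plus (g (y * z)) (θ * g y))
                    (≺-+ p (≺-resp (R.*-identityˡ _) R.refl (*-monoˡ-≺ (g y) gy≉0 1≺θ)))) (proj₁ gz≍g)) , 1≼θ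
                scale : ∀ x → θ * x ≍ x
                scale x = ≍-trans (*-cong-≍ θ≍1 (≍-refl {x})) (≍-reflexive (R.*-identityˡ x))
                p′ : g (y * z) ∼ θ * g y
                p′ = ≼-≺-trans (proj₁ (scale (g y))) p
                q′ : g (t * (y * z)) ∼ θ * g (t * y)
                q′ = ∼-resp (graph-cong g G (R.*-assoc t y z)) R.refl (≼-≺-trans (proj₁ (scale (g (t * y)))) q)
            in ∼-trans (*-monoʳ-∼ (g (t * y)) gt≉0 p′)
                 (∼-sym (∼-resp R.refl (solve 3 (λ θ a b → (θ :* a) :* b := a :* (θ :* b)) R.refl θ (g (t * y)) (g y))
                   (*-monoˡ-∼ (g y) gy≉0 q′)))

        -- If v(g(ty)/g(y)) determined v(y), the classes of g(ty)/g(y) in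
        -- RV would form a definable set meeting infinitely many of the sets
        -- v(x) = γ, each in a single class.
        ¬injective : ¬ Ev₂ (λ y y′ → y ~ᵛ y′ → y ≍ y′)
        ¬injective (s₂ , s₂≉0 , injective) =
          coarsen equivʳ unit-invariantʳ |>′ λ (s₁ , s₁≉0 , coarse) →
          ⊓-≉0 (⊓-≉0 s≉0 s₁≉0) s₂≉0 |>′ λ b≉0 →
          impossible coarse {s ⊓ s₁ ⊓ s₂} b≉0 (≼-trans (⊓-≼ˡ (s ⊓ s₁) s₂) (⊓-≼ˡ s s₁))
            (≼-trans (⊓-≼ˡ (s ⊓ s₁) s₂) (⊓-≼ʳ s s₁)) (⊓-≼ʳ (s ⊓ s₁) s₂)
          where
          impossible : ∀ {s₁} → (∀ y → y ≺ s₁ → ∀ z → z ≍ 1# → y ~ʳ (y * z)) →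
            ∀ {b} → b ≉ 0# → b ≼ s → b ≼ s₁ → b ≼ s₂ → ⊥₀
          impossible coarse {b} b≉0 b≼s b≼s₁ b≼s₂ =
            critical (definable⇒BCB Σ′) |>′ λ (L , f) →
            -- Far enough out, the value of g(ty)/g(y) is none of the critical values of `Σ′`.
            avoid L |>′ λ (a , a≉0 , a≼b , avoids) →
            ev-witness (ev-below a≉0) |>′ λ (y , _ , y≺a) →
            ≺-≼-trans y≺a a≼b |>′ λ y≺b →
            g≉0 y (≺-≼-trans y≺b b≼s) |>′ λ (gt≉0 , gy≉0) →
            divide (g (t * y)) gy≉0 |>′ λ (x , xg≈) →
            -- A unit with residue different from 1: `x` and `x * z` have equal values, so
            -- `critical` puts both in `Σ′`, but their classes in RV differ.
            fresh-unit (1# ∷ []) |>′ λ { (z , z≍1 , z-1≼1 ∷ []) →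
            f {x} {x * z} (All.map (λ {l} l≭ → case ≼-or-≻ l x of λ where
                  (inj₂ x≺l) → inj₁ (x≺l , ≼-≺-trans (proj₁ (scale-≍ z≍1)) x≺l)
                  (inj₁ l≼x) → case ≼-or-≻ x l of λ where
                    (inj₂ l≺x) → inj₂ (l≺x , ≺-≼-trans l≺x (proj₂ (scale-≍ z≍1)))
                    (inj₁ x≼l) → contradiction
                      (≍-trans (*-cong-≍ (l≼x , x≼l) ≍-refl) (≍-reflexive xg≈)) (l≭ y y≺a))
                avoids)
              (y , y≺b , ∼-reflexive gt≉0 xg≈) |>′ λ (y′ , y′≺b , xz∼) →
            g≉0 y′ (≺-≼-trans y′≺b b≼s) |>′ λ (gt′≉0 , gy′≉0) →
            *-≉0 gy≉0 gy′≉0 |>′ λ gg≉0 →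
            let swap : g (t * y) * g y′ ≈ x * (g y * g y′)
                swap = R.trans (R.*-congʳ (R.sym xg≈)) (R.*-assoc x (g y) (g y′))
                p : g (t * y′) * g y ∼ (x * z) * (g y * g y′)
                p = ∼-resp R.refl (solve 3 (λ a b c → (a :* b) :* c := a :* (c :* b)) R.refl (x * z) (g y′) (g y))
                      (*-monoˡ-∼ (g y) gy≉0 (∼-sym xz∼))
                y≍y′ : y ≍ y′
                y≍y′ = injective y y′ (≺-≼-trans y≺b b≼s₂) (≺-≼-trans y′≺b b≼s₂)
                  (≍-trans (≍-reflexive swap) (≍-trans (*-cong-≍ (≍-sym (scale-≍ {x} z≍1)) ≍-refl) (≍-sym (∼⇒≍ p))))
            in divide y′ (≺⇒≉0 y≺b) |>′ λ (w , wy≈y′) →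
            *-cancelʳ-≍ {w} {1#} (≺⇒≉0 y≺b) (≍-trans (≍-reflexive wy≈y′) (≍-trans (≍-sym y≍y′) (≍-reflexive (R.sym (R.*-identityˡ y))))) |>′ λ w≍1 →
            R.trans (R.*-comm y w) wy≈y′ |>′ λ yw≈y′ →
            -- `y′` is `y` times a unit, so the quotients at `y` and `y′` share their class in RV;
            -- yet these are the classes of `x` and `x * z`.
            coarse y (≺-≼-trans y≺b b≼s₁) w w≍1 |>′ λ r →
            let r′ : g (t * y) * g y′ ∼ g (t * y′) * g y
                r′ = ∼-resp (R.*-congˡ (graph-cong g G yw≈y′)) (R.*-congʳ (graph-cong g G (R.*-congˡ yw≈y′))) r
                x∼xz : x ∼ x * z
                x∼xz = *-cancelʳ-∼ (g y * g y′) (∼-trans (∼-resp swap R.refl r′) p)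
                1∼z : 1# ∼ z
                1∼z = *-cancelʳ-∼ x (∼-resp (R.sym (R.*-identityˡ x)) (R.*-comm x z) x∼xz)
            in ≺-≼-absurd (≼-≺-trans (proj₂ z≍1) (minus-sym-≺ 1∼z)) z-1≼1 }
            where
            Σ′ : Fm 0 1
            Σ′ = exᶠ (` 0F ≺ᶠ # b ∧ᶠ (` 1F ⊗ fn g G (` 0F) ∼ᶠ fn g G (# t ⊗ ` 0F)))

            -- By injectivity each `l` has the value of g(ty)/g(y) for at most one value of `y`;
            -- going beyond such a `y` excludes it.
            avoid : ∀ L → ∃ λ a → a ≉ 0# × a ≼ b × All (λ l → ∀ y → y ≺ a → ¬ (l * g y ≍ g (t * y))) L
            avoid []      = b , b≉0 , ≼-refl , []
            avoid (l ∷ L) = avoid L |>′ λ (a , a≉0 , a≼b , ps) →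
              case em {P = ∃ λ y → y ≺ a × l * g y ≍ g (t * y)} of λ where
                (no  none) → a , a≉0 , a≼b , (λ y y≺a p → none (y , y≺a , p)) ∷ ps
                (yes (y , y≺a , p)) → y , ≺⇒≉0 y≺a , ≼-trans (≺⇒≼ y≺a) a≼b ,
                  (λ y′ y′≺y p′ → ≺-≼-absurd y′≺y (proj₁ (injective y y′
                    (≺-≼-trans y≺a (≼-trans a≼b b≼s₂)) (≺-trans y′≺y (≺-≼-trans y≺a (≼-trans a≼b b≼s₂)))
                    (≍-trans (*-cong-≍ (≍-sym p) ≍-refl) (≍-trans (≍-reflexive (cross l (g y) (g y′))) (*-cong-≍ p′ ≍-refl)))))) ∷
                  All.map (λ q y′ y′≺y → q y′ (≺-trans y′≺y y≺a)) ps

    -- `¬injective` leaves only the alternative that the value of g(ty)/g(y) is eventually constant;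
    -- `e` is this quotient at one point.
    slope : Ev (λ y → g y ≉ 0#) → ∃ λ e → e ≉ 0# × Ev (λ y → g (t * y) ≍ e * g y)
    slope g≉0 = ev-∧ (ev-scale t≉0 g≉0) g≉0 |>′ λ (s , s≉0 , gg≉0) →
      let open Nonzero s≉0 gg≉0 in
      case constant-or-injective equivᵛ of λ where
        (inj₂ inj) → contradiction inj ¬injective
        (inj₁ (s₁ , s₁≉0 , constant)) → ev-witness (ev-∧ (ev-below s≉0) (ev-below s₁≉0)) |>′ λ (y₀ , _ , y₀≺s , y₀≺s₁) →
          gg≉0 y₀ y₀≺s |>′ λ (gt≉0 , gy≉0) → divide (g (t * y₀)) gy≉0 |>′ λ (e , eg≈) →
          e , (λ e≈0 → gt≉0 (R.trans (R.sym eg≈) (R.trans (R.*-congʳ e≈0) (R.zeroˡ _)))) , s₁ , s₁≉0 , λ y y≺s₁ →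
            *-cancelʳ-≍ gy≉0 (≍-trans (constant y y₀ y≺s₁ y₀≺s₁)
              (≍-trans (*-cong-≍ (≍-reflexive (R.sym eg≈)) ≍-refl) (≍-reflexive (cross e (g y₀) (g y)))))

  private
    π⁻¹ : K
    π⁻¹ = proj₁ (inverse π π≉0)

    ππ⁻¹≈1 : π * π⁻¹ ≈ 1#
    ππ⁻¹≈1 = proj₂ (inverse π π≉0)

    1≺π⁻¹ : 1# ≺ π⁻¹
    1≺π⁻¹ = ≺-resp ππ⁻¹≈1 (R.*-identityˡ π⁻¹) (*-monoˡ-≺ π⁻¹ (*-≉0ʳ 1≉0 ππ⁻¹≈1) π≺1)

  larger : ∀ {x} → x ≉ 0# → ∃ λ y → x ≺ y × y ≉ 0#
  larger {x} x≉0 = π⁻¹ * x , ≺-resp (R.*-identityˡ x) R.refl (*-monoˡ-≺ x x≉0 1≺π⁻¹) ,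
    *-≉0 (*-≉0ʳ 1≉0 ππ⁻¹≈1) x≉0

  -- Limits of valuations and approximation of bounded functions

  module _ {g} (G : Graph g) {l} (l≉0 : l ≉ 0#)
    (above : ∀ {a} → a ≺ l → Ev (λ y → a ≺ g y)) (under : ∀ {b} → b ≉ 0# → l ≺ b → Ev (λ y → g y ≺ b)) where

    private
      -- With h² = f, eventually `l * h` ≺ P and Q ≺ l h⁻¹, whereas f l h⁻¹ = l h.
      no-drift : ∀ {f} {P Q : K → K} → f ≺ 1# → (∀ {a} → a ≺ l → Ev (λ y → a ≺ P y)) →
        (∀ {b} → b ≉ 0# → l ≺ b → Ev (λ y → Q y ≺ b)) → ¬ Ev (λ y → P y ≍ f * Q y)
      no-drift {f} {P} {Q} f≺1 P-above Q-under ev =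
        square-root f |>′ λ (h , hh≈f) →
        ≺⇒≉0 f≺1 |>′ λ f≉0 →
        let h≉0 : h ≉ 0#
            h≉0 = *-≉0ʳ f≉0 hh≈f
            h≺1 : h ≺ 1#
            h≺1 1≼h = f≺1 (≼-resp (R.*-identityˡ 1#) hh≈f (*-mono-≼ 1≼h 1≼h))
        in inverse h h≉0 |>′ λ (w , hw≈1) →
        let w≉0 : w ≉ 0#
            w≉0 = *-≉0ʳ 1≉0 hw≈1
            1≺w : 1# ≺ w
            1≺w = ≺-resp hw≈1 (R.*-identityˡ w) (*-monoˡ-≺ w w≉0 h≺1)
            flw≈lh : f * (l * w) ≈ l * h
            flw≈lh = R.trans (R.*-congʳ (R.sym hh≈f)) (R.trans
              (solve 3 (λ h l w → (h :* h) :* (l :* w) := (l :* h) :* (h :* w)) R.refl h l w)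
              (R.trans (R.*-congˡ hw≈1) (R.*-identityʳ _)))
        in ev-witness (ev-∧ ev (ev-∧
             (P-above (≺-resp R.refl (R.*-identityʳ l) (*-monoʳ-≺ l l≉0 h≺1)))
             (Q-under (*-≉0 l≉0 w≉0) (≺-resp (R.*-identityʳ l) R.refl (*-monoʳ-≺ l l≉0 1≺w)))))
           |>′ λ (y , _ , p , q , r) →
           ≺-≼-absurd (≺-≼-trans q (proj₁ p)) (≺⇒≼ (≺-resp R.refl flw≈lh (*-monoʳ-≺ f f≉0 r)))

      g≉0 : Ev (λ y → g y ≉ 0#)
      g≉0 = larger l≉0 |>′ λ (b , l≺b , b≉0) → ev-map ≺⇒≉0 (under b≉0 l≺b)

      invariant : Ev (λ y → g (π * y) ≍ g y)
      invariant = slope G π≉0 g≉0 |>′ λ (e , e≉0 , ev) →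
        inverse e e≉0 |>′ λ (f , ef≈1) →
        (case ≼-or-≻ 1# e of λ where
          (inj₂ e≺1) → contradiction ev (no-drift e≺1 (λ a≺l → ev-scale π≉0 (above a≺l)) under)
          (inj₁ 1≼e) → case ≼-or-≻ e 1# of λ where
            (inj₁ e≼1) → e≼1 , 1≼e
            (inj₂ 1≺e) → contradiction
              (ev-map (λ {y} p → ≍-sym (≍-trans (*-cong-≍ (≍-refl {f}) p) (≍-reflexive (R.trans (R.sym (R.*-assoc f e (g y)))
                (R.trans (R.*-congʳ (R.trans (R.*-comm f e) ef≈1)) (R.*-identityˡ (g y))))))) ev)
              (no-drift (inverse-≺ ef≈1 1≺e) above (λ b≉0 l≺b → ev-scale π≉0 (under b≉0 l≺b))))
        |>′ λ e≍1 → ev-map (λ {y} p → ≍-trans p (≍-trans (*-cong-≍ e≍1 ≍-refl) (≍-reflexive (R.*-identityˡ (g y))))) ev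

      equiv : NearEquivalence (λ y y′ → g y ≍ g y′)
      equiv = record
        { definable  = definable₂ (fn g G (` 0F) ≍ᶠ fn g G (` 1F))
        ; bound      = 1#
        ; bound≉0    = 1≉0
        ; reflexive  = λ _ → ≍-refl
        ; symmetric  = λ _ _ → ≍-sym
        ; transitive = λ _ _ _ → ≍-trans
        }

    -- `invariant` makes `y` and `π * y` equivalent for equality of v(g), which excludes the
    -- injective case; a constant value can only be the limit v(l).
    limit-attained : Ev (λ y → g y ≍ l)
    limit-attained = case constant-or-injective equiv of λ where
      (inj₂ (s , s≉0 , injective)) → ev-witness (ev-∧ invariant (ev-below s≉0)) |>′ λ (y , y≉0 , p , y≺s) →
        ≺-≼-absurd (πx≺x y≉0) (proj₂ (injective (π * y) y (≺-trans (πx≺x y≉0) y≺s) y≺s p))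
      (inj₁ (s , s≉0 , constant)) → ev-witness (ev-∧ (ev-below s≉0) g≉0) |>′ λ (y₀ , _ , y₀≺s , c≉0) →
        let ev : Ev (λ y → g y ≍ g y₀)
            ev = s , s≉0 , λ y y≺s → constant y y₀ y≺s y₀≺s
        in case ≼-or-≻ l (g y₀) of λ where
          (inj₂ c≺l) → ev-absurd ev (ev-map (λ p q → ≺-≼-absurd p (proj₁ q)) (above c≺l))
          (inj₁ l≼c) → case ≼-or-≻ (g y₀) l of λ where
            (inj₂ l≺c) → ev-absurd ev (ev-map (λ p q → ≺-≼-absurd p (proj₂ q)) (under c≉0 l≺c))
            (inj₁ c≼l) → ev-map (λ p → ≍-trans p (c≼l , l≼c)) ev

  -- If some precision is not attained, those attained have a supremum v(l),
  -- to which the valuations of u − b, or of u(πy) − u(y), tend.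
  module _ {u} (U : Graph u) {β} (β≉0 : β ≉ 0#) (bounded : Ev (λ y → β ≼ u y)) where

    private
      approximable : Fm 0 1
      approximable = exᶠ (evᶠ (` 3F ≺ᶠ fn u U (` 0F) ⊕ ⊝ (` 2F)))

      Λ : K → Set ℓ
      Λ r = Sat approximable (r ∷ []) []

      Λ⇒ev : ∀ {r} → Λ r → ∃ λ b → Ev (λ y → r ≺ u y + - b)
      Λ⇒ev (b , p) = b , sat⇒ev p

      ev⇒Λ : ∀ {r b} → Ev (λ y → r ≺ u y + - b) → Λ r
      ev⇒Λ {b = b} ev = b , ev⇒sat ev

      down : ∀ {r r′} → r ≼ r′ → Λ r′ → Λ r
      down r≼r′ p = Λ⇒ev p |>′ λ (b , ev) → ev⇒Λ (ev-map (≼-≺-trans r≼r′) ev)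

      module _ {l} (l≉0 : l ≉ 0#) (≺l : ∀ r → r ≺ l → Λ r) (≻l : ∀ r → l ≺ r → ¬ Λ r) where

        -- If `l ≺ u y + - b` eventually, the value of u - b would tend to v(l), since no precision
        -- beyond `l` is attainable; by `limit-attained` it would be equal to v(l).
        l∉Λ : ¬ Λ l
        l∉Λ l∈Λ = Λ⇒ev l∈Λ |>′ λ (b , ev) →
          ev-absurd ev (ev-map (λ p q → ≺-≼-absurd q (proj₁ p))
            (limit-attained (graph (fn u U (` 0F) ⊕ ⊝ (# b))) l≉0 (λ a≺l → ev-map (≺-trans a≺l) ev) (under b)))
          where
          under : ∀ b {r} → r ≉ 0# → l ≺ r → Ev (λ y → u y + - b ≺ r)
          under b r≉0 l≺r = between l≺r r≉0 |>′ λ (z , l≺z , z≺r) →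
            case eventually (definable⇒BCB (# z ≺ᶠ fn u U (` 0F) ⊕ ⊝ (# b))) of λ where
              (inj₁ ev) → contradiction (ev⇒Λ ev) (≻l z l≺z)
              (inj₂ ev) → ev-map (λ {y} z⊀ → case ≼-or-≻ (u y + - b) z of λ where
                (inj₁ p) → ≼-≺-trans p z≺r
                (inj₂ p) → contradiction p z⊀) ev

        -- Otherwise the increments are eventually `≺ l`. Every precision `a ≺ l` is attained, so
        -- their values would tend to v(l) without reaching it.
        increments : Ev (λ y → l ≼ u (π * y) + - u y)
        increments = case eventually (definable⇒BCB (# l ≼ᶠ fn u U (# π ⊗ ` 0F) ⊕ ⊝ (fn u U (` 0F)))) of λ where
          (inj₁ ev) → ev
          (inj₂ ev) → ev-absurd (ev-map proj₂
            (limit-attained (graph (fn u U (# π ⊗ ` 0F) ⊕ ⊝ (fn u U (` 0F)))) l≉0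
              (λ a≺l → Λ⇒ev (≺l _ a≺l) |>′ λ (b , ev) →
                ev-map (λ (p , q) → minus-trans-≺ p (minus-sym-≺ q)) (ev-∧ (ev-scale π≉0 ev) ev))
              (λ _ l≺b → ev-map (λ {y} l⋠ → case ≼-or-≻ l (u (π * y) + - u y) of λ where
                (inj₁ p) → contradiction p l⋠
                (inj₂ p) → ≺-trans p l≺b) ev))) ev

        equiv : NearEquivalence (λ y y′ → l ≼ u y + - u y′)
        equiv = record
          { definable  = definable₂ (# l ≼ᶠ fn u U (` 0F) ⊕ ⊝ (fn u U (` 1F)))
          ; bound      = 1#
          ; bound≉0    = 1≉0
          ; reflexive  = λ _ → minus-self
          ; symmetric  = λ _ _ → minus-sym-≼
          ; transitive = λ _ _ _ → minus-trans-≼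
          }

        absurd : ⊥₀
        absurd = case constant-or-injective equiv of λ where
          (inj₂ (s , s≉0 , injective)) → ev-witness (ev-∧ increments (ev-below s≉0)) |>′ λ (y , y≉0 , p , y≺s) →
            ≺-≼-absurd (πx≺x y≉0) (proj₂ (injective (π * y) y (≺-trans (πx≺x y≉0) y≺s) y≺s p))
          (inj₁ (s , s≉0 , constant)) → ev-witness (ev-below s≉0) |>′ λ (y₀ , _ , y₀≺s) →
            -- The residue `c` of (u(y) - u(y₀))/l corrects the centre `u y₀` and would make the
            -- precision `l` attainable.
            residue-constant (graph (fn u U (` 0F) ⊕ ⊝ (# (u y₀)))) (graph (# l))
              (s , s≉0 , λ y y≺s → l≉0 , constant y y₀ y≺s y₀≺s) |>′ λ (c , _ , ev) →
            l∉Λ (ev⇒Λ {b = u y₀ + c * l} (ev-map (λ {y} → ≺-resp R.refl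
              (solve 3 (λ u b c → (u :+ :- b) :+ :- c := u :+ :- (b :+ c)) R.refl (u y) (u y₀) (c * l))) ev))

    approximation : ∀ {r} → r ≉ 0# → ∃ λ b → Ev (λ y → r ≺ u y + - b)
    approximation {r} r≉0 = by-contradiction λ none →
      -- Boundedness makes `π * β` a precision attained with centre `0#`.
      threshold (definable⇒BCB approximable) down {π * β} {r}
        (ev⇒Λ {b = 0#} (ev-map (λ {y} β≼ → ≺-resp R.refl (R.sym (minus-0 (u y))) (≺-≼-trans (πx≺x β≉0) β≼)) bounded))
        r≉0 (λ p → none (Λ⇒ev p))
      |>′ λ (l , l≉0 , ≺l , ≻l) → absurd l≉0 ≺l ≻l

  -- Roots of unity and the characteristic exponent

  private
    geometric : ℕ → K → K
    geometric n y = evalPoly V (Vec.replicate n 1#) 1# y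

    geometric-telescope : ∀ n y → (y + - 1#) * geometric n y ≈ y ^ suc n + - 1#
    geometric-telescope zero    y = solve 1 (λ y → (y :+ :- :1) :* :1 := y :* :1 :+ :- :1) R.refl y
    geometric-telescope (suc n) y = R.trans
      (solve 2 (λ y s → (y :+ :- :1) :* (:1 :+ y :* s) := (y :+ :- :1) :+ y :* ((y :+ :- :1) :* s)) R.refl y (geometric n y))
      (R.trans (R.+-congˡ (R.*-congˡ (geometric-telescope n y)))
        (R.trans (R.+-congˡ (R.trans (minus-*ˡ y (y ^ suc n) 1#) (R.+-congˡ (R.-‿cong (R.*-identityʳ y)))))
          (solve 3 (λ y w o → (y :+ :- o) :+ (w :+ :- y) := w :+ :- o) R.refl y (y * y ^ suc n) 1#)))

    geometric-1 : ∀ n {y} → y ≈ 1# → geometric n y ≈ fromℕ V (suc n)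
    geometric-1 zero    y≈1 = R.sym (R.+-identityʳ 1#)
    geometric-1 (suc n) y≈1 = R.+-congˡ (R.trans (R.*-congʳ y≈1) (R.trans (R.*-identityˡ _) (geometric-1 n y≈1)))

  ^-1 : ∀ n → 1# ^ n ≈ 1#
  ^-1 zero    = R.refl
  ^-1 (suc n) = R.trans (R.*-identityˡ _) (^-1 n)

  ^-≡1-* : ∀ {ζ} m n → ζ ^ n ≈ 1# → ζ ^ (m ℕ.* n) ≈ 1#
  ^-≡1-* {ζ} m n p = R.trans (^-congʳ ζ (ℕ.*-comm m n)) (R.trans (R.sym (^-assocʳ ζ n m)) (R.trans (^-congˡ m p) (^-1 m)))

  coprime-powers : ∀ {ζ m n} → Coprime m n → ζ ^ m ≈ 1# → ζ ^ n ≈ 1# → ζ ≈ 1#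
  coprime-powers {ζ} {m} {n} c p q = case coprime-Bézout c of λ where
      (Bézout.+- x y eq) → step y n x m eq q p
      (Bézout.-+ x y eq) → step x m y n eq p q
    where
    step : ∀ i j k l → 1 ℕ.+ i ℕ.* j ≡ k ℕ.* l → ζ ^ j ≈ 1# → ζ ^ l ≈ 1# → ζ ≈ 1#
    step i j k l eq ζʲ≈1 ζˡ≈1 = R.trans (R.sym (R.trans (R.*-congˡ (^-≡1-* i j ζʲ≈1)) (R.*-identityʳ ζ)))
      (R.trans (^-congʳ ζ eq) (^-≡1-* k l ζˡ≈1))

  -- A root `ζ` of 1 + X + ... + X^(q-1) satisfies ζ^q = 1, hence ζᵇ = 1 and ζ = 1; evaluating the
  -- polynomial at 1 gives q = 0 in K.
  prime-divides-characteristic : ∀ {b} → (∀ ζ → ζ ^ b ≈ 1# → ζ ≈ 1#) → ∀ {q} → Prime q → q ∣ b → fromℕ V q ≈ 0#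
  prime-divides-characteristic roots {zero}        q-prime _ = contradiction q-prime ¬prime[0]
  prime-divides-characteristic roots {suc zero}    q-prime _ = contradiction q-prime ¬prime[1]
  prime-divides-characteristic {b} roots {suc (suc n)} q-prime (divides m b≡mq) =
    ac (Vec.replicate (suc n) 1#) 1# 1≉0 |>′ λ (ζ , p) →
    R.trans (R.sym (geometric-1 (suc n) (roots ζ (R.trans (^-congʳ ζ b≡mq) (^-≡1-* m (suc (suc n))
      (x-y≈0 (R.trans (R.sym (geometric-telescope (suc n) ζ)) (R.trans (R.*-congˡ p) (R.zeroʳ _))))))))) p
    where
    x-y≈0 : ∀ {x y} → x + - y ≈ 0# → x ≈ y
    x-y≈0 {x} {y} eq = R.trans (R.sym (minus-plus x y)) (R.trans (R.+-congʳ eq) (R.+-identityˡ y))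

  -- All prime factors of `b` equal `p`. In characteristic zero there are none, and `b` is the empty
  -- product.
  power-of-characteristic : ∀ {p} → CharacteristicExponent V p → ∀ b → .{{ℕ.NonZero b}} →
    (∀ ζ → ζ ^ b ≈ 1# → ζ ≈ 1#) → ∃ λ m → b ≡ p ℕ.^ m
  power-of-characteristic {p} char b roots = length factors , ≡.trans isFactorisation
    (powers factors λ q∈ → all-p (All.lookup factorsPrime q∈) (≡.subst (_ ∣_) (≡.sym isFactorisation) (∈⇒∣product q∈)))
    where
    open PrimeFactorisation (factorise b)

    all-p : ∀ {q} → Prime q → q ∣ b → q ≡ p
    all-p {q} q-prime q∣b = prime-divides-characteristic roots q-prime q∣b |>′ λ q≈0 → case char of λ where
      (inj₁ (char₀ , _)) → contradiction (≡.subst Prime (0∣⇒≡0 (Equivalence.to (char₀ q) q≈0)) q-prime) ¬prime[0]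
      (inj₂ (charₚ , _)) → case prime⇒irreducible q-prime (Equivalence.to (charₚ q) q≈0) of λ where
        (inj₂ p≡q) → ≡.sym p≡q
        (inj₁ p≡1) → contradiction (R.trans (R.sym (R.+-identityʳ 1#))
          (Equivalence.from (charₚ 1) (divides 1 (≡.trans (≡.sym p≡1) (≡.sym (ℕ.*-identityˡ p)))))) 1≉0

    powers : ∀ qs → (∀ {q} → q ∈ qs → q ≡ p) → product qs ≡ p ℕ.^ length qs
    powers []       all-p = ≡.refl
    powers (q ∷ qs) all-p = ≡.cong₂ ℕ._*_ (all-p (here ≡.refl)) (powers qs (λ q∈ → all-p (there q∈)))

-- A numerator `a` is split as a⁺ - a⁻, so that formulas and cancellations involve natural exponents
-- only.
positivePart negativePart : ℤ → ℕ
positivePart (+ n)    = n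
positivePart -[1+ n ] = 0
negativePart (+ n)    = 0
negativePart -[1+ n ] = suc n

-- Leading terms of a definable family

module Families {ℓ} {E : Language ℓ} (em : ∀ {a} → ExcludedMiddle a)
  (M : Structure ℓ (Ldiv+ E)) (V : ValuedField M) (ac : AlgebraicallyClosed V)
  (cminimal : CMinimal M) {d} {W : Pred (Vec (Structure.Carrier M) d) ℓ}
  (F : KFamily V W) where

  open CMinimalFields em M V ac cminimal public
  open KFamily F public

  value : Vec K d → K → K
  value w x = proj₁ (f w x)

  private
    Value : Pred (Vec K (2 ℕ.+ d)) ℓ
    Value xs = X (Vec.tail (Vec.tail xs)) (head xs) × head (Vec.tail xs) ≈ value (Vec.tail (Vec.tail xs)) (head xs)

  abstract
    value-definable : Definable M Value
    value-definable = def-resp (λ { (x ∷ y ∷ w) → mk⇔ id id }) definable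

    power-graph : ∀ k → Graph (_^ k)
    power-graph zero    = graph (# 1#)
    power-graph (suc k) = graph (` 0F ⊗ fn (_^ k) (power-graph k) (` 0F))

    value-cong : ∀ {w x x′} → x ≈ x′ → X w x → X w x′ × value w x ≈ value w x′
    value-cong {w} {x} {x′} x≈x′ x∈X = Definable-cong value-definable
      {x ∷ value w x ∷ w} {x′ ∷ value w x ∷ w}
      (x≈x′ Pointwise.∷ R.refl Pointwise.∷ Pointwise.refl R.refl) (x∈X , R.refl)

  powᵉ : ∀ {n} → Expr n → ℕ → Expr n
  powᵉ t k = fn (_^ k) (power-graph k) t

  ^-≉0 : ∀ k {x} → x ≉ 0# → x ^ k ≉ 0#
  ^-≉0 zero    x≉0 = 1≉0
  ^-≉0 (suc k) x≉0 = *-≉0 x≉0 (^-≉0 k x≉0)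

  -- This is rv(f(x)) = rv(c) rv(x)^((p - q)/b) after the substitution x = tᵇ and with denominators
  -- cleared, a condition definable in `w` and `c`.
  Leading : Vec K d → (b p q : ℕ) → K → Set ℓ
  Leading w b p q c = Ev λ t → X w (t ^ b) × value w (t ^ b) * t ^ q ∼ c * t ^ p

  leadingᶠ : ∀ {n} (b p q : ℕ) → Fm d (suc n)
  leadingᶠ b p q = evᶠ (exᶠ (exᶠ (` 1F ≈ᶠ powᵉ (` 2F) b ∧ᶠ atom Value value-definable (1F ∷ 0F ∷ []) ∧ᶠ
    (` 0F ⊗ powᵉ (` 2F) q ∼ᶠ ` 4F ⊗ powᵉ (` 2F) p))))

  sat⇒leading : ∀ b p q {n c} {ρ : Vec K n} {w} → Sat (leadingᶠ b p q) (c ∷ ρ) w → Leading w b p q c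
  sat⇒leading b p q sat = ev-map (λ (x , y , x≈ , (x∈X , y≈) , p) →
    let x′∈X , v≈ = value-cong x≈ x∈X
    in x′∈X , ∼-resp (R.*-congʳ (R.trans y≈ v≈)) R.refl p) (sat⇒ev sat)

  leading⇒sat : ∀ b p q {n c} {ρ : Vec K n} {w} → Leading w b p q c → Sat (leadingᶠ b p q) (c ∷ ρ) w
  leading⇒sat b p q lead = ev⇒sat (ev-map (λ (x∈X , p) → _ , _ , R.refl , (x∈X , R.refl) , p) lead)

  leading-∼ : ∀ b p q {w c c′} → c ∼ c′ → Leading w b p q c → Leading w b p q c′
  leading-∼ b p q c∼c′ lead = ev-map (λ ((x∈X , q) , t≉0) → x∈X , ∼-trans q (*-monoˡ-∼ _ (^-≉0 p t≉0) c∼c′))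
    (ev-∧ lead (ev-map ≺⇒≉0 (ev-below 1≉0)))

  leading-unique : ∀ b p q {w c c′} → Leading w b p q c → Leading w b p q c′ → c ∼ c′
  leading-unique b p q lead lead′ = ev-witness (ev-∧ lead lead′) |>′ λ (t , t≉0 , (_ , r) , (_ , r′)) →
    *-cancelʳ-∼ (t ^ p) (∼-trans (∼-sym r) r′)

  leading-≉0 : ∀ b p q {w c} → Leading w b p q c → c ≉ 0#
  leading-≉0 b p q lead = ∼⇒≉0ʳ (leading-unique b p q lead lead)

  -- The function u(t) = f(tᵇ) / t^(p − q): the substitution x = tᵇ removes
  -- the root from x^((p − q)/b).
  module Quotients (w : Vec K d) (b p q : ℕ) where

    private
      Domain : K → Set ℓ
      Domain t = t ≉ 0# × X w (t ^ b)

      abstract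
        quotient : ∀ t → t ≉ 0# → ∃ λ z → z * t ^ p ≈ value w (t ^ b) * t ^ q
        quotient t t≉0 = divide (value w (t ^ b) * t ^ q) (^-≉0 p t≉0)

    u : K → K
    u t with em {P = Domain t}
    ... | yes (t≉0 , _) = proj₁ (quotient t t≉0)
    -- Any definable default will do: only the behaviour near infinity matters.
    ... | no  _         = 0#

    private
      u-inside : ∀ {t} → Domain t → u t * t ^ p ≈ value w (t ^ b) * t ^ q
      u-inside {t} t∈ with em {P = Domain t}
      ... | yes (t≉0 , _) = proj₂ (quotient t t≉0)
      ... | no  t∉        = contradiction t∈ t∉

      u-outside : ∀ {t} → ¬ Domain t → u t ≈ 0#
      u-outside {t} t∉ with em {P = Domain t}
      ... | yes t∈ = contradiction t∈ t∉
      ... | no  _  = R.refl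

      value₂ : Definable₂ (λ x y → X w x × y ≈ value w x)
      value₂ = def-resp (λ { (x ∷ y ∷ []) → mk⇔ id id }) (def-fix 2 value-definable w)

      φ : Fm 0 2
      φ = (` 0F ≺ᶠ # 0# ∧ᶠ exᶠ (exᶠ (` 1F ≈ᶠ powᵉ (` 2F) b ∧ᶠ relᶠ (λ x y → X w x × y ≈ value w x) value₂ 1F 0F ∧ᶠ
             ` 3F ⊗ powᵉ (` 2F) p ≈ᶠ ` 0F ⊗ powᵉ (` 2F) q)))
          ∨ᶠ ((` 0F ≺ᶠ # 0# ∧ᶠ exᶠ (exᶠ (` 1F ≈ᶠ powᵉ (` 2F) b ∧ᶠ relᶠ (λ x y → X w x × y ≈ value w x) value₂ 1F 0F)) ⇒ᶠ falseᶠ)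
              ∧ᶠ ` 1F ≈ᶠ # 0#)

      to : ∀ t z → Sat φ (t ∷ z ∷ []) [] → z ≈ u t
      to t z (inj₁ (t≺0 , x , y , x≈ , (x∈X , y≈) , eq)) = value-cong x≈ x∈X |>′ λ (x′∈X , v≈) →
        *-cancelˡ (^-≉0 p (≺⇒≉0 t≺0)) (R.trans (R.*-comm _ z) (R.trans eq (R.trans (R.*-congʳ (R.trans y≈ v≈))
          (R.trans (R.sym (u-inside (≺⇒≉0 t≺0 , x′∈X))) (R.*-comm (u t) _)))))
      to t z (inj₂ (t∉ , z≈0)) = R.trans z≈0 (R.sym (u-outside λ (t≉0 , x∈X) →
        ⊥-elim (t∉ (≉0⇒≺0 t≉0 , _ , _ , R.refl , x∈X , R.refl))))

      from : ∀ t z → z ≈ u t → Sat φ (t ∷ z ∷ []) []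
      from t z z≈u = case em {P = Domain t} of λ where
        (yes (t≉0 , x∈X)) → inj₁ (≉0⇒≺0 t≉0 , _ , _ , R.refl , (x∈X , R.refl) ,
          R.trans (R.*-congʳ z≈u) (u-inside (t≉0 , x∈X)))
        (no  t∉) → inj₂ ((λ (t≺0 , x , y , x≈ , x∈X , _) → contradiction (≺⇒≉0 t≺0 , proj₁ (value-cong x≈ x∈X)) t∉) ,
          R.trans z≈u (u-outside t∉))

    abstract
      u-graph : Graph u
      u-graph = def-resp (λ { (t ∷ z ∷ []) → mk⇔ (to t z) (from t z) }) (def-sat φ)

    u-quotient : Ev (λ t → X w (t ^ b)) → Ev (λ t → u t * t ^ p ≈ value w (t ^ b) * t ^ q)
    u-quotient ev = ev-map (λ (x∈X , t≉0) → u-inside (t≉0 , x∈X)) (ev-∧ ev (ev-map ≺⇒≉0 (ev-below 1≉0)))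

    u∼c : ∀ {c} → Leading w b p q c → Ev (λ t → u t ∼ c)
    u∼c lead = ev-map (λ {t} (eq , _ , r) → *-cancelʳ-∼ (t ^ p) (∼-resp (R.sym eq) R.refl r))
      (ev-∧ (u-quotient (ev-map proj₁ lead)) lead)

    u-approximation : ∀ {c} → c ≉ 0# → Ev (λ t → c ≼ u t) → ∀ {r} → r ≉ 0# → ∃ λ a → Ev (λ t → r ≺ u t + - a)
    u-approximation c≉0 ev = approximation u-graph c≉0 ev

  -- Since v(u) is eventually v(k), an approximation `a` of `u` to a precision strictly beyond `k`
  -- already has the same class in RV as `u`.
  leading-exists : ∀ b p q {w k} → k ≉ 0# →
    Ev (λ t → X w (t ^ b) × value w (t ^ b) * t ^ q ≍ k * t ^ p) → ∃ λ c → Leading w b p q c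
  leading-exists b p q {w} {k} k≉0 ev =
    ev-∧ ev (ev-∧ (u-quotient (ev-map proj₁ ev)) (ev-map ≺⇒≉0 (ev-below 1≉0))) |>′ λ ev′ →
    ev-map (λ {t} ((_ , r) , eq , t≉0) → *-cancelʳ-≍ {u t} {k} (^-≉0 p t≉0) (≍-trans (≍-reflexive eq) r)) ev′ |>′ λ u≍k →
    u-approximation k≉0 (ev-map proj₂ u≍k) k≉0 |>′ λ (a , k≺) →
    a , ev-map (λ {t} (((x∈X , _) , eq , t≉0) , u≍k , k≺) → x∈X ,
      ∼-resp eq R.refl (*-monoˡ-∼ _ (^-≉0 p t≉0) (∼-sym (≼-≺-trans (proj₁ u≍k) (minus-sym-≺ k≺)))))
      (ev-∧ ev′ (ev-∧ u≍k k≺))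
    where open Quotients w b p q

  -- For ζᵇ = 1, the functions u(ζt) and u(t) have the same limit up to any
  -- precision but differ by the factor ζ^(p − q).
  no-roots-of-unity : ∀ b p q {w c} → Leading w b p q c → ∀ {ζ} → ζ ^ b ≈ 1# → ζ ≍ 1# → ζ ^ p ≈ ζ ^ q
  no-roots-of-unity b p q {w} {c} lead {ζ} ζᵇ≈1 ζ≍1 = by-contradiction λ ζᵖ≉ζ^q →
    -- The twist gives δ u(t) = ζᵖ (u(ζt) - u(t)). As v(u) = v(c) eventually, the precision `δ * c`
    -- is what contradicts this.
    let δ = ζ ^ q + - (ζ ^ p)
        δ≉0 : δ ≉ 0#
        δ≉0 δ≈0 = ζᵖ≉ζ^q (R.sym (R.trans (R.sym (minus-plus _ _)) (R.trans (R.+-congʳ δ≈0) (R.+-identityˡ _))))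
        ζ≉0 : ζ ≉ 0#
        ζ≉0 = unit-≉0 ζ≍1
        c≉0 : c ≉ 0#
        c≉0 = leading-≉0 b p q lead
    in u-approximation c≉0 (ev-map (λ p → proj₂ (∼⇒≍ p)) (u∼c lead)) (*-≉0 δ≉0 c≉0) |>′ λ (a , ev) →
    ev-∧ (u-quotient (ev-map proj₁ lead)) (ev-map ≺⇒≉0 (ev-below 1≉0)) |>′ λ quot →
    ev-witness (ev-∧ (ev-∧ ev (ev-scale ζ≉0 ev)) (ev-∧ (ev-∧ quot (ev-scale ζ≉0 quot)) (ev-∧ lead (u∼c lead))))
    |>′ λ (t , _ , (r , r′) , ((eq , t≉0) , eq′ , _) , (x∈X , _) , u∼c) →
    let x≈ : t ^ b ≈ (ζ * t) ^ b
        x≈ = R.sym (R.trans (^-distrib-* ζ t b) (R.trans (R.*-congʳ ζᵇ≈1) (R.*-identityˡ _)))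
        same : value w (t ^ b) ≈ value w ((ζ * t) ^ b)
        same = proj₂ (value-cong x≈ x∈X)
        twisted : ζ ^ p * u (ζ * t) ≈ ζ ^ q * u t
        twisted = *-cancelˡ (^-≉0 p t≉0) (R.trans
          (R.trans (solve 3 (λ a z u → a :* (z :* u) := u :* (z :* a)) R.refl (t ^ p) (ζ ^ p) (u (ζ * t))) (R.*-congˡ (R.sym (^-distrib-* ζ t p))))
          (R.trans eq′ (R.trans (R.*-cong (R.sym same) (^-distrib-* ζ t q))
            (R.trans (solve 3 (λ v z a → v :* (z :* a) := z :* (v :* a)) R.refl (value w (t ^ b)) (ζ ^ q) (t ^ q))
              (R.trans (R.*-congˡ (R.sym eq)) (solve 3 (λ z u a → z :* (u :* a) := a :* (z :* u)) R.refl (ζ ^ q) (u t) (t ^ p)))))))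
        δu : δ * u t ≈ ζ ^ p * (u (ζ * t) + - u t)
        δu = R.trans (minus-*ʳ (ζ ^ q) (ζ ^ p) (u t)) (R.trans (R.+-congʳ (R.sym twisted)) (R.sym (minus-*ˡ (ζ ^ p) _ _)))
    in ≺-≼-absurd (≺-≼-trans (minus-trans-≺ r′ (minus-sym-≺ r))
         (proj₂ (≍-trans (*-cong-≍ (^-unit p) (≍-refl {u (ζ * t) + - u t})) (≍-reflexive (R.*-identityˡ _)))))
         (≼-trans (≼-reflexive (R.sym δu)) (*-monoʳ-≼ δ (proj₁ (∼⇒≍ u∼c))))
    where
    open Quotients w b p q
    ^-unit : ∀ k → ζ ^ k ≍ 1#
    ^-unit zero    = ≍-refl
    ^-unit (suc k) = ≍-trans (*-cong-≍ ζ≍1 (^-unit k)) (≍-reflexive (R.*-identityˡ 1#))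

  ^-mono-≼ : ∀ k {x y} → x ≼ y → x ^ k ≼ y ^ k
  ^-mono-≼ zero    x≼y = ≼-refl
  ^-mono-≼ (suc k) x≼y = *-mono-≼ x≼y (^-mono-≼ k x≼y)

  ^-mono-≺ : ∀ k {x y} → y ≉ 0# → x ≺ y → x ^ suc k ≺ y ^ suc k
  ^-mono-≺ k {x} {y} y≉0 x≺y = ≼-≺-trans (*-monoʳ-≼ x (^-mono-≼ k (≺⇒≼ x≺y))) (*-monoˡ-≺ (y ^ k) (^-≉0 k y≉0) x≺y)

  ^-cancel-≺ : ∀ k {x y} → x ^ k ≺ y ^ k → x ≺ y
  ^-cancel-≺ k p y≼x = p (^-mono-≼ k y≼x)

  ^-swap : ∀ x m n → (x ^ m) ^ n ≈ (x ^ n) ^ m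
  ^-swap x m n = R.trans (^-assocʳ x m n) (R.trans (^-congʳ x (ℕ.*-comm m n)) (R.sym (^-assocʳ x n m)))

  ev-power : ∀ k {P : Pred K ℓ} → Ev P → Ev (λ t → P (t ^ suc k))
  ev-power k (s , s≉0 , p) = root k s |>′ λ (σ , σᵏ≈s) →
    let σ≉0 : σ ≉ 0#
        σ≉0 σ≈0 = s≉0 (R.trans (R.sym σᵏ≈s) (R.trans (R.*-congʳ σ≈0) (R.zeroˡ _)))
    in σ , σ≉0 , λ t t≺σ → p _ (≺-resp R.refl σᵏ≈s (^-mono-≺ k σ≉0 t≺σ))

  roots-≍1 : ∀ k {ζ} → ζ ^ suc k ≈ 1# → ζ ≍ 1#
  roots-≍1 k {ζ} ζᵏ≈1 =
    (case ≼-or-≻ ζ 1# of λ where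
      (inj₁ p) → p
      (inj₂ p) → ≺-≼-absurd (^-mono-≺ k (λ ζ≈0 → 1≉0 (R.trans (R.sym ζᵏ≈1) (R.trans (R.*-congʳ ζ≈0) (R.zeroˡ _)))) p)
        (≼-reflexive (R.trans ζᵏ≈1 (R.sym (^-1 (suc k)))))) ,
    (case ≼-or-≻ 1# ζ of λ where
      (inj₁ p) → p
      (inj₂ p) → ≺-≼-absurd (^-mono-≺ k 1≉0 p) (≼-reflexive (R.trans (^-1 (suc k)) (R.sym ζᵏ≈1))))

  LeadingWith : ℚ → Vec K d → K → Set ℓ
  LeadingWith r w = Leading w (↧ₙ r) (positivePart (↥ r)) (negativePart (↥ r))

  -- A root of unity with ζᵇ = 1 also has ζᵃ = 1 by `no-roots-of-unity`, and a, b are coprime; so ζ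
  -- = 1.
  denominator-power : ∀ {p} → CharacteristicExponent V p → ∀ r {w c} → LeadingWith r w c → ∃ λ m → ↧ₙ r ≡ p ℕ.^ m
  denominator-power char r@(mkℚ a b-1 coprime) lead = power-of-characteristic char (suc b-1) λ ζ ζᵇ≈1 →
    coprime-powers (Coprimality.recompute coprime)
      (numerator-power a (no-roots-of-unity (suc b-1) (positivePart a) (negativePart a) lead ζᵇ≈1 (roots-≍1 b-1 ζᵇ≈1))) ζᵇ≈1
    where
    numerator-power : ∀ a {ζ} → ζ ^ positivePart a ≈ ζ ^ negativePart a → ζ ^ ℤ.∣ a ∣ ≈ 1#
    numerator-power (+ n)    eq = eq
    numerator-power -[1+ n ] eq = R.sym eq

  -- Powers in K^× and in RV^*, which differ only in their equality
  module Powers (_~_ : K* V → K* V → Set ℓ) where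

    G : RawGroup ℓ ℓ
    G = record { RawGroup (Kˣ V) ; _≈_ = _~_ }

    pow-+ : ∀ k x → proj₁ (pow G (+ k) x) ≈ proj₁ x ^ k
    pow-+ zero    x = R.refl
    pow-+ (suc k) x = R.*-congˡ (pow-+ k x)

    pow-* : ∀ a x → proj₁ (pow G a x) * proj₁ x ^ negativePart a ≈ proj₁ x ^ positivePart a
    pow-* (+ k)    x = R.trans (R.*-identityʳ _) (pow-+ k x)
    pow-* -[1+ k ] x = R.trans (R.*-comm _ _) (R.trans (R.*-congʳ (R.sym (pow-+ (suc k) x)))
      (proj₂ (inverse (proj₁ y) (proj₂ y))))
      where
      y : K* V
      y = pow G (+ suc k) x

    -- So `pow G a t` serves as x^(a/k). The equation is checked after multiplication by `x` to the
    -- power `negativePart a`.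
    pow-root : ∀ a k t x → proj₁ t ^ k ≈ proj₁ x → proj₁ (pow G (+ k) (pow G a t)) ≈ proj₁ (pow G a x)
    pow-root a k t x tᵏ≈x = *-cancelˡ (^-≉0 (negativePart a) (proj₂ x)) (R.trans (R.*-comm _ _)
      (R.trans (R.*-cong (pow-+ k (pow G a t)) (R.trans (^-congˡ (negativePart a) (R.sym tᵏ≈x)) (^-swap (proj₁ t) k (negativePart a))))
      (R.trans (R.sym (^-distrib-* (proj₁ (pow G a t)) (proj₁ t ^ negativePart a) k))
      (R.trans (^-congˡ k (pow-* a t))
      (R.trans (^-swap (proj₁ t) (positivePart a) k)
      (R.trans (^-congˡ (positivePart a) tᵏ≈x)
      (R.trans (R.sym (pow-* a x)) (R.*-comm _ _))))))))

  -- From the slope of the factorization to the monomial in RV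

  RV≈⇒∼ : ∀ {x y : K* V} → RawGroup._≈_ (RV* V) x y → proj₁ x ∼ proj₁ y
  RV≈⇒∼ {x} {y , y≉0} (m , m∈𝓜 , x≈) = ≺-resp (R.*-identityˡ y)
    (R.trans (solve 3 (λ m y o → m :* y := y :* (o :+ m) :+ :- (y :* o)) R.refl m y 1#)
      (R.+-cong (R.sym x≈) (R.-‿cong (R.*-identityʳ y))))
    (*-monoˡ-≺ y y≉0 (Equivalence.to (<⁺⇔≺ m v-1) m∈𝓜))

  ∼⇒RV≈ : ∀ {x y : K* V} → proj₁ x ∼ proj₁ y → RawGroup._≈_ (RV* V) x y
  ∼⇒RV≈ {x , _} {y , y≉0} x∼y = divide x y≉0 |>′ λ (z , zy≈x) → z + - 1# ,
    Equivalence.from (<⁺⇔≺ (z + - 1#) v-1) (*-cancelʳ-≺ y (≺-resp (R.sym (R.*-identityˡ y))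
      (R.trans (R.+-cong (R.sym zy≈x) (R.-‿cong (R.sym (R.*-identityˡ y)))) (R.sym (minus-*ʳ z 1# y))) x∼y)) ,
    R.trans (R.sym zy≈x) (R.trans (R.*-comm z y) (R.*-congˡ (solve 2 (λ z o → z := o :+ (z :+ :- o)) R.refl z 1#)))

  open RawMonoidDefs (RawGroup.rawMonoid Γ.rawGroup) using () renaming (_×_ to _·_)

  v-^ : ∀ k {x γ} → v x Γ.≈⁺ [ γ ] → v (x ^ k) Γ.≈⁺ [ k · γ ]
  v-^ zero    vx≈γ = v-1
  v-^ (suc k) vx≈γ = v-product vx≈γ (v-^ k vx≈γ)

  module _ {Λ} (isHom : IsEndomorphism V Λ) where
    open GroupMorphisms.IsGroupHomomorphism isHom

    hom-· : ∀ k γ → Λ (k · γ) Γ.≈ (k · Λ γ)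
    hom-· zero    γ = ε-homo
    hom-· (suc k) γ = Γ.trans (homo _ _) (Γ.∙-congˡ (hom-· k γ))

  pow-· : ∀ a γ → (pow Γ.rawGroup a γ Γ.+ (negativePart a · γ)) Γ.≈ (positivePart a · γ)
  pow-· (+ k)    γ = Γ.identityʳ _
  pow-· -[1+ k ] γ = Γ.inverseˡ _

  -- With v(t) = γ and r = a/b, linearity at bγ gives v(f(tᵇ)) = Λ(bγ) + α = aγ + α. So f(tᵇ)/tᵃ
  -- eventually has the value `α`, which `k` realizes.
  leading-from-slope : (H : ΓFamily V W) → FactorizesAtInfinity V F H → DefinedNearInfinity V F →
    ∀ {w} → W w → ∀ r {δ α Λ} → IsEndomorphism V Λ → IsMultiplication V r Λ →
    (∀ γ → γ Γ.< δ → ΓFamily.Y H w γ × ΓFamily.h H w γ Γ.≈ (Λ γ Γ.+ α)) → ∃ λ c → LeadingWith r w c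
  leading-from-slope H factorizes defined {w} w∈W r@(mkℚ a b-1 _) {δ} {α} {Λ} isHom multiplies linear =
    v-realize [ α ] |>′ λ (k , vk≈α) →
    leading-exists (suc b-1) (positivePart a) (negativePart a) (v-finite⁻¹ vk≈α)
      (ev-map (λ {t} (large , t≉0) → at k vk≈α t t≉0 large) (ev-∧ (ev-power b-1 near) (ev-map ≺⇒≉0 (ev-below 1≉0))))
    where
    open ΓFamily H
    open GroupMorphisms.IsGroupHomomorphism isHom using () renaming (⟦⟧-cong to Λ-cong)

    Near : K → Set ℓ
    Near x = X w x × ∃ λ γ → v x Γ.≈⁺ [ γ ] × γ Γ.< δ × v (value w x) Γ.≈⁺ [ h w γ ]

    realize : ∀ γ → ∃ λ s → v s Γ.≈⁺ [ γ ] × s ≉ 0#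
    realize γ = v-surjective γ |>′ λ (s , vs≈γ) → s , vs≈γ , v-finite⁻¹ vs≈γ

    near : Ev Near
    near = defined w w∈W |>′ λ (γ₁ , X-near) → factorizes w w∈W |>′ λ (γ₂ , h-near) →
      realize γ₁ |>′ λ (s₁ , vs₁ , s₁≉0) → realize γ₂ |>′ λ (s₂ , vs₂ , s₂≉0) → realize δ |>′ λ (s₃ , vs₃ , s₃≉0) →
      ev-map (λ {x} (x≺s₁ , x≺s₂ , x≺s₃) →
        let x* : K* V
            x* = x , ≺⇒≉0 x≺s₁
            x∈X = X-near x* (Equivalence.from (>⁺⇔≻ x vs₁) x≺s₁)
            γ , vx≈γ , _ , vf≈ = h-near x* (Equivalence.from (>⁺⇔≻ x vs₂) x≺s₂) x∈X
        in x∈X , γ , vx≈γ , v-< vx≈γ vs₃ x≺s₃ , vf≈)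
      (ev-∧ (ev-below s₁≉0) (ev-∧ (ev-below s₂≉0) (ev-below s₃≉0)))

    at : ∀ k → v k Γ.≈⁺ [ α ] → ∀ t → t ≉ 0# → Near (t ^ suc b-1) →
      X w (t ^ suc b-1) × value w (t ^ suc b-1) * t ^ negativePart a ≍ k * t ^ positivePart a
    at k vk≈α t t≉0 (x∈X , γ′ , vx≈γ′ , γ′<δ , vf≈) = v-finite t≉0 |>′ λ (γ , vt≈γ) →
      x∈X , v-≍ (≈⁺-trans (v-product vf≈ (v-^ (negativePart a) vt≈γ)) SupEq.[ slope-eq γ (SupEq.[≈]-injective _
                  (≈⁺-trans (≈⁺-sym vx≈γ′) (v-^ (suc b-1) vt≈γ))) ])
                (v-product vk≈α (v-^ (positivePart a) vt≈γ))
      where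
      slope-eq : ∀ γ → γ′ Γ.≈ (suc b-1 · γ) → (h w γ′ Γ.+ (negativePart a · γ)) Γ.≈ (α Γ.+ (positivePart a · γ))
      slope-eq γ γ′≈ = Γ.trans (Γ.∙-congʳ (Γ.trans (proj₂ (linear γ′ γ′<δ)) (Γ.trans
          (Γ.∙-congʳ (Γ.trans (Λ-cong γ′≈) (Γ.trans (hom-· isHom (suc b-1) γ) (multiplies γ)))) (Γ.comm _ α))))
        (Γ.trans (Γ.assoc α _ _) (Γ.∙-congˡ (pow-· a γ)))

  -- Every `x` has a root `t` of order `suc k`, and x ≺ s^(k+1) forces `t ≺ s`.
  near-infinity : ∀ k {P : Pred K ℓ} {Q : Pred (K* V) ℓ} → Ev P →
    (∀ (t x : K* V) → proj₁ t ^ suc k ≈ proj₁ x → P (proj₁ t) → Q x) → NearInfinity V Q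
  near-infinity k (s , s≉0 , p) f = v-finite (^-≉0 (suc k) s≉0) |>′ λ (γ , vs≈γ) → γ , λ x vx<γ →
    Equivalence.to (>⁺⇔≻ (proj₁ x) vs≈γ) vx<γ |>′ λ x≺s →
    root k (proj₁ x) |>′ λ (t , tᵏ≈x) →
    ^-cancel-≺ (suc k) {t} {s} (≺-resp (R.sym tᵏ≈x) R.refl x≺s) |>′ λ t≺s →
    f (t , ≺⇒≉0 t≺s) x tᵏ≈x (p t t≺s)

  module _ (r : ℚ) {w c} (lead : LeadingWith r w c) p m (b≡pᵐ : ↧ₙ r ≡ p ℕ.^ m) where

    private
      a : ℤ
      a = ↥ r

      b-1 p′ q′ : ℕ
      b-1 = ℕ.pred (↧ₙ r)
      p′ = positivePart a
      q′ = negativePart a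

      c≉0 : c ≉ 0#
      c≉0 = leading-≉0 (↧ₙ r) p′ q′ lead

      module RVPow = Powers (RawGroup._≈_ (RV* V))
      module KPow = Powers (RawGroup._≈_ (Kˣ V))
      open Quotients w (↧ₙ r) p′ q′

    rv-monomial : ∀ {c*} → proj₁ c* ≡ c → RVMonomialAtInfinity V F w a p (+ m) c*
    rv-monomial {c*} ≡.refl = near-infinity b-1 lead λ t x tᵇ≈x (x∈X , eq) →
      value-cong tᵇ≈x x∈X |>′ λ (x∈X , v≈) →
      x∈X , pow (RV* V) a t ,
      ∼⇒RV≈ {pow (RV* V) (+ (p ℕ.^ m)) (pow (RV* V) a t)} {pow (RV* V) a x} (∼-reflexive (proj₂ (pow (RV* V) a x)) (RVPow.pow-root a (p ℕ.^ m) t x (R.trans (^-congʳ (proj₁ t) (≡.sym b≡pᵐ)) tᵇ≈x))) ,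
      ∼⇒RV≈ {f w (proj₁ x)} {RawGroup._∙_ (RV* V) (pow (RV* V) a t) c*} (*-cancelʳ-∼ (proj₁ t ^ q′) (∼-resp (R.*-congʳ v≈)
        (R.trans (R.*-congˡ (R.sym (RVPow.pow-* a t)))
          (solve 3 (λ c z y → c :* (z :* y) := (z :* c) :* y) R.refl c (proj₁ (pow (RV* V) a t)) (proj₁ t ^ q′))) eq))

    -- The limit from definable completeness

    module _ (complete : DefinablyComplete V) where

      private
        positive : Fm 0 1
        positive = ` 0F ≺ᶠ # 0#

        -- The first variable approximates `u` near infinity to precision `r`. For fixed `r` such
        -- points form an open ball of radius v(r); completeness is applied to this nested family.
        χ : Fm 0 2
        χ = ` 1F ≺ᶠ # 0# ∧ᶠ evᶠ (` 3F ≺ᶠ fn u u-graph (` 0F) ⊕ ⊝ (` 2F))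

        Radius : Pred (Vec K 1) ℓ
        Radius xs = Sat positive xs []

        Approximant : Vec K 1 → K → Set ℓ
        Approximant xs x = Sat χ (x ∷ xs) []

        near-approximant : ∀ {r} → r ≉ 0# → ∃ λ a → Ev (λ t → r ≺ u t + - a)
        near-approximant = u-approximation c≉0 (ev-map (λ p → proj₂ (∼⇒≍ p)) (u∼c lead))

        approximants-ball : ∀ {r γ a} → v r Γ.≈⁺ [ γ ] → Ev (λ t → r ≺ u t + - a) →
          ∀ x → Approximant (r ∷ []) x ⇔ members V (open′ a [ γ ]) x
        approximants-ball {r} {γ} {a} vr≈γ ev x = mk⇔
          (λ (_ , sat) → ev-witness (ev-∧ ev (sat⇒ev sat)) |>′ λ (t , _ , p , q) →
            Equivalence.from (<⁺⇔≺ _ vr≈γ) (minus-trans-≺ (minus-sym-≺ q) p))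
          (λ x∈ → ≉0⇒≺0 (v-finite⁻¹ vr≈γ) ,
            ev⇒sat (ev-map (λ p → minus-trans-≺ p (minus-sym-≺ (Equivalence.to (<⁺⇔≺ _ vr≈γ) x∈))) ev))

        ball-of-radius : ∀ {r} γ → v r Γ.≈⁺ [ γ ] → ∃ λ a → ∀ x → Approximant (r ∷ []) x ⇔ members V (open′ a [ γ ]) x
        ball-of-radius γ vr≈γ = near-approximant (v-finite⁻¹ vr≈γ) |>′ λ (a , ev) → a , approximants-ball vr≈γ ev

        balls : ∀ xs → Radius xs → ∃ λ B → Approximant xs ≐ members V B
        balls (r ∷ []) r≺0 = v-finite (≺⇒≉0 r≺0) |>′ λ (γ , vr≈γ) → ball-of-radius γ vr≈γ |>′ λ (a , iff) →
          open′ a [ γ ] , (λ {x} → Equivalence.to (iff x)) , (λ {x} → Equivalence.from (iff x))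

        nonempty : ∀ {xs} → (∃ λ x → Approximant xs x) ⇔ Radius xs
        nonempty {r ∷ []} = mk⇔ (λ (x , r≺0 , _) → r≺0)
          (λ r≺0 → near-approximant (≺⇒≉0 r≺0) |>′ λ (a , ev) → a , r≺0 , ev⇒sat ev)

        nested : ∀ xs ys → Radius xs → Radius ys →
          (∀ x → Approximant xs x → Approximant ys x) ⊎ (∀ x → Approximant ys x → Approximant xs x)
        nested (r ∷ []) (r′ ∷ []) r≺0 r′≺0 = Sum.map
          (λ r′≼r x (_ , sat) → r′≺0 , ev⇒sat (ev-map (≼-≺-trans r′≼r) (sat⇒ev sat)))
          (λ r≼r′ x (_ , sat) → r≺0 , ev⇒sat (ev-map (≼-≺-trans r≼r′) (sat⇒ev sat))) (≼-total r′ r)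

        small : ∀ γ → ∃ λ xs → Radius xs × ∃ λ B → (Approximant xs ≐ members V B) × [ [ γ ] ] Γ.<± radius V B
        small γ = v-realize [ γ ] |>′ λ (l , vl≈γ) → larger (v-finite⁻¹ vl≈γ) |>′ λ (r , l≺r , r≉0) →
          v-finite r≉0 |>′ λ (γ′ , vr≈γ′) → ball-of-radius γ′ vr≈γ′ |>′ λ (a , iff) →
          (r ∷ []) , ≉0⇒≺0 r≉0 , open′ a [ γ′ ] , ((λ {x} → Equivalence.to (iff x)) , (λ {x} → Equivalence.from (iff x))) ,
          SupStrict.[ InfStrict.[ v-< vl≈γ vr≈γ′ l≺r ] ]

        abstract
          point : ∃ λ x → ∀ xs → Radius xs → Approximant xs x
          point = complete Radius Approximant
            (def-resp (λ { (r ∷ []) → mk⇔ id id }) (def-sat positive))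
            (def-resp (λ { (x ∷ r ∷ []) → mk⇔ id id }) (def-sat χ))
            (λ {xs} → nonempty {xs}) balls nested small

        limit : K
        limit = proj₁ point

        u→limit : ∀ {r} → r ≉ 0# → Ev (λ t → r ≺ u t + - limit)
        u→limit r≉0 = sat⇒ev (proj₂ (proj₂ point (_ ∷ []) (≉0⇒≺0 r≉0)))

        c∼limit : c ∼ limit
        c∼limit = ev-witness (ev-∧ (u→limit c≉0) (u∼c lead)) |>′ λ (t , _ , p , q) →
          ∼-sym (minus-sym-≺ (minus-trans-≺ (minus-sym-≺ q) p))

        limit≉0 : limit ≉ 0#
        limit≉0 = ∼⇒≉0ʳ c∼limit

      has-limit : ∀ {c*} → proj₁ c* ≡ c → HasLimitWithRV V F w a p (+ m) c*
      has-limit {c*} ≡.refl = limit ,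
        (λ γ → v-realize [ γ ] |>′ λ (r , vr≈γ) →
          near-infinity b-1 (ev-∧ (u→limit (v-finite⁻¹ vr≈γ)) (ev-∧ (u-quotient (ev-map proj₁ lead)) lead))
            λ t x tᵇ≈x (r≺ , quot , x∈X , _) →
            value-cong tᵇ≈x x∈X |>′ λ (x∈X , v≈) →
            let z : K* V
                z = pow (Kˣ V) a t
                z⁻¹ : K* V
                z⁻¹ = RawGroup._⁻¹ (Kˣ V) z
                zz⁻¹≈1 : proj₁ z * proj₁ z⁻¹ ≈ 1#
                zz⁻¹≈1 = proj₂ (inverse (proj₁ z) (proj₂ z))
                y = value w (proj₁ x) * proj₁ z⁻¹
                uz≈value : u (proj₁ t) * proj₁ z ≈ value w (proj₁ x)
                uz≈value = *-cancelˡ (^-≉0 q′ (proj₂ t)) (R.trans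
                  (solve 3 (λ y u z → y :* (u :* z) := u :* (z :* y)) R.refl (proj₁ t ^ q′) (u (proj₁ t)) (proj₁ z))
                  (R.trans (R.*-congˡ (KPow.pow-* a t)) (R.trans quot (R.trans (R.*-congʳ v≈) (R.*-comm _ _)))))
                u≈y : u (proj₁ t) ≈ y
                u≈y = R.trans (R.sym (R.*-identityʳ _)) (R.trans (R.*-congˡ (R.sym zz⁻¹≈1))
                  (R.trans (R.sym (R.*-assoc _ _ _)) (R.*-congʳ uz≈value)))
            in y , (x∈X , z , KPow.pow-root a (p ℕ.^ m) t x (R.trans (^-congʳ (proj₁ t) (≡.sym b≡pᵐ)) tᵇ≈x) , R.refl) ,
               Equivalence.from (<⁺⇔≺ _ vr≈γ) (≺-resp R.refl (R.+-congʳ u≈y) r≺)) ,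
        limit≉0 , ∼⇒RV≈ {c*} {limit , limit≉0} c∼limit

  -- The partition by slopes and the coefficient function

  module Partition (W-definable : Definable M W) where

    leadingAt : ∀ {n} → ℚ → Fm d (suc n)
    leadingAt r = leadingᶠ (↧ₙ r) (positivePart (↥ r)) (negativePart (↥ r))

    Wᶠ : ∀ {n} → Fm d n
    Wᶠ = atom {m = 0} W W-definable []

    slopeᶠ : ∀ {n} → ℚ → Fm d n
    slopeᶠ r = Wᶠ ∧ᶠ exᶠ (leadingAt r)

    -- the parameters w for which r is the first slope in the list
    part : (Z : List ℚ) → Fin (length Z) → Fm d 0
    part (r ∷ Z) zero    = slopeᶠ r
    part (r ∷ Z) (suc i) = (slopeᶠ r ⇒ᶠ falseᶠ) ∧ᶠ part Z i

    -- The first-slope selection of `part` is repeated so that one formula describes the class c(w)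
    -- in RV on all parts at once.
    coefficientᶠ : List ℚ → Fm d 1
    coefficientᶠ []      = falseᶠ
    coefficientᶠ (r ∷ Z) = (Wᶠ ∧ᶠ leadingAt r) ∨ᶠ ((slopeᶠ r ⇒ᶠ falseᶠ) ∧ᶠ coefficientᶠ Z)

    Part : (Z : List ℚ) → Fin (length Z) → Pred (Vec K d) ℓ
    Part Z i w = Sat (part Z i) [] w

    Coefficient : List ℚ → Vec K d → K → Set ℓ
    Coefficient Z w y = Sat (coefficientᶠ Z) (y ∷ []) w

    toLeading : ∀ r {n} {ρ : Vec K n} {w y} → Sat (leadingAt r) (y ∷ ρ) w → LeadingWith r w y
    toLeading r {ρ = ρ} = sat⇒leading (↧ₙ r) (positivePart (↥ r)) (negativePart (↥ r)) {ρ = ρ}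

    fromLeading : ∀ r {n} {ρ : Vec K n} {w y} → LeadingWith r w y → Sat (leadingAt r) (y ∷ ρ) w
    fromLeading r {ρ = ρ} = leading⇒sat (↧ₙ r) (positivePart (↥ r)) (negativePart (↥ r)) {ρ = ρ}

    coefficient⇒leading : ∀ Z i {w y} → Part Z i w → Coefficient Z w y → LeadingWith (List.lookup Z i) w y
    coefficient⇒leading (r ∷ Z) zero    q        (inj₁ (_ , l))   = toLeading r {ρ = []} l
    coefficient⇒leading (r ∷ Z) zero    q        (inj₂ (¬q , _))  = ⊥-elim (¬q q)
    coefficient⇒leading (r ∷ Z) (suc i) (¬q , _) (inj₁ (w∈W , l)) = ⊥-elim (¬q (w∈W , _ , l))
    coefficient⇒leading (r ∷ Z) (suc i) (_ , q)  (inj₂ (_ , l))   = coefficient⇒leading Z i q l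

    leading⇒coefficient : ∀ Z i {w y} → Part Z i w → LeadingWith (List.lookup Z i) w y → Coefficient Z w y
    leading⇒coefficient (r ∷ Z) zero    (w∈W , _) l = inj₁ (w∈W , fromLeading r {ρ = []} l)
    leading⇒coefficient (r ∷ Z) (suc i) (¬q , q)  l = inj₂ (¬q , leading⇒coefficient Z i q l)

    part⇒leading : ∀ Z i {w} → Part Z i w → W w × ∃ λ y → LeadingWith (List.lookup Z i) w y
    part⇒leading (r ∷ Z) zero    (w∈W , y , l) = w∈W , y , toLeading r {ρ = []} l
    part⇒leading (r ∷ Z) (suc i) (_ , q)       = part⇒leading Z i q

    coefficient⇒W : ∀ Z {w y} → Coefficient Z w y → W w
    coefficient⇒W (r ∷ Z) (inj₁ (w∈W , _)) = w∈W
    coefficient⇒W (r ∷ Z) (inj₂ (_ , l))   = coefficient⇒W Z l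

    part-covers : ∀ Z {w r c} → W w → r ∈ Z → LeadingWith r w c → ∃ λ i → Part Z i w
    part-covers (r ∷ Z) w∈W (here ≡.refl) l = zero , w∈W , _ , fromLeading r {ρ = []} l
    part-covers (r ∷ Z) {w} w∈W (there r∈Z) l = case em {P = Sat (slopeᶠ r) [] w} of λ where
      (yes q) → zero , q
      (no ¬q) → part-covers Z w∈W r∈Z l |>′ λ (i , q) → suc i , (λ p → contradiction p ¬q) , q

    part-disjoint : ∀ Z {i j w} → Part Z i w → Part Z j w → i ≡ j
    part-disjoint (r ∷ Z) {zero}  {zero}  p        q        = ≡.refl
    part-disjoint (r ∷ Z) {zero}  {suc j} p        (¬p , _) = ⊥-elim (¬p p)
    part-disjoint (r ∷ Z) {suc i} {zero}  (¬q , _) q        = ⊥-elim (¬q q)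
    part-disjoint (r ∷ Z) {suc i} {suc j} (_ , p)  (_ , q)  = ≡.cong suc (part-disjoint Z p q)

    module _ (Z : List ℚ) where

      coefficient : Vec K d → K* V
      coefficient w with em {P = ∃ λ y → y ≉ 0# × Coefficient Z w y}
      ... | yes (y , y≉0 , _) = y , y≉0
      -- A placeholder; on every part a coefficient exists.
      ... | no  _             = 1# , 1≉0

      coefficient-leading : ∀ i {w} → Part Z i w → LeadingWith (List.lookup Z i) w (proj₁ (coefficient w))
      coefficient-leading i {w} q with em {P = ∃ λ y → y ≉ 0# × Coefficient Z w y}
      ... | yes (y , y≉0 , l) = coefficient⇒leading Z i q l
      ... | no  none = part⇒leading Z i q |>′ λ (_ , y , l) → contradiction
        (y , leading-≉0 (↧ₙ r) (positivePart (↥ r)) (negativePart (↥ r)) l , leading⇒coefficient Z i q l) none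
        where
        r : ℚ
        r = List.lookup Z i

      module _ (covered : ∀ {w} → W w → ∃ λ i → Part Z i w) where

        partition : IsDefinablePartition V W (Part Z)
        partition = record
          { definable = λ i → def-sat (part Z i)
          ; covers    = λ w → mk⇔ covered (λ (i , q) → proj₁ (part⇒leading Z i q))
          ; disjoint  = part-disjoint Z
          }

        coefficient-definable : DefinableRV V W coefficient
        coefficient-definable = def-resp (λ { (y ∷ w) → mk⇔
          (λ l → coefficient⇒W Z l |>′ λ w∈W → covered w∈W |>′ λ (i , q) →
            let r = List.lookup Z i
                y∼c = leading-unique (↧ₙ r) (positivePart (↥ r)) (negativePart (↥ r))
                  (coefficient⇒leading Z i q l) (coefficient-leading i q)
            in w∈W , ∼⇒≉0ʳ (∼-sym y∼c) , ∼⇒RV≈ {y , ∼⇒≉0ʳ (∼-sym y∼c)} {coefficient w} y∼c)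
          (λ (w∈W , y≉0 , y≈c) → covered w∈W |>′ λ (i , q) →
            let r = List.lookup Z i
            in leading⇒coefficient Z i q (leading-∼ (↧ₙ r) (positivePart (↥ r)) (negativePart (↥ r))
                 (∼-sym (RV≈⇒∼ {y , y≉0} {coefficient w} y≈c)) (coefficient-leading i q))) })
          (def-sat (coefficientᶠ Z))

  -- The denominator is known to be a power of `p` only if the part of `r` is inhabited; the default
  -- `+ 0` can occur only for an empty part.
  exponent : ℕ → ℚ → ℤ
  exponent p r with em {P = ∃ λ m → ↧ₙ r ≡ p ℕ.^ m}
  ... | yes (m , _) = + m
  ... | no  _       = + 0

  exponent-spec : ∀ p r → (∃ λ m → ↧ₙ r ≡ p ℕ.^ m) → ∃ λ m → exponent p r ≡ + m × ↧ₙ r ≡ p ℕ.^ m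
  exponent-spec p r power with em {P = ∃ λ m → ↧ₙ r ≡ p ℕ.^ m}
  ... | yes (m , eq) = m , ≡.refl , eq
  ... | no  none     = contradiction power none

theorem5p4 :
    (∀ {a} → ExcludedMiddle a) →
    ∀ {ℓ} {E : Language ℓ} (M : Structure ℓ (Ldiv+ E)) (V : ValuedField M) →
    AlgebraicallyClosed V → CMinimal M →
    (p : ℕ) → CharacteristicExponent V p →
    ∀ {d} (W : Pred (Vec (Structure.Carrier M) d) ℓ) → Definable M W →
    (F : KFamily V W) → DefinedNearInfinity V F →
    (H : ΓFamily V W) → FactorizesAtInfinity V F H →
    EventuallyℚLinearAtInfinity V H →
    ∃ λ (k : ℕ) → Σ (Fin k → Pred (Vec (Structure.Carrier M) d) ℓ) λ P →
    Σ (Fin k → ℤ) λ n → Σ (Fin k → ℤ) λ m →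
    Σ (Vec (Structure.Carrier M) d → RawGroup.Carrier (RV* V)) λ c →
      IsDefinablePartition V W P ×
      DefinableRV V W c ×
      (∀ i w → P i w → RVMonomialAtInfinity V F w (n i) p (m i) (c w)) ×
      (DefinablyComplete V → AllDefinableΓ→ΓEventuallyLinear V →
        ∀ i w → P i w → HasLimitWithRV V F w (n i) p (m i) (c w))
theorem5p4 em M V ac cminimal p char W W-definable F defined H factorizes (Z , linear) =
  length Z , Part Z , (λ i → ↥ slope-at i) , (λ i → exponent p (slope-at i)) , coefficient Z ,
  partition Z covered , coefficient-definable Z covered ,
  (λ i w q → spec i q |>′ λ (m , eq , b≡pᵐ) →
    ≡.subst (λ m → RVMonomialAtInfinity V F w (↥ slope-at i) p m (coefficient Z w)) (≡.sym eq)
      (rv-monomial (slope-at i) {w} (coefficient-leading Z i q) p m b≡pᵐ {coefficient Z w} ≡.refl)) ,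
  (λ complete _ i w q → spec i q |>′ λ (m , eq , b≡pᵐ) →
    ≡.subst (λ m → HasLimitWithRV V F w (↥ slope-at i) p m (coefficient Z w)) (≡.sym eq)
      (has-limit (slope-at i) {w} (coefficient-leading Z i q) p m b≡pᵐ complete {coefficient Z w} ≡.refl))
  where
  open Families em M V ac cminimal F
  open Partition W-definable

  slope-at : Fin (length Z) → ℚ
  slope-at = List.lookup Z

  covered : ∀ {w} → W w → ∃ λ i → Part Z i w
  covered {w} w∈W = linear w w∈W |>′ λ (r , r∈Z , δ , α , Λ , isHom , multiplies , lin) →
    leading-from-slope H factorizes defined w∈W r isHom multiplies lin |>′ λ (c , lead) →
    part-covers Z w∈W r∈Z lead

  spec : ∀ i {w} → Part Z i w → ∃ λ m → exponent p (slope-at i) ≡ + m × ↧ₙ slope-at i ≡ p ℕ.^ m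
  spec i q = exponent-spec p (slope-at i) (denominator-power char (slope-at i) (coefficient-leading Z i q))
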